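{- There exists a family of Boolean functions $f$ such that $$\mathrm{fbs}(f) = \left(\frac{1}{\sqrt{6}} - o(1)\right)\mathrm{bs}(f)^{3/2},$$ where $o(1)$ is as $\mathrm{bs}(f)\to\infty$ along the family. Explicitly: there exist a sequence of positive integers $(n_k)_{k\ge 1}$, Boolean functions $f_k:\{0,1\}^{n_k}\to\{0,1\}$, and real numbers $\varepsilon_k$ with $\varepsilon_k\to 0$ as $k\to\infty$, such that $\mathrm{bs}(f_k)\to\infty$ as $k\to\infty$ and $$\mathrm{fbs}(f_k)=\left(\frac{1}{\sqrt{6}}-\varepsilon_k\right)\mathrm{bs}(f_k)^{3/2}\quad\text{for every } k\ge 1.$$
   Context: Let $f:\{0,1\}^n\to\{0,1\}$ be a Boolean function and write $[n]=\{1,\dots,n\}$. For $x\in\{0,1\}^n$ and $P\subseteq[n]$, let $x^P$ denote the input obtained from $x$ by flipping every bit $x_i$ with $i\in P$. A set $B\subseteq[n]$ is called a sensitive block of $x$ if $f(x)\neq f(x^B)$. Block sensitivity: $\mathrm{bs}(f,x)$ is the maximum number $t$ such that there are $t$ pairwise disjoint subsets $B_1,\dots,B_t$ of $[n]$ with $f(x)\neq f(x^{B_i})$ for each $i$. The block sensitivity of $f$ is $\mathrm{bs}(f)=\max_{x\in\{0,1\}^n}\mathrm{bs}(f,x)$. Fractional block sensitivity: $\mathrm{fbs}(f,x)$ is the optimal value of the linear program in which each sensitive block $B$ of $x$ is assigned a real weight $w_B$: maximize $\sum_{B:\, f(x)\neq f(x^B)} w_B$ subject to $\sum_{B\ni i}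 w_B\le 1$ for every $i\in[n]$ (the sum being over sensitive blocks $B$ of $x$ containing $i$) and $0\le w_B\le 1$ for every sensitive block $B$. The fractional block sensitivity of $f$ is $\mathrm{fbs}(f)=\max_{x\in\{0,1\}^n}\mathrm{fbs}(f,x)$. -}

module Defs where

open import Data.Bool.Base using (Bool; _xor_)
import Data.Bool.Properties as Bool
open import Data.Fin.Base using (Fin)
open import Data.Fin.Subset using (Subset; inside; outside; _∩_; Empty)
open import Data.Fin.Subset.Properties using (_∈?_)
open import Data.Integer.Base as ℤ using (+_)
import Data.Integer.Properties as ℤ
open import Data.List.Base using (List; []; _∷_; _++_; map; filter; foldr)
open import Data.Nat.Base as ℕ using (ℕ; zero; suc; s≤s; z≤n)
import Data.Nat.Properties as ℕ
open import Data.Nat.Solver using () renaming (module +-*-Solver to ℕ-Solver)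
open import Data.Product.Base using (Σ; ∃; _×_; _,_)
open import Data.Rational.Base as ℚ using (ℚ; 0ℚ; 1ℚ; ½; mkℚ)
import Data.Rational.Properties as ℚ
open import Data.Rational.Solver using () renaming (module +-*-Solver to ℚ-Solver)
import Data.Rational.Unnormalised.Base as ℚᵘ
import Data.Rational.Unnormalised.Properties as ℚᵘ
open import Data.Sum.Base using (inj₁; inj₂)
open import Data.Vec.Base using (Vec; []; _∷_; zipWith)
open import Relation.Binary.PropositionalEquality
open import Relation.Nullary using (yes; no; contradiction)
open import Relation.Nullary.Decidable using (¬?; _×-dec_)
open import Relation.Unary using (Decidable)

-- ℝ consists of Cauchy sequences of rationals with a modulus, and is a setoid
-- under _≃_; propositional equality on ℝ is meaningless.
Cauchy : (ℕ → ℚ) → Set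
Cauchy s = ∀ ε → 0ℚ ℚ.< ε →
  ∃ λ N → ∀ m n → N ℕ.≤ m → N ℕ.≤ n → ℚ.∣ s m ℚ.- s n ∣ ℚ.≤ ε

record ℝ : Set where
  constructor mkℝ
  field
    seq    : ℕ → ℚ
    cauchy : Cauchy seq

open ℝ public

infix 4 _≃_ _≤_ _<_

_≃_ : ℝ → ℝ → Set
x ≃ y = ∀ ε → 0ℚ ℚ.< ε →
  ∃ λ N → ∀ n → N ℕ.≤ n → ℚ.∣ seq x n ℚ.- seq y n ∣ ℚ.≤ ε

_≤_ : ℝ → ℝ → Set
x ≤ y = ∀ ε → 0ℚ ℚ.< ε →
  ∃ λ N → ∀ n → N ℕ.≤ n → seq x n ℚ.≤ seq y n ℚ.+ ε

_<_ : ℝ → ℝ → Set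
x < y = ∃ λ δ → 0ℚ ℚ.< δ ×
  ∃ λ N → ∀ n → N ℕ.≤ n → seq x n ℚ.+ δ ℚ.≤ seq y n

private

  module _ where
    open ℚ-Solver

    ½+½ : ∀ p → ½ ℚ.* p ℚ.+ ½ ℚ.* p ≡ p
    ½+½ = solve 1 (λ p → con ½ :* p :+ con ½ :* p := p) refl

    +-diff : ∀ a b c d → (a ℚ.+ b) ℚ.- (c ℚ.+ d) ≡ (a ℚ.- c) ℚ.+ (b ℚ.- d)
    +-diff = solve 4 (λ a b c d → (a :+ b) :- (c :+ d) := (a :- c) :+ (b :- d)) refl

    *-diff : ∀ a b c d → a ℚ.* b ℚ.- c ℚ.* d ≡ a ℚ.* (b ℚ.- d) ℚ.+ (a ℚ.- c) ℚ.* d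
    *-diff = solve 4 (λ a b c d → a :* b :- c :* d := a :* (b :- d) :+ (a :- c) :* d) refl

    neg-diff : ∀ a b → ℚ.- a ℚ.- ℚ.- b ≡ ℚ.- (a ℚ.- b)
    neg-diff = solve 2 (λ a b → :- a :- :- b := :- (a :- b)) refl

    swap-diff : ∀ a b → ℚ.- (a ℚ.- b) ≡ b ℚ.- a
    swap-diff = solve 2 (λ a b → :- (a :- b) := b :- a) refl

    split : ∀ a b → a ≡ (a ℚ.- b) ℚ.+ b
    split = solve 2 (λ a b → a := (a :- b) :+ b) refl

    plus-minus : ∀ a b → (a ℚ.+ b) ℚ.- a ≡ b
    plus-minus = solve 2 (λ a b → (a :+ b) :- a := b) refl

    inv-diff : ∀ i j a b →
      (i ℚ.- j) ℚ.* (a ℚ.* b) ≡ (i ℚ.* a) ℚ.* b ℚ.- (j ℚ.* b) ℚ.* a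
    inv-diff = solve 4 (λ i j a b → (i :- j) :* (a :* b) := (i :* a) :* b :- (j :* b) :* a) refl

    swap-mid : ∀ a b c → a ℚ.* (b ℚ.* c) ≡ b ℚ.* (a ℚ.* c)
    swap-mid = solve 3 (λ a b c → a :* (b :* c) := b :* (a :* c)) refl

  module _ where
    open ℚ.≤-Reasoning

    ∣-∣-swap : ∀ p q → ℚ.∣ p ℚ.- q ∣ ≡ ℚ.∣ q ℚ.- p ∣
    ∣-∣-swap p q = trans (sym (ℚ.∣-p∣≡∣p∣ (p ℚ.- q))) (cong ℚ.∣_∣ (swap-diff p q))

    p-p≡0 : ∀ p → ℚ.∣ p ℚ.- p ∣ ≡ 0ℚ
    p-p≡0 p = cong ℚ.∣_∣ (ℚ.+-inverseʳ p)

    p≤∣p∣ : ∀ p → p ℚ.≤ ℚ.∣ p ∣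
    p≤∣p∣ p with ℚ.≤-total 0ℚ p
    ... | inj₁ 0≤p = ℚ.≤-reflexive (sym (ℚ.0≤p⇒∣p∣≡p 0≤p))
    ... | inj₂ p≤0 = ℚ.≤-trans p≤0 (ℚ.0≤∣p∣ p)

    ∣∣-least : ∀ {p ε} → p ℚ.≤ ε → ℚ.- p ℚ.≤ ε → ℚ.∣ p ∣ ℚ.≤ ε
    ∣∣-least {p} {ε} p≤ε -p≤ε with ℚ.∣p∣≡p∨∣p∣≡-p p
    ... | inj₁ e = subst (ℚ._≤ ε) (sym e) p≤ε
    ... | inj₂ e = subst (ℚ._≤ ε) (sym e) -p≤ε

    minus-≤ : ∀ {p q ε} → p ℚ.≤ q ℚ.+ ε → p ℚ.- q ℚ.≤ ε
    minus-≤ {p} {q} {ε} h = begin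
      p ℚ.- q           ≤⟨ ℚ.+-monoˡ-≤ (ℚ.- q) h ⟩
      (q ℚ.+ ε) ℚ.- q   ≡⟨ plus-minus q ε ⟩
      ε                 ∎

    ∣-∣-least : ∀ {p q ε} → p ℚ.≤ q ℚ.+ ε → q ℚ.≤ p ℚ.+ ε → ℚ.∣ p ℚ.- q ∣ ℚ.≤ ε
    ∣-∣-least {p} {q} {ε} h k =
      ∣∣-least (minus-≤ h) (subst (ℚ._≤ ε) (sym (swap-diff p q)) (minus-≤ k))

    ∣∣-≤ : ∀ p q → ℚ.∣ p ∣ ℚ.≤ ℚ.∣ q ∣ ℚ.+ ℚ.∣ p ℚ.- q ∣
    ∣∣-≤ p q = begin
      ℚ.∣ p ∣                         ≡⟨ cong ℚ.∣_∣ (split p q) ⟩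
      ℚ.∣ (p ℚ.- q) ℚ.+ q ∣           ≤⟨ ℚ.∣p+q∣≤∣p∣+∣q∣ (p ℚ.- q) q ⟩
      ℚ.∣ p ℚ.- q ∣ ℚ.+ ℚ.∣ q ∣       ≡⟨ ℚ.+-comm ℚ.∣ p ℚ.- q ∣ ℚ.∣ q ∣ ⟩
      ℚ.∣ q ∣ ℚ.+ ℚ.∣ p ℚ.- q ∣       ∎

    ∣∣-diff : ∀ p q → ℚ.∣ ℚ.∣ p ∣ ℚ.- ℚ.∣ q ∣ ∣ ℚ.≤ ℚ.∣ p ℚ.- q ∣
    ∣∣-diff p q = ∣-∣-least (∣∣-≤ p q)
      (subst (λ r → ℚ.∣ q ∣ ℚ.≤ ℚ.∣ p ∣ ℚ.+ r) (∣-∣-swap q p) (∣∣-≤ q p))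

  *-pos : ∀ {p q} → 0ℚ ℚ.< p → 0ℚ ℚ.< q → 0ℚ ℚ.< p ℚ.* q
  *-pos {p} {q} 0<p 0<q = ℚ.positive⁻¹ (p ℚ.* q)
    where instance
      _ = ℚ.positive 0<p
      _ = ℚ.positive 0<q
      _ = ℚ.pos*pos⇒pos p q

  *-mono : ∀ {p q r s} → 0ℚ ℚ.≤ p → 0ℚ ℚ.≤ s → p ℚ.≤ q → r ℚ.≤ s → p ℚ.* r ℚ.≤ q ℚ.* s
  *-mono {p} {q} {r} {s} 0≤p 0≤s p≤q r≤s =
    ℚ.≤-trans (ℚ.*-monoˡ-≤-nonNeg p r≤s) (ℚ.*-monoʳ-≤-nonNeg s p≤q)
    where instance
      _ = ℚ.nonNegative 0≤p
      _ = ℚ.nonNegative 0≤s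

inv : ℚ → ℚ
inv p with p ℚ.≟ 0ℚ
... | yes _  = 0ℚ
... | no p≢0 = (ℚ.1/ p) {{ℚ.≢-nonZero p≢0}}

inv-* : ∀ p → 0ℚ ℚ.< p → inv p ℚ.* p ≡ 1ℚ
inv-* p 0<p with p ℚ.≟ 0ℚ
... | yes p≡0 = contradiction (sym p≡0) (ℚ.<⇒≢ 0<p)
... | no  p≢0 = ℚ.*-inverseˡ p {{ℚ.≢-nonZero p≢0}}

inv-pos : ∀ p → 0ℚ ℚ.< p → 0ℚ ℚ.< inv p
inv-pos p 0<p with p ℚ.≟ 0ℚ
... | yes p≡0 = contradiction (sym p≡0) (ℚ.<⇒≢ 0<p)
... | no  p≢0 = ℚ.positive⁻¹ _ {{ℚ.1/pos⇒pos p {{ℚ.positive 0<p}}}}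

fromℚ : ℚ → ℝ
fromℚ q = mkℝ (λ _ → q) λ ε 0<ε → 0 , λ _ _ _ _ →
  subst (ℚ._≤ ε) (sym (p-p≡0 q)) (ℚ.<⇒≤ 0<ε)

fromℕ : ℕ → ℝ
fromℕ n = fromℚ (+ n ℚ./ 1)

0ℝ 1ℝ : ℝ
0ℝ = fromℚ 0ℚ
1ℝ = fromℚ 1ℚ

infixl 6 _+_ _-_
infixl 7 _*_
infix  8 -_

_+_ : ℝ → ℝ → ℝ
x + y = mkℝ (λ n → seq x n ℚ.+ seq y n) cau
  where
  open ℚ.≤-Reasoning
  cau : Cauchy (λ n → seq x n ℚ.+ seq y n)
  cau ε 0<ε =
    let 0<ε/2 = *-pos {½} (ℚ.positive⁻¹ ½) 0<ε
        M , hx = cauchy x (½ ℚ.* ε) 0<ε/2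
        N , hy = cauchy y (½ ℚ.* ε) 0<ε/2
    in M ℕ.⊔ N , λ m n p q → begin
      ℚ.∣ (seq x m ℚ.+ seq y m) ℚ.- (seq x n ℚ.+ seq y n) ∣
        ≡⟨ cong ℚ.∣_∣ (+-diff (seq x m) (seq y m) (seq x n) (seq y n)) ⟩
      ℚ.∣ (seq x m ℚ.- seq x n) ℚ.+ (seq y m ℚ.- seq y n) ∣
        ≤⟨ ℚ.∣p+q∣≤∣p∣+∣q∣ (seq x m ℚ.- seq x n) (seq y m ℚ.- seq y n) ⟩
      ℚ.∣ seq x m ℚ.- seq x n ∣ ℚ.+ ℚ.∣ seq y m ℚ.- seq y n ∣
        ≤⟨ ℚ.+-mono-≤
             (hx m n (ℕ.m⊔n≤o⇒m≤o M N p) (ℕ.m⊔n≤o⇒m≤o M N q))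
             (hy m n (ℕ.m⊔n≤o⇒n≤o M N p) (ℕ.m⊔n≤o⇒n≤o M N q)) ⟩
      ½ ℚ.* ε ℚ.+ ½ ℚ.* ε
        ≡⟨ ½+½ ε ⟩
      ε ∎

-_ : ℝ → ℝ
- x = mkℝ (λ n → ℚ.- seq x n) λ ε 0<ε →
  let N , h = cauchy x ε 0<ε
  in N , λ m n p q → subst (ℚ._≤ ε)
       (sym (trans (cong ℚ.∣_∣ (neg-diff (seq x m) (seq x n))) (ℚ.∣-p∣≡∣p∣ _)))
       (h m n p q)

_-_ : ℝ → ℝ → ℝ
x - y = x + - y

∣_∣ : ℝ → ℝ
∣ x ∣ = mkℝ (λ n → ℚ.∣ seq x n ∣) λ ε 0<ε →
  let N , h = cauchy x ε 0<ε
  in N , λ m n p q → ℚ.≤-trans (∣∣-diff (seq x m) (seq x n)) (h m n p q)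

bounded : ∀ x → ∃ λ B → 0ℚ ℚ.< B × ∃ λ N → ∀ n → N ℕ.≤ n → ℚ.∣ seq x n ∣ ℚ.≤ B
bounded x with cauchy x 1ℚ (ℚ.positive⁻¹ 1ℚ)
... | N , h =
  ℚ.∣ seq x N ∣ ℚ.+ 1ℚ ,
  ℚ.+-mono-≤-< (ℚ.0≤∣p∣ (seq x N)) (ℚ.positive⁻¹ 1ℚ) ,
  N , λ n N≤n → ℚ.≤-trans (∣∣-≤ (seq x n) (seq x N))
        (ℚ.+-monoʳ-≤ ℚ.∣ seq x N ∣ (h n N N≤n ℕ.≤-refl))

private

  cancel-inv : ∀ {C} → 0ℚ ℚ.< C → ∀ p → C ℚ.* (inv C ℚ.* p) ≡ p
  cancel-inv {C} 0<C p = begin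
    C ℚ.* (inv C ℚ.* p)   ≡⟨ ℚ.*-assoc C (inv C) p ⟨
    C ℚ.* inv C ℚ.* p     ≡⟨ cong (ℚ._* p) (ℚ.*-comm C (inv C)) ⟩
    inv C ℚ.* C ℚ.* p     ≡⟨ cong (ℚ._* p) (inv-* C 0<C) ⟩
    1ℚ ℚ.* p              ≡⟨ ℚ.*-identityˡ p ⟩
    p                     ∎
    where open ≡-Reasoning

  *-lip : ∀ {A B η a b c d} → 0ℚ ℚ.< A → 0ℚ ℚ.< B →
          ℚ.∣ a ∣ ℚ.≤ A → ℚ.∣ d ∣ ℚ.≤ B →
          ℚ.∣ a ℚ.- c ∣ ℚ.≤ inv B ℚ.* η → ℚ.∣ b ℚ.- d ∣ ℚ.≤ inv A ℚ.* η →
          ℚ.∣ a ℚ.* b ℚ.- c ℚ.* d ∣ ℚ.≤ η ℚ.+ η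
  *-lip {A} {B} {η} {a} {b} {c} {d} 0<A 0<B a≤A d≤B a-c≤ b-d≤ = begin
    ℚ.∣ a ℚ.* b ℚ.- c ℚ.* d ∣
      ≡⟨ cong ℚ.∣_∣ (*-diff a b c d) ⟩
    ℚ.∣ a ℚ.* (b ℚ.- d) ℚ.+ (a ℚ.- c) ℚ.* d ∣
      ≤⟨ ℚ.∣p+q∣≤∣p∣+∣q∣ (a ℚ.* (b ℚ.- d)) ((a ℚ.- c) ℚ.* d) ⟩
    ℚ.∣ a ℚ.* (b ℚ.- d) ∣ ℚ.+ ℚ.∣ (a ℚ.- c) ℚ.* d ∣
      ≡⟨ cong₂ ℚ._+_ (ℚ.∣p*q∣≡∣p∣*∣q∣ a (b ℚ.- d)) (ℚ.∣p*q∣≡∣p∣*∣q∣ (a ℚ.- c) d) ⟩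
    ℚ.∣ a ∣ ℚ.* ℚ.∣ b ℚ.- d ∣ ℚ.+ ℚ.∣ a ℚ.- c ∣ ℚ.* ℚ.∣ d ∣
      ≤⟨ ℚ.+-mono-≤
           (*-mono (ℚ.0≤∣p∣ a) (ℚ.≤-trans (ℚ.0≤∣p∣ (b ℚ.- d)) b-d≤) a≤A b-d≤)
           (*-mono (ℚ.0≤∣p∣ (a ℚ.- c)) (ℚ.<⇒≤ 0<B) a-c≤ d≤B) ⟩
    A ℚ.* (inv A ℚ.* η) ℚ.+ inv B ℚ.* η ℚ.* B
      ≡⟨ cong₂ ℚ._+_ (cancel-inv 0<A η) (trans (ℚ.*-comm (inv B ℚ.* η) B) (cancel-inv 0<B η)) ⟩
    η ℚ.+ η ∎
    where open ℚ.≤-Reasoning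

_*_ : ℝ → ℝ → ℝ
x * y = mkℝ (λ n → seq x n ℚ.* seq y n) λ ε 0<ε →
  let A , 0<A , M₁ , hA = bounded x
      B , 0<B , M₂ , hB = bounded y
      0<ε/2   = *-pos {½} (ℚ.positive⁻¹ ½) 0<ε
      M₃ , hx = cauchy x (inv B ℚ.* (½ ℚ.* ε)) (*-pos (inv-pos B 0<B) 0<ε/2)
      M₄ , hy = cauchy y (inv A ℚ.* (½ ℚ.* ε)) (*-pos (inv-pos A 0<A) 0<ε/2)
  in (M₁ ℕ.⊔ M₂) ℕ.⊔ (M₃ ℕ.⊔ M₄) , λ m n p q →
    let p₁₂ = ℕ.m⊔n≤o⇒m≤o (M₁ ℕ.⊔ M₂) (M₃ ℕ.⊔ M₄) p
        p₃₄ = ℕ.m⊔n≤o⇒n≤o (M₁ ℕ.⊔ M₂) (M₃ ℕ.⊔ M₄) p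
        q₁₂ = ℕ.m⊔n≤o⇒m≤o (M₁ ℕ.⊔ M₂) (M₃ ℕ.⊔ M₄) q
        q₃₄ = ℕ.m⊔n≤o⇒n≤o (M₁ ℕ.⊔ M₂) (M₃ ℕ.⊔ M₄) q
    in subst (ℚ.∣ seq x m ℚ.* seq y m ℚ.- seq x n ℚ.* seq y n ∣ ℚ.≤_) (½+½ ε)
         (*-lip {A} {B} {½ ℚ.* ε} {seq x m} {seq y m} {seq x n} {seq y n} 0<A 0<B
           (hA m (ℕ.m⊔n≤o⇒m≤o M₁ M₂ p₁₂)) (hB n (ℕ.m⊔n≤o⇒n≤o M₁ M₂ q₁₂))
           (hx m n (ℕ.m⊔n≤o⇒m≤o M₃ M₄ p₃₄) (ℕ.m⊔n≤o⇒m≤o M₃ M₄ q₃₄))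
           (hy m n (ℕ.m⊔n≤o⇒n≤o M₃ M₄ p₃₄) (ℕ.m⊔n≤o⇒n≤o M₃ M₄ q₃₄)))

inv-lip : ∀ {δ ε a b} → 0ℚ ℚ.< δ → 0ℚ ℚ.< ε → δ ℚ.≤ a → δ ℚ.≤ b →
          ℚ.∣ a ℚ.- b ∣ ℚ.≤ ε ℚ.* (δ ℚ.* δ) → ℚ.∣ inv a ℚ.- inv b ∣ ℚ.≤ ε
inv-lip {δ} {ε} {a} {b} 0<δ 0<ε δ≤a δ≤b h =
  ℚ.*-cancelʳ-≤-pos (a ℚ.* b) (begin
    ℚ.∣ inv a ℚ.- inv b ∣ ℚ.* (a ℚ.* b)
      ≡⟨ cong (ℚ.∣ inv a ℚ.- inv b ∣ ℚ.*_) (sym (ℚ.0≤p⇒∣p∣≡p (ℚ.<⇒≤ 0<ab))) ⟩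
    ℚ.∣ inv a ℚ.- inv b ∣ ℚ.* ℚ.∣ a ℚ.* b ∣
      ≡⟨ sym (ℚ.∣p*q∣≡∣p∣*∣q∣ (inv a ℚ.- inv b) (a ℚ.* b)) ⟩
    ℚ.∣ (inv a ℚ.- inv b) ℚ.* (a ℚ.* b) ∣
      ≡⟨ cong ℚ.∣_∣ (inv-diff (inv a) (inv b) a b) ⟩
    ℚ.∣ (inv a ℚ.* a) ℚ.* b ℚ.- (inv b ℚ.* b) ℚ.* a ∣
      ≡⟨ cong₂ (λ u v → ℚ.∣ u ℚ.* b ℚ.- v ℚ.* a ∣) (inv-* a 0<a) (inv-* b 0<b) ⟩
    ℚ.∣ 1ℚ ℚ.* b ℚ.- 1ℚ ℚ.* a ∣
      ≡⟨ cong₂ (λ u v → ℚ.∣ u ℚ.- v ∣) (ℚ.*-identityˡ b) (ℚ.*-identityˡ a) ⟩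
    ℚ.∣ b ℚ.- a ∣
      ≡⟨ ∣-∣-swap b a ⟩
    ℚ.∣ a ℚ.- b ∣
      ≤⟨ h ⟩
    ε ℚ.* (δ ℚ.* δ)
      ≤⟨ ℚ.*-monoˡ-≤-nonNeg ε {{ℚ.nonNegative (ℚ.<⇒≤ 0<ε)}}
           (*-mono (ℚ.<⇒≤ 0<δ) (ℚ.<⇒≤ 0<b) δ≤a δ≤b) ⟩
    ε ℚ.* (a ℚ.* b) ∎)
  where
  open ℚ.≤-Reasoning
  0<a  = ℚ.<-≤-trans 0<δ δ≤a
  0<b  = ℚ.<-≤-trans 0<δ δ≤b
  0<ab = *-pos 0<a 0<b
  instance _ = ℚ.positive 0<ab

recip : (x : ℝ) → 0ℝ < x → ℝ
recip x (δ , 0<δ , N , h) = mkℝ (λ n → inv (seq x n)) λ ε 0<ε →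
  let M , k = cauchy x (ε ℚ.* (δ ℚ.* δ)) (*-pos 0<ε (*-pos 0<δ 0<δ))
  in N ℕ.⊔ M , λ m n p q → inv-lip 0<δ 0<ε
       (δ≤ m (ℕ.m⊔n≤o⇒m≤o N M p)) (δ≤ n (ℕ.m⊔n≤o⇒m≤o N M q))
       (k m n (ℕ.m⊔n≤o⇒n≤o N M p) (ℕ.m⊔n≤o⇒n≤o N M q))
  where
  δ≤ : ∀ n → N ℕ.≤ n → δ ℚ.≤ seq x n
  δ≤ n N≤n = subst (ℚ._≤ seq x n) (ℚ.+-identityˡ δ) (h n N≤n)

recip-inverse : ∀ x (0<x : 0ℝ < x) → recip x 0<x * x ≃ 1ℝ
recip-inverse x (δ , 0<δ , N , h) ε 0<ε = N , λ n N≤n →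
  let δ≤xₙ = subst (ℚ._≤ seq x n) (ℚ.+-identityˡ δ) (h n N≤n)
  in subst (ℚ._≤ ε)
       (sym (trans (cong (λ r → ℚ.∣ r ℚ.- 1ℚ ∣) (inv-* (seq x n) (ℚ.<-≤-trans 0<δ δ≤xₙ)))
                   (p-p≡0 1ℚ)))
       (ℚ.<⇒≤ 0<ε)

-- The floor of the square root.
isqrt : ℕ → ℕ
isqrt zero = 0
isqrt (suc m) with suc (isqrt m) ℕ.* suc (isqrt m) ℕ.≤? suc m
... | yes _ = suc (isqrt m)
... | no  _ = isqrt m

isqrt-lower : ∀ m → isqrt m ℕ.* isqrt m ℕ.≤ m
isqrt-lower zero = z≤n
isqrt-lower (suc m) with suc (isqrt m) ℕ.* suc (isqrt m) ℕ.≤? suc m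
... | yes h = h
... | no  _ = ℕ.m≤n⇒m≤1+n (isqrt-lower m)

isqrt-upper : ∀ m → m ℕ.< suc (isqrt m) ℕ.* suc (isqrt m)
isqrt-upper zero = s≤s z≤n
isqrt-upper (suc m) with suc (isqrt m) ℕ.* suc (isqrt m) ℕ.≤? suc m
... | no  h = ℕ.≰⇒> h
... | yes _ = ℕ.≤-<-trans (isqrt-upper m)
  (ℕ.*-mono-< (ℕ.n<1+n (suc (isqrt m))) (ℕ.n<1+n (suc (isqrt m))))

√-approx : ℕ → ℕ → ℕ
√-approx n k = isqrt (n ℕ.* (suc k ℕ.* suc k))

sq-cancel-< : ∀ {a b} → a ℕ.* a ℕ.< b ℕ.* b → a ℕ.< b
sq-cancel-< {a} {b} h with a ℕ.<? b
... | yes a<b = a<b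
... | no  a≮b = contradiction (ℕ.<-≤-trans h (ℕ.*-mono-≤ (ℕ.≮⇒≥ a≮b) (ℕ.≮⇒≥ a≮b))) (ℕ.<-irrefl refl)

/-mono : ∀ a b k l → a ℕ.* suc l ℕ.≤ b ℕ.* suc k → + a ℚ./ suc k ℚ.≤ + b ℚ./ suc l
/-mono a b k l h = ℚ.toℚᵘ-cancel-≤ (begin
  ℚ.toℚᵘ (+ a ℚ./ suc k)  ≃⟨ ℚ.toℚᵘ-fromℚᵘ (ℚᵘ.mkℚᵘ (+ a) k) ⟩
  ℚᵘ.mkℚᵘ (+ a) k         ≤⟨ ℚᵘ.*≤* (subst₂ ℤ._≤_ (ℤ.pos-* a (suc l)) (ℤ.pos-* b (suc k)) (ℤ.+≤+ h)) ⟩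
  ℚᵘ.mkℚᵘ (+ b) l         ≃⟨ ℚ.toℚᵘ-fromℚᵘ (ℚᵘ.mkℚᵘ (+ b) l) ⟨
  ℚ.toℚᵘ (+ b ℚ./ suc l)  ∎)
  where open ℚᵘ.≤-Reasoning

/-+ : ∀ a b k → + (a ℕ.+ b) ℚ./ suc k ≡ + a ℚ./ suc k ℚ.+ + b ℚ./ suc k
/-+ a b k = ℚ.toℚᵘ-injective (begin
  ℚ.toℚᵘ (+ (a ℕ.+ b) ℚ./ suc k)
    ≈⟨ ℚ.toℚᵘ-fromℚᵘ (ℚᵘ.mkℚᵘ (+ (a ℕ.+ b)) k) ⟩
  ℚᵘ.mkℚᵘ (+ (a ℕ.+ b)) k
    ≈⟨ ℚᵘ.*≡* (trans (sym (ℤ.pos-* (a ℕ.+ b) (suc k ℕ.* suc k))) (trans (cong +_ (lem a b (suc k)))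
         (trans (ℤ.pos-* (a ℕ.* suc k ℕ.+ b ℕ.* suc k) (suc k))
           (cong (ℤ._* + suc k) (trans (ℤ.pos-+ (a ℕ.* suc k) (b ℕ.* suc k))
              (cong₂ ℤ._+_ (ℤ.pos-* a (suc k)) (ℤ.pos-* b (suc k)))))))) ⟩
  ℚᵘ.mkℚᵘ (+ a) k ℚᵘ.+ ℚᵘ.mkℚᵘ (+ b) k
    ≈⟨ ℚᵘ.+-cong (ℚ.toℚᵘ-fromℚᵘ (ℚᵘ.mkℚᵘ (+ a) k)) (ℚ.toℚᵘ-fromℚᵘ (ℚᵘ.mkℚᵘ (+ b) k)) ⟨
  ℚ.toℚᵘ (+ a ℚ./ suc k) ℚᵘ.+ ℚ.toℚᵘ (+ b ℚ./ suc k)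
    ≈⟨ ℚ.toℚᵘ-homo-+ (+ a ℚ./ suc k) (+ b ℚ./ suc k) ⟨
  ℚ.toℚᵘ (+ a ℚ./ suc k ℚ.+ + b ℚ./ suc k) ∎)
  where
  open ℚᵘ.≃-Reasoning
  lem : ∀ a b k → (a ℕ.+ b) ℕ.* (k ℕ.* k) ≡ (a ℕ.* k ℕ.+ b ℕ.* k) ℕ.* k
  lem = solve 3 (λ a b k → (a :+ b) :* (k :* k) := (a :* k :+ b :* k) :* k) refl
    where open ℕ-Solver

/-sq : ∀ a k → + a ℚ./ suc k ℚ.* (+ a ℚ./ suc k) ≡ + (a ℕ.* a) ℚ./ (suc k ℕ.* suc k)
/-sq a k = ℚ.toℚᵘ-injective (begin
  ℚ.toℚᵘ (+ a ℚ./ suc k ℚ.* (+ a ℚ./ suc k))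
    ≈⟨ ℚ.toℚᵘ-homo-* (+ a ℚ./ suc k) (+ a ℚ./ suc k) ⟩
  ℚ.toℚᵘ (+ a ℚ./ suc k) ℚᵘ.* ℚ.toℚᵘ (+ a ℚ./ suc k)
    ≈⟨ ℚᵘ.*-cong (ℚ.toℚᵘ-fromℚᵘ (ℚᵘ.mkℚᵘ (+ a) k)) (ℚ.toℚᵘ-fromℚᵘ (ℚᵘ.mkℚᵘ (+ a) k)) ⟩
  ℚᵘ.mkℚᵘ (+ a) k ℚᵘ.* ℚᵘ.mkℚᵘ (+ a) k
    ≈⟨ ℚᵘ.*≡* (cong (ℤ._* + (suc k ℕ.* suc k)) (sym (ℤ.pos-* a a))) ⟩
  ℚᵘ.mkℚᵘ (+ (a ℕ.* a)) (k ℕ.+ k ℕ.* suc k)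
    ≈⟨ ℚ.toℚᵘ-fromℚᵘ (ℚᵘ.mkℚᵘ (+ (a ℕ.* a)) (k ℕ.+ k ℕ.* suc k)) ⟨
  ℚ.toℚᵘ (+ (a ℕ.* a) ℚ./ (suc k ℕ.* suc k)) ∎)
  where open ℚᵘ.≃-Reasoning

archimedean : ∀ c ε → 0ℚ ℚ.< ε → ∃ λ N → ∀ n → N ℕ.≤ n → + c ℚ./ suc n ℚ.≤ ε
archimedean c ε@(mkℚ (+ suc a) d _) 0<ε = c ℕ.* suc d , λ n h →
  subst (+ c ℚ./ suc n ℚ.≤_) (ℚ.fromℚᵘ-toℚᵘ ε) (/-mono c (suc a) n d (begin
    c ℕ.* suc d      ≤⟨ h ⟩
    n                ≤⟨ ℕ.n≤1+n n ⟩
    suc n            ≤⟨ ℕ.m≤m+n (suc n) _ ⟩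
    suc a ℕ.* suc n  ∎))
  where open ℕ.≤-Reasoning
archimedean c ε@(mkℚ (+ zero) d _) 0<ε = contradiction (ℚ.positive 0<ε) λ ()
archimedean c ε@(mkℚ (ℤ.-[1+_] a) d _) 0<ε = contradiction (ℚ.positive 0<ε) λ ()

√-seq : ℕ → ℕ → ℚ
√-seq n k = + √-approx n k ℚ./ suc k

√-close : ∀ n k l → √-seq n k ℚ.≤ √-seq n l ℚ.+ + 1 ℚ./ suc l
√-close n k l = subst (√-seq n k ℚ.≤_) (/-+ (√-approx n l) 1 l)
  (/-mono a (b ℕ.+ 1) k l (subst (λ r → a ℕ.* suc l ℕ.≤ r ℕ.* suc k) (ℕ.+-comm 1 b)
    (ℕ.<⇒≤ (sq-cancel-< (begin-strict
      a ℕ.* suc l ℕ.* (a ℕ.* suc l)                     ≡⟨ ex a (suc l) ⟩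
      a ℕ.* a ℕ.* (suc l ℕ.* suc l)                     ≤⟨ ℕ.*-monoˡ-≤ (suc l ℕ.* suc l) (isqrt-lower (n ℕ.* (suc k ℕ.* suc k))) ⟩
      n ℕ.* (suc k ℕ.* suc k) ℕ.* (suc l ℕ.* suc l)     ≡⟨ ex′ n (suc k ℕ.* suc k) (suc l ℕ.* suc l) ⟩
      n ℕ.* (suc l ℕ.* suc l) ℕ.* (suc k ℕ.* suc k)     <⟨ ℕ.*-monoˡ-< (suc k ℕ.* suc k) (isqrt-upper (n ℕ.* (suc l ℕ.* suc l))) ⟩
      suc b ℕ.* suc b ℕ.* (suc k ℕ.* suc k)             ≡⟨ ex (suc b) (suc k) ⟨
      suc b ℕ.* suc k ℕ.* (suc b ℕ.* suc k)             ∎)))))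
  where
  open ℕ.≤-Reasoning
  a = √-approx n k
  b = √-approx n l
  ex : ∀ a l → a ℕ.* l ℕ.* (a ℕ.* l) ≡ a ℕ.* a ℕ.* (l ℕ.* l)
  ex = solve 2 (λ a l → a :* l :* (a :* l) := a :* a :* (l :* l)) refl
    where open ℕ-Solver
  ex′ : ∀ a b c → a ℕ.* b ℕ.* c ≡ a ℕ.* c ℕ.* b
  ex′ = solve 3 (λ a b c → a :* b :* c := a :* c :* b) refl
    where open ℕ-Solver

-- The k-th approximation is ⌊√ (n (k+1)²) ⌋ / (k+1).
√_ : ℕ → ℝ
√ n = mkℝ (√-seq n) λ ε 0<ε →
  let N , h = archimedean 1 ε 0<ε
  in N , λ k l p q → ∣-∣-least
       (ℚ.≤-trans (√-close n k l) (ℚ.+-monoʳ-≤ (√-seq n l) (h l q)))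
       (ℚ.≤-trans (√-close n l k) (ℚ.+-monoʳ-≤ (√-seq n k) (h k p)))

infix 9 √_

private

  module _ where
    open ℕ-Solver

    suc-sq : ∀ a → suc a ℕ.* suc a ≡ a ℕ.* a ℕ.+ (1 ℕ.+ 2 ℕ.* a)
    suc-sq = solve 1 (λ a → (con 1 :+ a) :* (con 1 :+ a) := a :* a :+ (con 1 :+ con 2 :* a)) refl

    factor : ∀ n M → M ℕ.+ 2 ℕ.* (n ℕ.* M) ≡ M ℕ.* (1 ℕ.+ 2 ℕ.* n)
    factor = solve 2 (λ n M → M :+ con 2 :* (n :* M) := M :* (con 1 :+ con 2 :* n)) refl

    rotate : ∀ M c → M ℕ.* c ℕ.* M ≡ c ℕ.* (M ℕ.* M)
    rotate = solve 2 (λ M c → M :* c :* M := c :* (M :* M)) refl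

    square-nM : ∀ n M → n ℕ.* M ℕ.* (n ℕ.* M) ≡ n ℕ.* (n ℕ.* (M ℕ.* M))
    square-nM = solve 2 (λ n M → n :* M :* (n :* M) := n :* (n :* (M :* M))) refl

  module _ where
    open ℕ.≤-Reasoning

    M≤approx : ∀ n M a .{{_ : ℕ.NonZero n}} →
               n ℕ.* (M ℕ.* M) ℕ.< suc a ℕ.* suc a → M ℕ.≤ a
    M≤approx n M a h = ℕ.≤-pred (sq-cancel-< {M} {suc a} (begin-strict
      M ℕ.* M           ≤⟨ ℕ.m≤n*m (M ℕ.* M) n ⟩
      n ℕ.* (M ℕ.* M)   <⟨ h ⟩
      suc a ℕ.* suc a   ∎))

    approx≤nM : ∀ n M a → a ℕ.* a ℕ.≤ n ℕ.* (M ℕ.* M) → a ℕ.≤ n ℕ.* M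
    approx≤nM zero zero    zero    h = z≤n
    approx≤nM zero (suc M) zero    h = z≤n
    approx≤nM n@(suc _) M a h = ℕ.≤-pred (sq-cancel-< {a} {suc (n ℕ.* M)} (begin-strict
      a ℕ.* a                           ≤⟨ h ⟩
      n ℕ.* (M ℕ.* M)                   ≤⟨ ℕ.m≤n*m (n ℕ.* (M ℕ.* M)) n ⟩
      n ℕ.* (n ℕ.* (M ℕ.* M))           ≡⟨ square-nM n M ⟨
      n ℕ.* M ℕ.* (n ℕ.* M)             <⟨ ℕ.*-mono-< (ℕ.n<1+n (n ℕ.* M)) (ℕ.n<1+n (n ℕ.* M)) ⟩
      suc (n ℕ.* M) ℕ.* suc (n ℕ.* M)   ∎))

    approx-gap : ∀ n M a .{{_ : ℕ.NonZero M}} →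
                 a ℕ.* a ℕ.≤ n ℕ.* (M ℕ.* M) → n ℕ.* (M ℕ.* M) ℕ.< suc a ℕ.* suc a →
                 n ℕ.* (M ℕ.* M) ℕ.≤ a ℕ.* a ℕ.+ M ℕ.* (1 ℕ.+ 2 ℕ.* n)
    approx-gap n M a h k = begin
      n ℕ.* (M ℕ.* M)                      ≤⟨ ℕ.<⇒≤ k ⟩
      suc a ℕ.* suc a                      ≡⟨ suc-sq a ⟩
      a ℕ.* a ℕ.+ (1 ℕ.+ 2 ℕ.* a)          ≤⟨ ℕ.+-monoʳ-≤ (a ℕ.* a) (ℕ.+-mono-≤ (ℕ.>-nonZero⁻¹ M) (ℕ.*-monoʳ-≤ 2 (approx≤nM n M a h))) ⟩
      a ℕ.* a ℕ.+ (M ℕ.+ 2 ℕ.* (n ℕ.* M))  ≡⟨ cong (a ℕ.* a ℕ.+_) (factor n M) ⟩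
      a ℕ.* a ℕ.+ M ℕ.* (1 ℕ.+ 2 ℕ.* n)    ∎

  square-upper : ∀ n k a → a ℕ.* a ℕ.≤ n ℕ.* (suc k ℕ.* suc k) →
                 + a ℚ./ suc k ℚ.* (+ a ℚ./ suc k) ℚ.≤ + n ℚ./ 1
  square-upper n k a h = subst (ℚ._≤ + n ℚ./ 1) (sym (/-sq a k))
    (/-mono (a ℕ.* a) n (k ℕ.+ k ℕ.* suc k) 0
      (subst (ℕ._≤ n ℕ.* (suc k ℕ.* suc k)) (sym (ℕ.*-identityʳ (a ℕ.* a))) h))

  square-lower : ∀ n k a → a ℕ.* a ℕ.≤ n ℕ.* (suc k ℕ.* suc k) →
                 n ℕ.* (suc k ℕ.* suc k) ℕ.< suc a ℕ.* suc a →
                 + n ℚ./ 1 ℚ.≤ + a ℚ./ suc k ℚ.* (+ a ℚ./ suc k) ℚ.+ + (1 ℕ.+ 2 ℕ.* n) ℚ./ suc k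
  square-lower n k a h h′ = begin
    + n ℚ./ 1
      ≤⟨ /-mono n (a ℕ.* a ℕ.+ M ℕ.* c) 0 (k ℕ.+ k ℕ.* M)
           (subst (n ℕ.* (M ℕ.* M) ℕ.≤_) (sym (ℕ.*-identityʳ (a ℕ.* a ℕ.+ M ℕ.* c))) (approx-gap n M a h h′)) ⟩
    + (a ℕ.* a ℕ.+ M ℕ.* c) ℚ./ (M ℕ.* M)
      ≡⟨ /-+ (a ℕ.* a) (M ℕ.* c) (k ℕ.+ k ℕ.* M) ⟩
    + (a ℕ.* a) ℚ./ (M ℕ.* M) ℚ.+ + (M ℕ.* c) ℚ./ (M ℕ.* M)
      ≡⟨ cong (ℚ._+ (+ (M ℕ.* c) ℚ./ (M ℕ.* M))) (/-sq a k) ⟨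
    + a ℚ./ M ℚ.* (+ a ℚ./ M) ℚ.+ + (M ℕ.* c) ℚ./ (M ℕ.* M)
      ≤⟨ ℚ.+-monoʳ-≤ (+ a ℚ./ M ℚ.* (+ a ℚ./ M))
           (/-mono (M ℕ.* c) c (k ℕ.+ k ℕ.* M) k (ℕ.≤-reflexive (rotate M c))) ⟩
    + a ℚ./ M ℚ.* (+ a ℚ./ M) ℚ.+ + c ℚ./ M ∎
    where
    open ℚ.≤-Reasoning
    M = suc k
    c = 1 ℕ.+ 2 ℕ.* n

  ≤-weaken : ∀ {p q ε} → 0ℚ ℚ.< ε → p ℚ.≤ q → p ℚ.≤ q ℚ.+ ε
  ≤-weaken {p} {q} {ε} 0<ε p≤q =
    subst (ℚ._≤ q ℚ.+ ε) (ℚ.+-identityʳ p) (ℚ.+-mono-≤ p≤q (ℚ.<⇒≤ 0<ε))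

0<√ : ∀ n .{{_ : ℕ.NonZero n}} → 0ℝ < √ n
0<√ n = 1ℚ , ℚ.positive⁻¹ 1ℚ , 0 , λ k _ →
  subst (ℚ._≤ √-seq n k) (sym (ℚ.+-identityˡ 1ℚ))
    (/-mono 1 (√-approx n k) 0 k
      (subst₂ ℕ._≤_ (sym (ℕ.*-identityˡ (suc k))) (sym (ℕ.*-identityʳ (√-approx n k)))
        (M≤approx n (suc k) (√-approx n k) (isqrt-upper (n ℕ.* (suc k ℕ.* suc k))))))

0≤√ : ∀ n → 0ℝ ≤ √ n
0≤√ n ε 0<ε = 0 , λ k _ → ≤-weaken 0<ε (/-mono 0 (√-approx n k) 0 k z≤n)

√-square : ∀ n → √ n * √ n ≃ fromℕ n
√-square n ε 0<ε =
  let N , h = archimedean (1 ℕ.+ 2 ℕ.* n) ε 0<ε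
  in N , λ k N≤k →
    let m = n ℕ.* (suc k ℕ.* suc k) in
    ∣-∣-least
      (≤-weaken 0<ε (square-upper n k (√-approx n k) (isqrt-lower m)))
      (ℚ.≤-trans
        (square-lower n k (√-approx n k) (isqrt-lower m) (isqrt-upper m))
        (ℚ.+-monoʳ-≤ (√-seq n k ℚ.* √-seq n k) (h k N≤k)))

1/√_ : ∀ n .{{_ : ℕ.NonZero n}} → ℝ
1/√ n = recip (√ n) (0<√ n)

_^3/2 : ℕ → ℝ
n ^3/2 = √ (n ℕ.^ 3)

infix 4 _⟶_ _⟶∞

_⟶_ : (ℕ → ℝ) → ℝ → Set
u ⟶ l = ∀ ε → 0ℝ < ε → ∃ λ K → ∀ k → K ℕ.≤ k → ∣ u k - l ∣ < ε

_⟶∞ : (ℕ → ℕ) → Set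
u ⟶∞ = ∀ M → ∃ λ K → ∀ k → K ℕ.≤ k → M ℕ.≤ u k

∑ : List ℝ → ℝ
∑ = foldr _+_ 0ℝ

-- Reals have no computable maximum in general, so the optimum of the linear
-- program, and with it bs and fbs, are given as relations:
-- IsBsAt f x t reads bs(f,x) = t, IsFbs f v reads fbs(f) = v, and so on.
IsMaximum : {A : Set} → (A → A → Set) → (A → Set) → A → Set
IsMaximum _≼_ P m = P m × (∀ u → P u → u ≼ m)

Input : ℕ → Set
Input n = Vec Bool n

BoolFun : ℕ → Set
BoolFun n = Input n → Bool

-- Subset n is Vec Bool n, with inside = true and outside = false.
flipBits : ∀ {n} → Input n → Subset n → Input n
flipBits = zipWith _xor_

Sensitive : ∀ {n} → BoolFun n → Input n → Subset n → Set
Sensitive f x B = f x ≢ f (flipBits x B)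

sensitive? : ∀ {n} (f : BoolFun n) (x : Input n) → Decidable (Sensitive f x)
sensitive? f x B = ¬? (f x Bool.≟ f (flipBits x B))

HasDisjointSensitiveBlocks : ∀ {n} → BoolFun n → Input n → ℕ → Set
HasDisjointSensitiveBlocks {n} f x t = Σ (Fin t → Subset n) λ B →
  (∀ i → Sensitive f x (B i)) × (∀ i j → i ≢ j → Empty (B i ∩ B j))

IsBsAt : ∀ {n} → BoolFun n → Input n → ℕ → Set
IsBsAt f x = IsMaximum ℕ._≤_ (HasDisjointSensitiveBlocks f x)

IsBs : ∀ {n} → BoolFun n → ℕ → Set
IsBs f = IsMaximum ℕ._≤_ λ t → ∃ λ x → IsBsAt f x t

-- Every subset of Fin n, listed exactly once.
subsets : ∀ n → List (Subset n)
subsets zero    = [] ∷ []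
subsets (suc n) = map (inside ∷_) (subsets n) ++ map (outside ∷_) (subsets n)

-- The weight of a block that is not sensitive at x is never inspected.
Weighting : ℕ → Set
Weighting n = Subset n → ℝ

objective : ∀ {n} → BoolFun n → Input n → Weighting n → ℝ
objective {n} f x w = ∑ (map w (filter (sensitive? f x) (subsets n)))

load : ∀ {n} → BoolFun n → Input n → Weighting n → Fin n → ℝ
load {n} f x w i =
  ∑ (map w (filter (λ B → sensitive? f x B ×-dec (i ∈? B)) (subsets n)))

Feasible : ∀ {n} → BoolFun n → Input n → Weighting n → Set
Feasible f x w =
  (∀ i → load f x w i ≤ 1ℝ) ×
  (∀ B → Sensitive f x B → 0ℝ ≤ w B × w B ≤ 1ℝ)

IsFbsAt : ∀ {n} → BoolFun n → Input n → ℝ → Set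
IsFbsAt f x = IsMaximum _≤_ λ v → ∃ λ w → Feasible f x w × objective f x w ≃ v

IsFbs : ∀ {n} → BoolFun n → ℝ → Set
IsFbs f = IsMaximum _≤_ λ v → ∃ λ x → IsFbsAt f x v

{-# OPTIONS --safe #-}
module Submission where

-- Take m = 2^k vertices, the bit vectors of length k, at distances given by their xor read as a
-- binary number; the distances from a vertex to the others are distinct. The function g on graphs
-- is the disjunction of one term per vertex t: all edges at t are present, and every edge uv that
-- is the longest side of the triangle tuv is absent. In a K₄ the longest edge is mentioned
-- positively by its ends and negatively by the other two vertices, so whatever its value two of the
-- four terms are violated there: at a 0-input of g there are at most 3 disjoint sensitive blocks.
-- A term mentions D = (m−1)(m+4)/6 edges, so f = OR of n = ⌊D/3⌋ copies of g has bs(f) = D.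
-- At the empty graph, weight 1/2 on every star is feasible, since an edge has two ends; this gives
-- n·m/2 in f. It is optimal: at any 0-input of g the violated sets are hit by m/2 edges, namely by
-- the antipodal edges if all are absent, while an antipodal edge that is present already hits every
-- term except those of its two ends. Finally (n·m/2)² ~ D³/6.

open import Defs
open import Data.Bool.Base using (Bool; true; false; not; _∧_; _∨_; _xor_; if_then_else_)
import Data.Bool.Properties as Bool
open import Data.Empty using (⊥)
open import Data.Fin.Base as Fin using (Fin)
import Data.Fin.Properties as Fin
open import Data.Fin.Subset as Subset using (Subset; ⁅_⁆) renaming (_∈_ to _∈ₛ_; _∉_ to _∉ₛ_)
open import Data.Fin.Subset.Properties using (_∈?_; nonempty?; Empty-unique; x∈p∩q⁺; x∈p∩q⁻; x∈⁅x⁆; x∈⁅y⁆⇒x≡y)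
open import Data.Integer.Base using (+_)
open import Data.List.Base as List using (List; []; _∷_; _++_; map; filter; length; concatMap; cartesianProduct; cartesianProductWith)
import Data.List.Properties as List
open import Data.List.Membership.Propositional using (_∈_; find; lose)
open import Data.List.Membership.Propositional.Properties
open import Data.List.Relation.Unary.All as All using ()
open import Data.List.Relation.Unary.AllPairs using ([]; _∷_)
open import Data.List.Relation.Unary.Any as Any using (Any; here; there)
import Data.List.Relation.Unary.Any.Properties as Any
open import Data.List.Relation.Unary.Unique.Propositional using (Unique)
import Data.List.Relation.Unary.Unique.Propositional.Properties as Unique
open import Data.Nat.Base as ℕ using (ℕ; zero; suc; z≤n; s≤s; _^_)
open import Data.Nat.DivMod using (_/_; _%_; m≡m%n+[m/n]*n; m%n<n)
import Data.Nat.Properties as ℕ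
open import Data.Nat.Solver using () renaming (module +-*-Solver to ℕ-Solver)
open import Data.Product.Base using (Σ; ∃; ∃₂; _×_; _,_; proj₁; proj₂)
import Data.Product.Function.NonDependent.Propositional as Product
open import Data.Rational.Base as ℚ using (ℚ; 0ℚ; 1ℚ; ½)
import Data.Rational.Properties as ℚ
open import Data.Rational.Solver using () renaming (module +-*-Solver to ℚ-Solver)
open import Data.Sum.Base as Sum using (_⊎_; inj₁; inj₂; [_,_]′)
import Data.Sum.Function.Propositional as Sum
open import Data.Vec.Base as Vec using (Vec; []; _∷_; lookup; tabulate; replicate)
open import Data.Vec.Properties using (≡-dec; ∷-injectiveˡ; ∷-injectiveʳ; lookup-zipWith; lookup∘tabulate; []=⇒lookup; lookup⇒[]=; lookup-replicate)
open import Function.Base using (_∘_; id; case_of_)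
open import Function.Bundles using (_↔_; mk↔ₛ′; Inverse)
open import Function.Properties.Inverse using (↔-trans; ↔-refl)
open import Relation.Binary.PropositionalEquality
open import Relation.Nullary using (Dec; does; yes; no; ¬_; contradiction)
open import Relation.Nullary.Decidable using (toWitness; ¬?; _×-dec_; dec-true; dec-false)
open import Relation.Unary using (Decidable)

-- At a 0-input block sensitivity adds up over the copies, at most 3 for each, while at a 1-input
-- the D edges of one satisfied term bound it by D, whatever the number of copies. So about D/3
-- copies cost nothing, while the fractional value grows with each of them. They yield n·m/2 ~ D·m/6
-- with m ~ √(6D), that is D^(3/2)/√6: the constant comes from the size of a term. Each of the
-- m(m-1)(m-2)/6 triangles charges its longest side to the opposite vertex, so a term has on average
-- (m-1)(m-2)/6 negative edges besides its m-1 positive ones. The xor distance makes this average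
-- the value at every vertex, and it makes the sides of a triangle distinct, so that no ties have to
-- be broken. Since the claim is an equation, the upper bound on the linear program must meet n·m/2
-- exactly. A hitting set of that size is a 0/1 solution of the dual program; at a 1-input the D
-- mentioned edges serve, because D ≤ n·m/2. The error ε is defined by the equation itself, so only
-- ε → 0 calls for estimates.

private variable
  A A′ : Set
  k : ℕ

-- Finite sums of natural numbers

Σ[_] : List A → (A → ℕ) → ℕ
Σ[ [] ]     f = 0
Σ[ x ∷ xs ] f = f x ℕ.+ Σ[ xs ] f

𝟙 : Bool → ℕ
𝟙 true  = 1
𝟙 false = 0

Σ-++ : ∀ (xs ys : List A) f → Σ[ xs ++ ys ] f ≡ Σ[ xs ] f ℕ.+ Σ[ ys ] f
Σ-++ []       ys f = refl
Σ-++ (x ∷ xs) ys f = trans (cong (f x ℕ.+_) (Σ-++ xs ys f)) (sym (ℕ.+-assoc (f x) _ _))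

Σ-map : ∀ (g : A → A′) xs f → Σ[ map g xs ] f ≡ Σ[ xs ] (λ x → f (g x))
Σ-map g []       f = refl
Σ-map g (x ∷ xs) f = cong (f (g x) ℕ.+_) (Σ-map g xs f)

Σ-cong : ∀ (xs : List A) {f g} → (∀ x → f x ≡ g x) → Σ[ xs ] f ≡ Σ[ xs ] g
Σ-cong []       e = refl
Σ-cong (x ∷ xs) e = cong₂ ℕ._+_ (e x) (Σ-cong xs e)

Σ-mono : ∀ (xs : List A) {f g} → (∀ x → f x ℕ.≤ g x) → Σ[ xs ] f ℕ.≤ Σ[ xs ] g
Σ-mono []       e = z≤n
Σ-mono (x ∷ xs) e = ℕ.+-mono-≤ (e x) (Σ-mono xs e)

Σ-const : ∀ (xs : List A) c → Σ[ xs ] (λ _ → c) ≡ length xs ℕ.* c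
Σ-const []       c = refl
Σ-const (x ∷ xs) c = cong (c ℕ.+_) (Σ-const xs c)

Σ-zero : ∀ (xs : List A) → Σ[ xs ] (λ _ → 0) ≡ 0
Σ-zero xs = trans (Σ-const xs 0) (ℕ.*-zeroʳ (length xs))

Σ-+ : ∀ (xs : List A) f g → Σ[ xs ] (λ x → f x ℕ.+ g x) ≡ Σ[ xs ] f ℕ.+ Σ[ xs ] g
Σ-+ []       f g = refl
Σ-+ (x ∷ xs) f g = trans (cong (f x ℕ.+ g x ℕ.+_) (Σ-+ xs f g)) (interchange (f x) (g x) _ _)
  where
  open ℕ-Solver
  interchange : ∀ a b c d → a ℕ.+ b ℕ.+ (c ℕ.+ d) ≡ a ℕ.+ c ℕ.+ (b ℕ.+ d)
  interchange = solve 4 (λ a b c d → a :+ b :+ (c :+ d) := a :+ c :+ (b :+ d)) refl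

Σ-*ˡ : ∀ c (xs : List A) f → Σ[ xs ] (λ x → c ℕ.* f x) ≡ c ℕ.* Σ[ xs ] f
Σ-*ˡ c []       f = sym (ℕ.*-zeroʳ c)
Σ-*ˡ c (x ∷ xs) f = trans (cong (c ℕ.* f x ℕ.+_) (Σ-*ˡ c xs f)) (sym (ℕ.*-distribˡ-+ c (f x) _))

Σ-swap : ∀ (xs : List A) (ys : List A′) (f : A → A′ → ℕ) →
         Σ[ xs ] (λ x → Σ[ ys ] (f x)) ≡ Σ[ ys ] (λ y → Σ[ xs ] (λ x → f x y))
Σ-swap []       ys f = sym (Σ-zero ys)
Σ-swap (x ∷ xs) ys f = trans (cong (Σ[ ys ] (f x) ℕ.+_) (Σ-swap xs ys f)) (sym (Σ-+ ys (f x) _))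

Σ-product : ∀ {C : Set} (g : A → A′ → C) xs ys f →
            Σ[ cartesianProductWith g xs ys ] f ≡ Σ[ xs ] (λ x → Σ[ ys ] (λ y → f (g x y)))
Σ-product g []       ys f = refl
Σ-product g (x ∷ xs) ys f = trans (Σ-++ (map (g x) ys) _ f)
  (cong₂ ℕ._+_ (Σ-map (g x) ys f) (Σ-product g xs ys f))

Σ-filter : ∀ {P : A → Set} (P? : Decidable P) xs f →
           Σ[ filter P? xs ] f ≡ Σ[ xs ] (λ x → 𝟙 (does (P? x)) ℕ.* f x)
Σ-filter P? []       f = refl
Σ-filter P? (x ∷ xs) f with does (P? x)
... | true  = cong₂ ℕ._+_ (sym (ℕ.+-identityʳ (f x))) (Σ-filter P? xs f)
... | false = Σ-filter P? xs f

length-filter : ∀ {P : A → Set} (P? : Decidable P) xs →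
                length (filter P? xs) ≡ Σ[ xs ] (λ x → 𝟙 (does (P? x)))
length-filter P? []       = refl
length-filter P? (x ∷ xs) with does (P? x)
... | true  = cong suc (length-filter P? xs)
... | false = length-filter P? xs

term≤Σ : ∀ {x : A} {xs} f → x ∈ xs → f x ℕ.≤ Σ[ xs ] f
term≤Σ f (here refl) = ℕ.m≤m+n _ _
term≤Σ f (there x∈)  = ℕ.≤-trans (term≤Σ f x∈) (ℕ.m≤n+m _ _)

Σ-allFin-suc : ∀ {n} (f : Fin (suc n) → ℕ) →
               Σ[ List.allFin (suc n) ] f ≡ f Fin.zero ℕ.+ Σ[ List.allFin n ] (λ i → f (Fin.suc i))
Σ-allFin-suc f = cong (f Fin.zero ℕ.+_) (tab Fin.suc f)
  where
  tab : ∀ {n} {X : Set} (g : Fin n → X) (f : X → ℕ) →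
        Σ[ List.tabulate g ] f ≡ Σ[ List.allFin n ] (λ i → f (g i))
  tab {zero}  g f = refl
  tab {suc n} g f = cong (f (g Fin.zero) ℕ.+_)
    (trans (tab (λ i → g (Fin.suc i)) f) (sym (tab Fin.suc (λ i → f (g i)))))

Σ-allFin-δ : ∀ {n} (i : Fin n) (f : Fin n → ℕ) →
             Σ[ List.allFin n ] (λ j → 𝟙 (does (i Fin.≟ j)) ℕ.* f j) ≡ f i
Σ-allFin-δ {suc n} Fin.zero f = trans (Σ-allFin-suc (λ j → 𝟙 (does (Fin.zero Fin.≟ j)) ℕ.* f j))
  (trans (cong₂ ℕ._+_ (ℕ.+-identityʳ (f Fin.zero)) (Σ-zero (List.allFin n))) (ℕ.+-identityʳ _))
Σ-allFin-δ {suc n} (Fin.suc i) f = trans (Σ-allFin-suc (λ j → 𝟙 (does (Fin.suc i Fin.≟ j)) ℕ.* f j))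
  (Σ-allFin-δ i (λ j → f (Fin.suc j)))

infix 4 _≟ᵥ_
_≟ᵥ_ : ∀ {n} (u v : Vec Bool n) → Dec (u ≡ v)
_≟ᵥ_ = ≡-dec Bool._≟_

Σ-subsets-suc : ∀ {n} (f : Subset (suc n) → ℕ) →
  Σ[ subsets (suc n) ] f ≡ Σ[ subsets n ] (λ B → f (true ∷ B)) ℕ.+ Σ[ subsets n ] (λ B → f (false ∷ B))
Σ-subsets-suc {n} f = trans (Σ-++ (map (true ∷_) (subsets n)) _ f)
  (cong₂ ℕ._+_ (Σ-map (true ∷_) (subsets n) f) (Σ-map (false ∷_) (subsets n) f))

Σ-subsets-δ : ∀ {n} (S : Subset n) (f : Subset n → ℕ) →
              Σ[ subsets n ] (λ B → 𝟙 (does (S ≟ᵥ B)) ℕ.* f B) ≡ f S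
Σ-subsets-δ [] f = trans (ℕ.+-identityʳ _) (ℕ.+-identityʳ _)
Σ-subsets-δ {suc n} (true ∷ S) f = trans (Σ-subsets-suc (λ B → 𝟙 (does ((true ∷ S) ≟ᵥ B)) ℕ.* f B))
  (trans (cong₂ ℕ._+_ (Σ-subsets-δ S (λ B → f (true ∷ B))) (Σ-zero (subsets n))) (ℕ.+-identityʳ _))
Σ-subsets-δ {suc n} (false ∷ S) f = trans (Σ-subsets-suc (λ B → 𝟙 (does ((false ∷ S) ≟ᵥ B)) ℕ.* f B))
  (cong₂ ℕ._+_ (Σ-zero (subsets n)) (Σ-subsets-δ S (λ B → f (false ∷ B))))

Σ-subsets-one : ∀ {n} (S : Subset n) → Σ[ subsets n ] (λ B → 𝟙 (does (S ≟ᵥ B))) ≡ 1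
Σ-subsets-one {n} S =
  trans (Σ-cong (subsets n) (λ B → sym (ℕ.*-identityʳ _))) (Σ-subsets-δ S (λ _ → 1))

length-subsets : ∀ n → length (subsets n) ≡ 2 ℕ.^ n
length-subsets zero    = refl
length-subsets (suc n) = begin
  length (map (true ∷_) (subsets n) ++ map (false ∷_) (subsets n))
    ≡⟨ List.length-++ (map (true ∷_) (subsets n)) ⟩
  length (map (true ∷_) (subsets n)) ℕ.+ length (map (false ∷_) (subsets n))
    ≡⟨ cong₂ ℕ._+_ (List.length-map _ (subsets n)) (List.length-map _ (subsets n)) ⟩
  length (subsets n) ℕ.+ length (subsets n)
    ≡⟨ cong₂ ℕ._+_ (length-subsets n) (trans (length-subsets n) (sym (ℕ.+-identityʳ _))) ⟩
  2 ℕ.^ n ℕ.+ (2 ℕ.^ n ℕ.+ 0) ∎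
  where open ≡-Reasoning

∈-subsets : ∀ {n} (B : Subset n) → B ∈ subsets n
∈-subsets []          = here refl
∈-subsets (true ∷ B)  = ∈-++⁺ˡ (∈-map⁺ (true ∷_) (∈-subsets B))
∈-subsets (false ∷ B) = ∈-++⁺ʳ _ (∈-map⁺ (false ∷_) (∈-subsets B))

-- The graph on bit vectors

-- inner b e lies in the half of leading bit b, cross u v joins false ∷ u to true ∷ v; so each
-- unordered pair of distinct vertices is represented exactly once.
data Edge : ℕ → Set where
  inner : Bool → Edge k → Edge (suc k)
  cross : Vec Bool k → Vec Bool k → Edge (suc k)

dist : Vec Bool k → Vec Bool k → ℕ
dist []              []      = 0
dist {suc k} (b ∷ u) (c ∷ v) = if b xor c then 2 ^ k ℕ.+ dist u v else dist u v

-- closer t u v decides dist t v < dist u v: at the first bit where t and u differ, v agrees with t.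
closer : Vec Bool k → Vec Bool k → Vec Bool k → Bool
closer []      []      []      = false
closer (a ∷ t) (b ∷ u) (c ∷ v) = if a xor b then not (a xor c) else closer t u v

-- The term of t demands that the edges e with inc t e be present and those with zer t e be absent.
inc : Vec Bool k → Edge k → Bool
inc (a ∷ t)     (inner c e) = if a xor c then false else inc t e
inc (false ∷ t) (cross u v) = does (t ≟ᵥ u)
inc (true ∷ t)  (cross u v) = does (t ≟ᵥ v)

zer : Vec Bool k → Edge k → Bool
zer (a ∷ t)     (inner c e) = if a xor c then false else zer t e
-- The side from `false ∷ t` to `false ∷ u` stays within a half and is shorter than any crossing
-- edge, so only the other crossing side competes. An `inner` edge seen from the other half is never
-- the longest, since both remaining sides cross.
zer (false ∷ t) (cross u v) = closer t u v
zer (true ∷ t)  (cross u v) = closer t v u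

dist<2^k : (u v : Vec Bool k) → dist u v ℕ.< 2 ^ k
dist<2^k []          []          = s≤s z≤n
dist<2^k {suc k} (b ∷ u) (c ∷ v) with b xor c
... | true  = ℕ.+-monoʳ-< (2 ^ k) (ℕ.<-≤-trans (dist<2^k u v) (ℕ.m≤m+n (2 ^ k) 0))
... | false = ℕ.<-≤-trans (dist<2^k u v) (ℕ.m≤m+n (2 ^ k) _)

dist-sym : (u v : Vec Bool k) → dist u v ≡ dist v u
dist-sym []      []      = refl
dist-sym {suc k} (b ∷ u) (c ∷ v) = cong₂ (λ x d → if x then 2 ^ k ℕ.+ d else d) (Bool.xor-comm b c) (dist-sym u v)

dist-refl : (u : Vec Bool k) → dist u u ≡ 0
dist-refl []          = refl
dist-refl (true ∷ u)  = dist-refl u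
dist-refl (false ∷ u) = dist-refl u

private
  far≢near : (u v w z : Vec Bool k) → 2 ^ k ℕ.+ dist u v ≢ dist w z
  far≢near {k} u v w z e = ℕ.<-irrefl (sym e) (ℕ.<-≤-trans (dist<2^k w z) (ℕ.m≤m+n (2 ^ k) _))

  far≮near : (u v w z : Vec Bool k) → ¬ (2 ^ k ℕ.+ dist u v ℕ.< dist w z)
  far≮near {k} u v w z h = ℕ.<-asym h (ℕ.<-≤-trans (dist<2^k w z) (ℕ.m≤m+n (2 ^ k) _))

-- The leading bits of two vertices differ exactly when their distance is at least the weight of
-- that bit, so the distance to `v` gives back the bits one by one. Hence no triangle is isosceles.
dist-injective : (u w v : Vec Bool k) → dist u v ≡ dist w v → u ≡ w
dist-injective []          []          []          e = refl
dist-injective (true ∷ u)  (true ∷ w)  (true ∷ v)  e = cong (true ∷_) (dist-injective u w v e)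
dist-injective (true ∷ u)  (true ∷ w)  (false ∷ v) e = cong (true ∷_) (dist-injective u w v (ℕ.+-cancelˡ-≡ _ _ _ e))
dist-injective (true ∷ u)  (false ∷ w) (true ∷ v)  e = contradiction (sym e) (far≢near w v u v)
dist-injective (true ∷ u)  (false ∷ w) (false ∷ v) e = contradiction e (far≢near u v w v)
dist-injective (false ∷ u) (true ∷ w)  (true ∷ v)  e = contradiction e (far≢near u v w v)
dist-injective (false ∷ u) (true ∷ w)  (false ∷ v) e = contradiction (sym e) (far≢near w v u v)
dist-injective (false ∷ u) (false ∷ w) (true ∷ v)  e = cong (false ∷_) (dist-injective u w v (ℕ.+-cancelˡ-≡ _ _ _ e))
dist-injective (false ∷ u) (false ∷ w) (false ∷ v) e = cong (false ∷_) (dist-injective u w v e)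

closer-complete : (t u v : Vec Bool k) → dist t v ℕ.< dist u v → closer t u v ≡ true
closer-complete []          []          []          ()
closer-complete (true ∷ t)  (true ∷ u)  (true ∷ v)  h = closer-complete t u v h
closer-complete (true ∷ t)  (true ∷ u)  (false ∷ v) h = closer-complete t u v (ℕ.+-cancelˡ-< _ _ _ h)
closer-complete (true ∷ t)  (false ∷ u) (true ∷ v)  h = refl
closer-complete (true ∷ t)  (false ∷ u) (false ∷ v) h = contradiction h (far≮near t v u v)
closer-complete (false ∷ t) (true ∷ u)  (true ∷ v)  h = contradiction h (far≮near t v u v)
closer-complete (false ∷ t) (true ∷ u)  (false ∷ v) h = refl
closer-complete (false ∷ t) (false ∷ u) (true ∷ v)  h = closer-complete t u v (ℕ.+-cancelˡ-< _ _ _ h)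
closer-complete (false ∷ t) (false ∷ u) (false ∷ v) h = closer-complete t u v h

closer-irrefl : (t v : Vec Bool k) → closer t t v ≡ false
closer-irrefl []          []      = refl
closer-irrefl (true ∷ t)  (c ∷ v) = closer-irrefl t v
closer-irrefl (false ∷ t) (c ∷ v) = closer-irrefl t v

does-≟⇒≡ : (u v : Vec Bool k) → does (u ≟ᵥ v) ≡ true → u ≡ v
does-≟⇒≡ u v h with yes e ← u ≟ᵥ v = e

inc⇒¬zer : (t : Vec Bool k) (e : Edge k) → inc t e ≡ true → zer t e ≡ false
inc⇒¬zer (a ∷ t)     (inner c e) h with a xor c
... | false = inc⇒¬zer t e h
inc⇒¬zer (false ∷ t) (cross u v) h with refl ← does-≟⇒≡ t u h = closer-irrefl t v
inc⇒¬zer (true ∷ t)  (cross u v) h with refl ← does-≟⇒≡ t v h = closer-irrefl t u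

-- What later arguments use of an edge. It is symmetric in `u` and `v` and hides the choice between
-- `inner` and `cross`, neither of which holds for the constructors.
record EdgeBetween {k} (u v : Vec Bool k) : Set where
  field
    edge     : Edge k
    incˡ     : inc u edge ≡ true
    incʳ     : inc v edge ≡ true
    inc-only : ∀ w → inc w edge ≡ true → w ≡ u ⊎ w ≡ v
    zer-near : ∀ w → dist w u ℕ.< dist u v → dist w v ℕ.< dist u v → zer w edge ≡ true

open EdgeBetween

≟ᵥ-refl : (u : Vec Bool k) → does (u ≟ᵥ u) ≡ true
≟ᵥ-refl u = dec-true (u ≟ᵥ u) refl

EdgeBetween-sym : {u v : Vec Bool k} → EdgeBetween u v → EdgeBetween v u
EdgeBetween-sym E .edge = E .edge
EdgeBetween-sym E .incˡ = E .incʳ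
EdgeBetween-sym E .incʳ = E .incˡ
EdgeBetween-sym E .inc-only w h = [ inj₂ , inj₁ ]′ (E .inc-only w h)
EdgeBetween-sym {u = u} {v} E .zer-near w h h′ =
  E .zer-near w (subst (_ ℕ.<_) (dist-sym v u) h′) (subst (_ ℕ.<_) (dist-sym v u) h)

cross-edge : (u v : Vec Bool k) → EdgeBetween (false ∷ u) (true ∷ v)
cross-edge u v .edge = cross u v
cross-edge u v .incˡ = ≟ᵥ-refl u
cross-edge u v .incʳ = ≟ᵥ-refl v
cross-edge u v .inc-only (false ∷ w) h = inj₁ (cong (false ∷_) (does-≟⇒≡ w u h))
cross-edge u v .inc-only (true ∷ w)  h = inj₂ (cong (true ∷_) (does-≟⇒≡ w v h))
cross-edge u v .zer-near (false ∷ w) _ h = closer-complete w u v (ℕ.+-cancelˡ-< _ _ _ h)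
cross-edge u v .zer-near (true ∷ w)  h _ =
  closer-complete w v u (subst (dist w u ℕ.<_) (dist-sym u v) (ℕ.+-cancelˡ-< _ _ _ h))

inner-edge : ∀ b {u v : Vec Bool k} → EdgeBetween u v → EdgeBetween (b ∷ u) (b ∷ v)
inner-edge b E .edge = inner b (E .edge)
inner-edge b E .incˡ rewrite Bool.xor-same b = E .incˡ
inner-edge b E .incʳ rewrite Bool.xor-same b = E .incʳ
inner-edge true  E .inc-only (true ∷ w)  h = [ inj₁ ∘ cong _ , inj₂ ∘ cong _ ]′ (E .inc-only w h)
inner-edge false E .inc-only (false ∷ w) h = [ inj₁ ∘ cong _ , inj₂ ∘ cong _ ]′ (E .inc-only w h)
inner-edge true  {u} {v} E .zer-near (true ∷ w)  h h′ = E .zer-near w h h′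
inner-edge true  {u} {v} E .zer-near (false ∷ w) h h′ = contradiction h (far≮near w u u v)
inner-edge false {u} {v} E .zer-near (true ∷ w)  h h′ = contradiction h (far≮near w u u v)
inner-edge false {u} {v} E .zer-near (false ∷ w) h h′ = E .zer-near w h h′

edgeBetween : (u v : Vec Bool k) → u ≢ v → EdgeBetween u v
edgeBetween []          []          u≢v = contradiction refl u≢v
edgeBetween (false ∷ u) (true ∷ v)  u≢v = cross-edge u v
edgeBetween (true ∷ u)  (false ∷ v) u≢v = EdgeBetween-sym (cross-edge v u)
edgeBetween (false ∷ u) (false ∷ v) u≢v = inner-edge false (edgeBetween u v (u≢v ∘ cong (false ∷_)))
edgeBetween (true ∷ u)  (true ∷ v)  u≢v = inner-edge true (edgeBetween u v (u≢v ∘ cong (true ∷_)))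

-- Violated terms: four vertices, and sets of edges that hit everything violated

broken : Vec Bool k → (Edge k → Bool) → Edge k → Bool
broken t y e = if y e then zer t e else inc t e

broken-0 : ∀ (t : Vec Bool k) y {e} → y e ≡ false → inc t e ≡ true → broken t y e ≡ true
broken-0 t y h i rewrite h = i

broken-1 : ∀ (t : Vec Bool k) y {e} → y e ≡ true → zer t e ≡ true → broken t y e ≡ true
broken-1 t y h z rewrite h = z

-- A block that makes the term of `s` true must flip every edge that violates it. So blocks serving
-- `s` and `t` both contain the edge found here and are not disjoint.
Meet : (Edge k → Bool) → Vec Bool k → Vec Bool k → Set
Meet y s t = ∃ λ e → broken s y e ≡ true × broken t y e ≡ true

longest-edge : ∀ (y : Edge k → Bool) u v w z → u ≢ v → w ≢ u → w ≢ v → z ≢ u → z ≢ v →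
               dist w u ℕ.≤ dist u v → dist w v ℕ.≤ dist u v →
               dist z u ℕ.≤ dist u v → dist z v ℕ.≤ dist u v →
               Meet y u v ⊎ Meet y w z
longest-edge y u v w z u≢v w≢u w≢v z≢u z≢v wu wv zu zv with edgeBetween u v u≢v
... | E with y (E .edge) in eq
... | false = inj₁ (E .edge , broken-0 u y eq (E .incˡ) , broken-0 v y eq (E .incʳ))
... | true  = inj₂ (E .edge , broken-1 w y eq (near w w≢u w≢v wu wv) , broken-1 z y eq (near z z≢u z≢v zu zv))
  where
  -- Weak inequalities suffice as hypotheses: equality in one of them would make two sides at `u` or
  -- at `v` equal, and then `w` would be the other end.
  near : ∀ w → w ≢ u → w ≢ v → dist w u ℕ.≤ dist u v → dist w v ℕ.≤ dist u v → zer w (E .edge) ≡ true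
  near w w≢u w≢v wu wv = E .zer-near w
    (ℕ.≤∧≢⇒< wu (λ e → w≢v (dist-injective w v u (trans e (dist-sym u v)))))
    (ℕ.≤∧≢⇒< wv (λ e → w≢u (dist-injective w u v e)))

argmax : ∀ {n} (f : Fin (suc n) → ℕ) → ∃ λ i → ∀ j → f j ℕ.≤ f i
argmax {zero}  f = Fin.zero , λ { Fin.zero → ℕ.≤-refl }
argmax {suc n} f with argmax (f ∘ Fin.suc)
... | i , max with ℕ.≤-total (f Fin.zero) (f (Fin.suc i))
... | inj₁ h = Fin.suc i , λ { Fin.zero → h ; (Fin.suc j) → max j }
... | inj₂ h = Fin.zero , λ { Fin.zero → ℕ.≤-refl ; (Fin.suc j) → ℕ.≤-trans (max j) h }

argmax₂ : ∀ {m n} (f : Fin (suc m) → Fin (suc n) → ℕ) → ∃₂ λ i j → ∀ a b → f a b ℕ.≤ f i j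
argmax₂ f =
  let i , max = argmax (λ a → f a (proj₁ (argmax (f a))))
  in i , proj₁ (argmax (f i)) , λ a b → ℕ.≤-trans (proj₂ (argmax (f a)) b) (max a)

abstract
  -- Checked by enumeration. The case `i ≡ j` is included because the pair that attains the maximum
  -- is shown to be distinct only afterwards, by means of `w`.
  two-others : ∀ (i j : Fin 4) → ∃₂ λ w z → w ≢ z × w ≢ i × w ≢ j × z ≢ i × z ≢ j
  two-others = toWitness {a? = Fin.all? λ i → Fin.all? λ j → Fin.any? λ w → Fin.any? λ z →
    ¬? (w Fin.≟ z) ×-dec ¬? (w Fin.≟ i) ×-dec ¬? (w Fin.≟ j) ×-dec ¬? (z Fin.≟ i) ×-dec ¬? (z Fin.≟ j)} _

four-meet : ∀ (y : Edge k → Bool) (q : Fin 4 → Vec Bool k) → (∀ i j → i ≢ j → q i ≢ q j) →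
            ∃₂ λ i j → i ≢ j × Meet y (q i) (q j)
four-meet y q q-inj = split (argmax₂ (λ i j → dist (q i) (q j)))
  where
  -- A maximum attained on the diagonal would be 0, and then all four vertices would coincide.
  coincide : ∀ {i j w} → dist (q w) (q i) ℕ.≤ dist (q i) (q j) → i ≡ j → q w ≡ q i
  coincide {i} {j} {w} h refl = dist-injective (q w) (q i) (q i)
    (trans (ℕ.n≤0⇒n≡0 (subst (dist (q w) (q i) ℕ.≤_) (dist-refl (q i)) h)) (sym (dist-refl (q i))))
  split : (∃₂ λ i j → ∀ a b → dist (q a) (q b) ℕ.≤ dist (q i) (q j)) →
          ∃₂ λ i j → i ≢ j × Meet y (q i) (q j)
  split (i , j , max) with two-others i j
  ... | w , z , w≢z , w≢i , w≢j , z≢i , z≢j =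
    [ (λ m → i , j , i≢j , m) , (λ m → w , z , w≢z , m) ]′
      (longest-edge y (q i) (q j) (q w) (q z) (q-inj i j i≢j)
        (q-inj w i w≢i) (q-inj w j w≢j) (q-inj z i z≢i) (q-inj z j z≢j)
        (max w i) (max w j) (max z i) (max z j))
    where
    i≢j : i ≢ j
    i≢j e = q-inj w i w≢i (coincide (max w i) e)

negate : Vec Bool k → Vec Bool k
negate = Vec.map not

negate-involutive : (u : Vec Bool k) → negate (negate u) ≡ u
negate-involutive []      = refl
negate-involutive (b ∷ u) = cong₂ _∷_ (Bool.not-involutive b) (negate-involutive u)

-- `negate u` disagrees with `u` at every bit, so at the first bit where `t` departs from `u` it
-- agrees with `t`.
closer-antipode : (t u : Vec Bool k) → t ≢ u → closer t u (negate u) ≡ true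
closer-antipode []          []          t≢u = contradiction refl t≢u
closer-antipode (true ∷ t)  (true ∷ u)  t≢u = closer-antipode t u (t≢u ∘ cong (true ∷_))
closer-antipode (false ∷ t) (false ∷ u) t≢u = closer-antipode t u (t≢u ∘ cong (false ∷_))
closer-antipode (true ∷ t)  (false ∷ u) t≢u = refl
closer-antipode (false ∷ t) (true ∷ u)  t≢u = refl

-- The edge from `false ∷ u` to its bitwise complement, at the greatest distance there is. Over all
-- `u` these edges form a perfect matching.
antipodal : Vec Bool k → Edge (suc k)
antipodal u = cross u (negate u)

zer-antipodal : (t : Vec Bool (suc k)) (u : Vec Bool k) → t ≢ false ∷ u → t ≢ true ∷ negate u →
                zer t (antipodal u) ≡ true
zer-antipodal (false ∷ t) u h _ = closer-antipode t u (h ∘ cong (false ∷_))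
zer-antipodal (true ∷ t)  u _ h = subst (λ v → closer t (negate u) v ≡ true) (negate-involutive u)
  (closer-antipode t (negate u) (h ∘ cong (true ∷_)))

inc-antipodal : (t : Vec Bool (suc k)) → ∃ λ u → inc t (antipodal u) ≡ true
inc-antipodal (false ∷ t) = t , ≟ᵥ-refl t
inc-antipodal (true ∷ t)  = negate t , dec-true (t ≟ᵥ _) (sym (negate-involutive t))

hitting-set : ∀ (y : Edge (suc k) → Bool) → 3 ℕ.≤ 2 ^ k → (∀ t → ∃ λ e → broken t y e ≡ true) →
              ∃ λ T → length T ℕ.≤ 2 ^ k × (∀ t → ∃ λ e → e ∈ T × broken t y e ≡ true)
hitting-set {k} y 3≤ violated with Any.any? (λ u → y (antipodal u) Bool.≟ true) (subsets k)
... | yes p with find p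
... | u , _ , yu =
  -- The present edge violates all terms but those of its two ends; for each end any edge that
  -- violates its term is added. These three elements are the reason for `3 ≤ 2 ^ k`.
  antipodal u ∷ proj₁ (violated s₀) ∷ proj₁ (violated s₁) ∷ [] , 3≤ , hit
  where
  s₀ = false ∷ u
  s₁ = true ∷ negate u
  hit : ∀ t → ∃ λ e → e ∈ _ × broken t y e ≡ true
  hit t with t ≟ᵥ s₀ | t ≟ᵥ s₁
  ... | yes refl | _        = _ , there (here refl) , proj₂ (violated s₀)
  ... | no _     | yes refl = _ , there (there (here refl)) , proj₂ (violated s₁)
  ... | no t≢s₀  | no t≢s₁  = _ , here refl , broken-1 t y yu (zer-antipodal t u t≢s₀ t≢s₁)
hitting-set {k} y 3≤ violated | no none =
  map antipodal (subsets k) ,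
  ℕ.≤-reflexive (trans (List.length-map antipodal (subsets k)) (length-subsets k)) ,
  λ t → case inc-antipodal t of λ (u , h) →
    antipodal u , ∈-map⁺ antipodal (∈-subsets u) , broken-0 t y (Bool.¬-not (λ yu → none (lose (∈-subsets u) yu))) h

-- Listing the edges and counting those that a term mentions

allEdges : ∀ k → List (Edge k)
allEdges zero    = []
allEdges (suc k) = map (inner true) (allEdges k) ++ map (inner false) (allEdges k) ++
                   cartesianProductWith cross (subsets k) (subsets k)

∈-allEdges : (e : Edge k) → e ∈ allEdges k
∈-allEdges (inner true e)  = ∈-++⁺ˡ (∈-map⁺ (inner true) (∈-allEdges e))
∈-allEdges (inner false e) = ∈-++⁺ʳ (map (inner true) (allEdges _)) (∈-++⁺ˡ (∈-map⁺ (inner false) (∈-allEdges e)))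
∈-allEdges (cross u v)     = ∈-++⁺ʳ (map (inner true) (allEdges _)) (∈-++⁺ʳ (map (inner false) (allEdges _))
  (∈-cartesianProductWith⁺ cross (∈-subsets u) (∈-subsets v)))

subsets-unique : ∀ k → Unique (subsets k)
subsets-unique zero    = All.[] ∷ []
subsets-unique (suc k) = Unique.++⁺ (Unique.map⁺ ∷-injectiveʳ (subsets-unique k))
  (Unique.map⁺ ∷-injectiveʳ (subsets-unique k))
  λ (p , q) → case (∈-map⁻ (true ∷_) p , ∈-map⁻ (false ∷_) q) of λ { ((_ , _ , refl) , (_ , _ , ())) }

allEdges-unique : ∀ k → Unique (allEdges k)
allEdges-unique zero    = []
allEdges-unique (suc k) = Unique.++⁺ (Unique.map⁺ (λ { refl → refl }) (allEdges-unique k))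
  (Unique.++⁺ (Unique.map⁺ (λ { refl → refl }) (allEdges-unique k))
    (Unique.cartesianProductWith⁺ cross (λ { refl → refl , refl }) (subsets-unique k) (subsets-unique k))
    λ (p , q) → case (∈-map⁻ (inner false) p , cross⁻ q) of λ { ((_ , _ , refl) , (_ , _ , ())) })
  λ (p , q) → case ∈-map⁻ (inner true) p of λ { (_ , _ , refl) →
    [ (λ r → case ∈-map⁻ (inner false) r of λ { (_ , _ , ()) }) , (λ r → case cross⁻ r of λ { (_ , _ , ()) }) ]′
      (∈-++⁻ (map (inner false) (allEdges k)) q) }
  where
  cross⁻ : ∀ {e} → e ∈ cartesianProductWith cross (subsets k) (subsets k) → ∃₂ λ u v → e ≡ cross u v
  cross⁻ h = let u , v , _ , _ , eq = ∈-cartesianProductWith⁻ cross (subsets k) (subsets k) h in u , v , eq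

degree : (e : Edge k) → Σ[ subsets k ] (λ t → 𝟙 (inc t e)) ≡ 2
degree {suc k} (inner true e) = trans (Σ-subsets-suc (λ t → 𝟙 (inc t (inner true e))))
  (cong₂ ℕ._+_ (degree e) (Σ-zero (subsets k)))
degree {suc k} (inner false e) = trans (Σ-subsets-suc (λ t → 𝟙 (inc t (inner false e))))
  (cong₂ ℕ._+_ (Σ-zero (subsets k)) (degree e))
degree {suc k} (cross u v) = trans (Σ-subsets-suc (λ t → 𝟙 (inc t (cross u v)))) (cong₂ ℕ._+_ (point v) (point u))
  where
  ≟-comm : ∀ {n} (s t : Vec Bool n) → does (s ≟ᵥ t) ≡ does (t ≟ᵥ s)
  ≟-comm s t with s ≟ᵥ t
  ... | yes refl = sym (≟ᵥ-refl s)
  ... | no s≢t   = sym (dec-false (t ≟ᵥ s) (s≢t ∘ sym))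
  point : ∀ u → Σ[ subsets k ] (λ t → 𝟙 (does (t ≟ᵥ u))) ≡ 1
  point u = trans (Σ-cong (subsets k) (λ t → cong 𝟙 (≟-comm t u))) (Σ-subsets-one u)

closerPairs : Vec Bool k → ℕ
closerPairs {k} t = Σ[ subsets k ] λ u → Σ[ subsets k ] λ v → 𝟙 (closer t u v)

Σ-subsets-const : ∀ k c → Σ[ subsets k ] (λ _ → c) ≡ 2 ^ k ℕ.* c
Σ-subsets-const k c = trans (Σ-const (subsets k) c) (cong (ℕ._* c) (length-subsets k))

-- If `u` lies in the half of `t`, the leading bit of `v` is free, which doubles the count. If `u`
-- lies in the other half, exactly the `v` in the half of `t` qualify, whatever their other bits.
closerPairs-∷ : ∀ b (t : Vec Bool k) →
                closerPairs (b ∷ t) ≡ closerPairs t ℕ.+ closerPairs t ℕ.+ 2 ^ k ℕ.* (2 ^ k)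
closerPairs-∷ {k} = λ where
    true  t → trans (Σ-subsets-suc (row true t)) (cong₂ ℕ._+_ (same true t) (diff true t))
    false t → trans (Σ-subsets-suc (row false t))
      (trans (ℕ.+-comm (Σ[ subsets k ] (λ u → row false t (true ∷ u))) _) (cong₂ ℕ._+_ (same false t) (diff false t)))
  where
  open ≡-Reasoning
  row : Bool → Vec Bool k → Vec Bool (suc k) → ℕ
  row b t u = Σ[ subsets (suc k) ] λ v → 𝟙 (closer (b ∷ t) u v)
  same : ∀ b t → Σ[ subsets k ] (λ u → row b t (b ∷ u)) ≡ closerPairs t ℕ.+ closerPairs t
  same true  t = trans (Σ-cong (subsets k) λ u → Σ-subsets-suc (𝟙 ∘ closer (true ∷ t) (true ∷ u))) (Σ-+ (subsets k) _ _)
  same false t = trans (Σ-cong (subsets k) λ u → Σ-subsets-suc (𝟙 ∘ closer (false ∷ t) (false ∷ u))) (Σ-+ (subsets k) _ _)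
  diff-row : ∀ b t u → row b t (not b ∷ u) ≡ 2 ^ k
  diff-row true t u = begin
    row true t (false ∷ u)            ≡⟨ Σ-subsets-suc (𝟙 ∘ closer (true ∷ t) (false ∷ u)) ⟩
    Σ[ subsets k ] (λ _ → 1) ℕ.+ Σ[ subsets k ] (λ _ → 0)
                                      ≡⟨ cong₂ ℕ._+_ (Σ-subsets-const k 1) (Σ-zero (subsets k)) ⟩
    2 ^ k ℕ.* 1 ℕ.+ 0                 ≡⟨ trans (ℕ.+-identityʳ _) (ℕ.*-identityʳ _) ⟩
    2 ^ k                             ∎
  diff-row false t u = begin
    row false t (true ∷ u)            ≡⟨ Σ-subsets-suc (𝟙 ∘ closer (false ∷ t) (true ∷ u)) ⟩
    Σ[ subsets k ] (λ _ → 0) ℕ.+ Σ[ subsets k ] (λ _ → 1)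
                                      ≡⟨ cong₂ ℕ._+_ (Σ-zero (subsets k)) (Σ-subsets-const k 1) ⟩
    2 ^ k ℕ.* 1                       ≡⟨ ℕ.*-identityʳ _ ⟩
    2 ^ k                             ∎
  diff : ∀ b t → Σ[ subsets k ] (λ u → row b t (not b ∷ u)) ≡ 2 ^ k ℕ.* (2 ^ k)
  diff b t = trans (Σ-cong (subsets k) (diff-row b t)) (Σ-subsets-const k (2 ^ k))

-- For each `u ≢ t` exactly half of the `v` are nearer to `t`, so with m vertices the number of
-- pairs is (m - 1)·m/2; stated without subtraction or division.
closerPairs-count : (t : Vec Bool k) → 2 ℕ.* closerPairs t ℕ.+ 2 ^ k ≡ 2 ^ k ℕ.* 2 ^ k
closerPairs-count []                = refl
closerPairs-count {suc k} (b ∷ t) = begin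
  2 ℕ.* closerPairs (b ∷ t) ℕ.+ 2 ℕ.* m             ≡⟨ cong (λ p → 2 ℕ.* p ℕ.+ 2 ℕ.* m) (closerPairs-∷ b t) ⟩
  2 ℕ.* (p ℕ.+ p ℕ.+ m ℕ.* m) ℕ.+ 2 ℕ.* m           ≡⟨ regroup p m ⟩
  2 ℕ.* (2 ℕ.* p ℕ.+ m) ℕ.+ 2 ℕ.* (m ℕ.* m)         ≡⟨ cong (λ q → 2 ℕ.* q ℕ.+ 2 ℕ.* (m ℕ.* m)) (closerPairs-count t) ⟩
  2 ℕ.* (m ℕ.* m) ℕ.+ 2 ℕ.* (m ℕ.* m)               ≡⟨ double m ⟩
  2 ℕ.* m ℕ.* (2 ℕ.* m)                             ∎
  where
  open ≡-Reasoning
  open ℕ-Solver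
  p = closerPairs t
  m = 2 ^ k
  regroup : ∀ p m → 2 ℕ.* (p ℕ.+ p ℕ.+ m ℕ.* m) ℕ.+ 2 ℕ.* m ≡ 2 ℕ.* (2 ℕ.* p ℕ.+ m) ℕ.+ 2 ℕ.* (m ℕ.* m)
  regroup = solve 2 (λ p m → con 2 :* (p :+ p :+ m :* m) :+ con 2 :* m := con 2 :* (con 2 :* p :+ m) :+ con 2 :* (m :* m)) refl
  double : ∀ m → 2 ℕ.* (m ℕ.* m) ℕ.+ 2 ℕ.* (m ℕ.* m) ≡ 2 ℕ.* m ℕ.* (2 ℕ.* m)
  double = solve 1 (λ m → con 2 :* (m :* m) :+ con 2 :* (m :* m) := con 2 :* m :* (con 2 :* m)) refl

inDomain : Vec Bool k → Edge k → Bool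
inDomain t e = inc t e ∨ zer t e

domainSize : Vec Bool k → ℕ
domainSize {k} t = Σ[ allEdges k ] (λ e → 𝟙 (inDomain t e))

𝟙-∨ : ∀ {a b} → (a ≡ true → b ≡ false) → 𝟙 (a ∨ b) ≡ 𝟙 a ℕ.+ 𝟙 b
𝟙-∨ {true}  h rewrite h refl = refl
𝟙-∨ {false} h = refl

domainSize-∷ : ∀ b (t : Vec Bool k) → domainSize (b ∷ t) ≡ domainSize t ℕ.+ (2 ^ k ℕ.+ closerPairs t)
domainSize-∷ {k} b t = trans (Σ-++ (map (inner true) (allEdges k)) _ d)
    (trans (cong (Σ[ map (inner true) (allEdges k) ] d ℕ.+_) (Σ-++ (map (inner false) (allEdges k)) _ d))
      (trans (cong₂ ℕ._+_ (Σ-map (inner true) (allEdges k) d) (cong₂ ℕ._+_ (Σ-map (inner false) (allEdges k) d) (crossing b)))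
        (halves b)))
  where
  open ≡-Reasoning
  d = λ e → 𝟙 (inDomain (b ∷ t) e)
  halves : ∀ b → Σ[ allEdges k ] (λ e → 𝟙 (inDomain (b ∷ t) (inner true e))) ℕ.+
                 (Σ[ allEdges k ] (λ e → 𝟙 (inDomain (b ∷ t) (inner false e))) ℕ.+ (2 ^ k ℕ.+ closerPairs t)) ≡
                 domainSize t ℕ.+ (2 ^ k ℕ.+ closerPairs t)
  halves true  = cong (λ z → domainSize t ℕ.+ (z ℕ.+ (2 ^ k ℕ.+ closerPairs t))) (Σ-zero (allEdges k))
  halves false = cong (ℕ._+ (domainSize t ℕ.+ (2 ^ k ℕ.+ closerPairs t))) (Σ-zero (allEdges k))
  table : (Vec Bool k → Vec Bool k → ℕ) → ℕ
  table f = Σ[ subsets k ] λ u → Σ[ subsets k ] λ v → f u v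
  swapped : ∀ f → table f ≡ table (λ u v → f v u)
  swapped f = Σ-swap (subsets k) (subsets k) f
  falseCase : table (λ u v → 𝟙 (inDomain (false ∷ t) (cross u v))) ≡ 2 ^ k ℕ.+ closerPairs t
  falseCase = begin
    table (λ u v → 𝟙 (does (t ≟ᵥ u) ∨ closer t u v))
      ≡⟨ Σ-cong (subsets k) (λ u → Σ-cong (subsets k) (λ v → 𝟙-∨ (inc⇒¬zer (false ∷ t) (cross u v)))) ⟩
    table (λ u v → 𝟙 (does (t ≟ᵥ u)) ℕ.+ 𝟙 (closer t u v))
      ≡⟨ trans (Σ-cong (subsets k) (λ u → Σ-+ (subsets k) _ _)) (Σ-+ (subsets k) _ _) ⟩
    table (λ u v → 𝟙 (does (t ≟ᵥ u))) ℕ.+ closerPairs t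
      ≡⟨ cong (ℕ._+ closerPairs t) (trans (swapped _) (Σ-cong (subsets k) (λ _ → Σ-subsets-one t))) ⟩
    Σ[ subsets k ] (λ _ → 1) ℕ.+ closerPairs t
      ≡⟨ cong (ℕ._+ closerPairs t) (trans (Σ-subsets-const k 1) (ℕ.*-identityʳ _)) ⟩
    2 ^ k ℕ.+ closerPairs t ∎
  crossing : ∀ b → Σ[ cartesianProductWith cross (subsets k) (subsets k) ] (λ e → 𝟙 (inDomain (b ∷ t) e)) ≡
                   2 ^ k ℕ.+ closerPairs t
  crossing false = trans (Σ-product cross (subsets k) (subsets k) _) falseCase
  -- Seen from the other half the two ends of a crossing edge exchange roles, so transposing the
  -- table reduces to the first case.
  crossing true  = trans (Σ-product cross (subsets k) (subsets k) _) (trans (swapped _) falseCase)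

-- For m = 2^k this says (m - 1)(m + 4)/6 = (m - 1) + (m - 1)(m - 2)/6, the incident edges plus the
-- negative ones. The induction adds the crossing edges: m incident to the vertex and
-- `closerPairs t` negative.
domainSize-count : (t : Vec Bool k) → 6 ℕ.* domainSize t ℕ.+ 4 ≡ 2 ^ k ℕ.* 2 ^ k ℕ.+ 3 ℕ.* 2 ^ k
domainSize-count []                = refl
domainSize-count {suc k} (b ∷ t) = begin
  6 ℕ.* domainSize (b ∷ t) ℕ.+ 4
    ≡⟨ cong (λ s → 6 ℕ.* s ℕ.+ 4) (domainSize-∷ b t) ⟩
  6 ℕ.* (s ℕ.+ (m ℕ.+ p)) ℕ.+ 4
    ≡⟨ regroup s m p ⟩
  (6 ℕ.* s ℕ.+ 4) ℕ.+ (3 ℕ.* (2 ℕ.* p ℕ.+ m) ℕ.+ 3 ℕ.* m)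
    ≡⟨ cong₂ (λ x y → x ℕ.+ (3 ℕ.* y ℕ.+ 3 ℕ.* m)) (domainSize-count t) (closerPairs-count t) ⟩
  m ℕ.* m ℕ.+ 3 ℕ.* m ℕ.+ (3 ℕ.* (m ℕ.* m) ℕ.+ 3 ℕ.* m)
    ≡⟨ collect m ⟩
  2 ℕ.* m ℕ.* (2 ℕ.* m) ℕ.+ 3 ℕ.* (2 ℕ.* m) ∎
  where
  open ≡-Reasoning
  open ℕ-Solver
  s = domainSize t
  p = closerPairs t
  m = 2 ^ k
  regroup : ∀ s m p → 6 ℕ.* (s ℕ.+ (m ℕ.+ p)) ℕ.+ 4 ≡ (6 ℕ.* s ℕ.+ 4) ℕ.+ (3 ℕ.* (2 ℕ.* p ℕ.+ m) ℕ.+ 3 ℕ.* m)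
  regroup = solve 3 (λ s m p → con 6 :* (s :+ (m :+ p)) :+ con 4 :=
    (con 6 :* s :+ con 4) :+ (con 3 :* (con 2 :* p :+ m) :+ con 3 :* m)) refl
  collect : ∀ m → m ℕ.* m ℕ.+ 3 ℕ.* m ℕ.+ (3 ℕ.* (m ℕ.* m) ℕ.+ 3 ℕ.* m) ≡ 2 ℕ.* m ℕ.* (2 ℕ.* m) ℕ.+ 3 ℕ.* (2 ℕ.* m)
  collect = solve 1 (λ m → m :* m :+ con 3 :* m :+ (con 3 :* (m :* m) :+ con 3 :* m) :=
    con 2 :* m :* (con 2 :* m) :+ con 3 :* (con 2 :* m)) refl

domain : Vec Bool k → List (Edge k)
domain {k} t = filter (λ e → inDomain t e Bool.≟ true) (allEdges k)

length-domain : (t : Vec Bool k) → length (domain t) ≡ domainSize t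
length-domain {k} t = trans (length-filter (λ e → inDomain t e Bool.≟ true) (allEdges k))
  (Σ-cong (allEdges k) λ e → cong 𝟙 (≟-true (inDomain t e)))
  where
  ≟-true : ∀ b → does (b Bool.≟ true) ≡ b
  ≟-true true  = refl
  ≟-true false = refl

∈-domain : (t : Vec Bool k) (e : Edge k) → inDomain t e ≡ true → e ∈ domain t
∈-domain t e h = ∈-filter⁺ (λ e → inDomain t e Bool.≟ true) (∈-allEdges e) h

domain-unique : (t : Vec Bool k) → Unique (domain t)
domain-unique {k} t = Unique.filter⁺ (λ e → inDomain t e Bool.≟ true) (allEdges-unique k)

different : (u : Vec Bool (suc k)) → ∃ λ v → v ≢ u
different (b ∷ u) = not b ∷ u , λ e → Bool.not-¬ refl (sym (∷-injectiveˡ e))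

-- Two of the three leading bits agree. In the opposite half at most one vertex remains to be
-- avoided, and `different` avoids its tail.
avoid-three : (a b c : Vec Bool (2 ℕ.+ k)) → ∃ λ d → d ≢ a × d ≢ b × d ≢ c
avoid-three (true ∷ a) (true ∷ b) (c₀ ∷ c) =
  let d , h = different c in false ∷ d , (λ ()) , (λ ()) , h ∘ ∷-injectiveʳ
avoid-three (false ∷ a) (false ∷ b) (c₀ ∷ c) =
  let d , h = different c in true ∷ d , (λ ()) , (λ ()) , h ∘ ∷-injectiveʳ
avoid-three (true ∷ a) (false ∷ b) (true ∷ c) =
  let d , h = different b in false ∷ d , (λ ()) , h ∘ ∷-injectiveʳ , (λ ())
avoid-three (true ∷ a) (false ∷ b) (false ∷ c) =
  let d , h = different a in true ∷ d , h ∘ ∷-injectiveʳ , (λ ()) , (λ ())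
avoid-three (false ∷ a) (true ∷ b) (true ∷ c) =
  let d , h = different a in false ∷ d , h ∘ ∷-injectiveʳ , (λ ()) , (λ ())
avoid-three (false ∷ a) (true ∷ b) (false ∷ c) =
  let d , h = different b in true ∷ d , (λ ()) , h ∘ ∷-injectiveʳ , (λ ())

endpoints : (e : Edge k) → ∃₂ λ u v → ∀ w → inc w e ≡ true → w ≡ u ⊎ w ≡ v
endpoints (cross u v) = false ∷ u , true ∷ v , EdgeBetween.inc-only (cross-edge u v)
endpoints (inner b e) with endpoints e
... | u , v , h = b ∷ u , b ∷ v , only b
  where
  only : ∀ b w → inc w (inner b e) ≡ true → w ≡ b ∷ u ⊎ w ≡ b ∷ v
  only true  (true ∷ w)  i = [ inj₁ ∘ cong _ , inj₂ ∘ cong _ ]′ (h w i)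
  only false (false ∷ w) i = [ inj₁ ∘ cong _ , inj₂ ∘ cong _ ]′ (h w i)

-- Serves to keep the term of `t` false when a single edge `e` is flipped in the star of `s`: the
-- edge `e′` is demanded by `t`, absent from that star, and not the one flipped. If `t` is an end of
-- `e`, a neighbour outside `s` and both ends of `e` provides it.
private-edge : ∀ {s t : Vec Bool (2 ℕ.+ k)} (e : Edge (2 ℕ.+ k)) → t ≢ s →
               ∃ λ e′ → inc t e′ ≡ true × inc s e′ ≡ false × e′ ≢ e
private-edge {s = s} {t} e t≢s with inc t e in te | endpoints e
... | true | u , v , ends with avoid-three s u v
... | a , a≢s , a≢u , a≢v = E .edge , E .incˡ , Bool.¬-not (λ h → [ t≢s ∘ sym , a≢s ∘ sym ]′ (E .inc-only s h)) ,
  λ eq → [ a≢u , a≢v ]′ (ends a (subst (λ e → inc a e ≡ true) eq (E .incʳ)))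
  where
  t≢a : t ≢ a
  t≢a refl = [ a≢u , a≢v ]′ (ends a te)
  E = edgeBetween t a t≢a
private-edge {s = s} {t} e t≢s | false | _ with avoid-three s t t
... | a , a≢s , a≢t , _ = E .edge , E .incˡ , Bool.¬-not (λ h → [ t≢s ∘ sym , a≢s ∘ sym ]′ (E .inc-only s h)) ,
  λ eq → case trans (sym te) (subst (λ e → inc t e ≡ true) eq (E .incˡ)) of λ ()
  where
  E = edgeBetween t a (a≢t ∘ sym)

-- Linear programming bounds

half-pos : ∀ {ε} → 0ℚ ℚ.< ε → 0ℚ ℚ.< ½ ℚ.* ε
half-pos {ε} 0<ε = subst (ℚ._< ½ ℚ.* ε) (ℚ.*-zeroʳ ½) (ℚ.*-monoʳ-<-pos ½ 0<ε)

½+½≡ : ∀ p → ½ ℚ.* p ℚ.+ ½ ℚ.* p ≡ p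
½+½≡ = solve 1 (λ p → con ½ :* p :+ con ½ :* p := p) refl
  where open ℚ-Solver

p≤p+ε : ∀ {p ε} → 0ℚ ℚ.< ε → p ℚ.≤ p ℚ.+ ε
p≤p+ε {p} {ε} 0<ε = subst (ℚ._≤ p ℚ.+ ε) (ℚ.+-identityʳ p) (ℚ.+-monoʳ-≤ p (ℚ.<⇒≤ 0<ε))

pointwise-≤ : ∀ {x y} → (∀ n → seq x n ℚ.≤ seq y n) → x ≤ y
pointwise-≤ h ε 0<ε = 0 , λ n _ → ℚ.≤-trans (h n) (p≤p+ε 0<ε)

pointwise-≃ : ∀ {x y} → (∀ n → seq x n ≡ seq y n) → x ≃ y
pointwise-≃ {x} {y} h ε 0<ε = 0 , λ n _ →
  subst (ℚ._≤ ε) (sym (trans (cong (λ r → ℚ.∣ r ℚ.- seq y n ∣) (h n)) (cong ℚ.∣_∣ (ℚ.+-inverseʳ (seq y n))))) (ℚ.<⇒≤ 0<ε)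

≤-trans : ∀ {x y z} → x ≤ y → y ≤ z → x ≤ z
≤-trans {x} {y} {z} h k ε 0<ε =
  let M , hM = h (½ ℚ.* ε) (half-pos 0<ε)
      N , kN = k (½ ℚ.* ε) (half-pos 0<ε)
  in M ℕ.⊔ N , λ n p → begin
    seq x n
      ≤⟨ hM n (ℕ.m⊔n≤o⇒m≤o M N p) ⟩
    seq y n ℚ.+ ½ ℚ.* ε
      ≤⟨ ℚ.+-monoˡ-≤ (½ ℚ.* ε) (kN n (ℕ.m⊔n≤o⇒n≤o M N p)) ⟩
    seq z n ℚ.+ ½ ℚ.* ε ℚ.+ ½ ℚ.* ε
      ≡⟨ trans (ℚ.+-assoc (seq z n) _ _) (cong (seq z n ℚ.+_) (½+½≡ ε)) ⟩
    seq z n ℚ.+ ε ∎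
  where open ℚ.≤-Reasoning

+-mono-≤ : ∀ {x y u v} → x ≤ y → u ≤ v → x + u ≤ y + v
+-mono-≤ {x} {y} {u} {v} h k ε 0<ε =
  let M , hM = h (½ ℚ.* ε) (half-pos 0<ε)
      N , kN = k (½ ℚ.* ε) (half-pos 0<ε)
  in M ℕ.⊔ N , λ n p → begin
    seq x n ℚ.+ seq u n
      ≤⟨ ℚ.+-mono-≤ (hM n (ℕ.m⊔n≤o⇒m≤o M N p)) (kN n (ℕ.m⊔n≤o⇒n≤o M N p)) ⟩
    seq y n ℚ.+ ½ ℚ.* ε ℚ.+ (seq v n ℚ.+ ½ ℚ.* ε)
      ≡⟨ regroup (seq y n) (½ ℚ.* ε) (seq v n) ⟩
    seq y n ℚ.+ seq v n ℚ.+ (½ ℚ.* ε ℚ.+ ½ ℚ.* ε)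
      ≡⟨ cong (seq y n ℚ.+ seq v n ℚ.+_) (½+½≡ ε) ⟩
    seq y n ℚ.+ seq v n ℚ.+ ε ∎
  where
  open ℚ.≤-Reasoning
  regroup : ∀ a b c → a ℚ.+ b ℚ.+ (c ℚ.+ b) ≡ a ℚ.+ c ℚ.+ (b ℚ.+ b)
  regroup = solve 3 (λ a b c → a :+ b :+ (c :+ b) := a :+ c :+ (b :+ b)) refl
    where open ℚ-Solver

neg≤∣∣ : ∀ p → ℚ.- p ℚ.≤ ℚ.∣ p ∣
neg≤∣∣ p with ℚ.≤-total 0ℚ (ℚ.- p)
... | inj₁ h = ℚ.≤-reflexive (trans (sym (ℚ.0≤p⇒∣p∣≡p h)) (ℚ.∣-p∣≡∣p∣ p))
... | inj₂ h = ℚ.≤-trans h (ℚ.0≤∣p∣ p)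

≃⇒≥ : ∀ {x y} → x ≃ y → y ≤ x
≃⇒≥ {x} {y} h ε 0<ε = let N , hN = h ε 0<ε in N , λ n N≤n → begin
  seq y n                                   ≡⟨ split (seq x n) (seq y n) ⟩
  seq x n ℚ.+ (ℚ.- (seq x n ℚ.- seq y n))   ≤⟨ ℚ.+-monoʳ-≤ (seq x n) (neg≤∣∣ (seq x n ℚ.- seq y n)) ⟩
  seq x n ℚ.+ ℚ.∣ seq x n ℚ.- seq y n ∣     ≤⟨ ℚ.+-monoʳ-≤ (seq x n) (hN n N≤n) ⟩
  seq x n ℚ.+ ε                             ∎
  where
  open ℚ.≤-Reasoning
  split : ∀ a b → b ≡ a ℚ.+ (ℚ.- (a ℚ.- b))
  split = solve 2 (λ a b → b := a :+ (:- (a :- b))) refl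
    where open ℚ-Solver

∑-mono : ∀ {A : Set} {f g : A → ℝ} → (∀ x → f x ≤ g x) → ∀ xs → ∑ (map f xs) ≤ ∑ (map g xs)
∑-mono         h []       = pointwise-≤ {0ℝ} {0ℝ} λ _ → ℚ.≤-refl
∑-mono {f = f} {g} h (x ∷ xs) =
  +-mono-≤ {f x} {g x} {∑ (map f xs)} {∑ (map g xs)} (h x) (∑-mono h xs)

∑-+ : ∀ {A : Set} (f g : A → ℝ) xs n →
      seq (∑ (map (λ x → f x + g x) xs)) n ≡ seq (∑ (map f xs)) n ℚ.+ seq (∑ (map g xs)) n
∑-+ f g []       n = refl
∑-+ f g (x ∷ xs) n = trans (cong (seq (f x) n ℚ.+ seq (g x) n ℚ.+_) (∑-+ f g xs n))
  (interchange (seq (f x) n) (seq (g x) n) (seq (∑ (map f xs)) n) (seq (∑ (map g xs)) n))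
  where
  open ℚ-Solver
  interchange : ∀ a b c d → a ℚ.+ b ℚ.+ (c ℚ.+ d) ≡ a ℚ.+ c ℚ.+ (b ℚ.+ d)
  interchange = solve 4 (λ a b c d → a :+ b :+ (c :+ d) := a :+ c :+ (b :+ d)) refl

on : Bool → ℝ → ℝ
on b a = if b then a else 0ℝ

Σℚ : {A : Set} → List A → (A → ℚ) → ℚ
Σℚ []       g = 0ℚ
Σℚ (x ∷ xs) g = g x ℚ.+ Σℚ xs g

seq-∑ : ∀ {A : Set} (w : A → ℝ) xs n → seq (∑ (map w xs)) n ≡ Σℚ xs (λ x → seq (w x) n)
seq-∑ w []       n = refl
seq-∑ w (x ∷ xs) n = cong (seq (w x) n ℚ.+_) (seq-∑ w xs n)

Σℚ-filter : ∀ {A : Set} {P : A → Set} (P? : Decidable P) (g : A → ℚ) xs →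
            Σℚ (filter P? xs) g ≡ Σℚ xs (λ x → if does (P? x) then g x else 0ℚ)
Σℚ-filter P? g []       = refl
Σℚ-filter P? g (x ∷ xs) with does (P? x)
... | true  = cong (g x ℚ.+_) (Σℚ-filter P? g xs)
... | false = trans (Σℚ-filter P? g xs) (sym (ℚ.+-identityˡ _))

Σℚ-cong : ∀ {A : Set} {g h : A → ℚ} → (∀ x → g x ≡ h x) → ∀ xs → Σℚ xs g ≡ Σℚ xs h
Σℚ-cong e []       = refl
Σℚ-cong e (x ∷ xs) = cong₂ ℚ._+_ (e x) (Σℚ-cong e xs)

seq-on : ∀ b a n → (if b then seq a n else 0ℚ) ≡ seq (on b a) n
seq-on true  a n = refl
seq-on false a n = refl

∑-filter : ∀ {A : Set} {P : A → Set} (P? : Decidable P) (w : A → ℝ) xs n →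
           seq (∑ (map w (filter P? xs))) n ≡ seq (∑ (map (λ x → on (does (P? x)) (w x)) xs)) n
∑-filter P? w xs n = trans (seq-∑ w (filter P? xs) n)
  (trans (Σℚ-filter P? (λ x → seq (w x) n) xs)
    (trans (Σℚ-cong (λ x → seq-on (does (P? x)) (w x) n) xs)
      (sym (seq-∑ (λ x → on (does (P? x)) (w x)) xs n))))

on-cover : ∀ {a : ℝ} {P Q R : Set} (P? : Dec P) (Q? : Dec Q) (R? : Dec R) →
           (P → Q ⊎ R) → (Q ⊎ R → 0ℝ ≤ a) →
           on (does P?) a ≤ on (does Q?) a + on (does R?) a
on-cover {a} (yes p) (no ¬q) (no ¬r) cover nonneg = contradiction (cover p) [ ¬q , ¬r ]′
on-cover {a} (no ¬p) (no ¬q) (no ¬r) cover nonneg = pointwise-≤ {0ℝ} {0ℝ + 0ℝ} λ _ → ℚ.≤-refl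
on-cover {a} (yes p) (yes q) (yes r) cover nonneg = ≤-trans {a} {0ℝ + a} {a + a}
  (pointwise-≤ {a} {0ℝ + a} λ n → ℚ.≤-reflexive (sym (ℚ.+-identityˡ (seq a n))))
  (+-mono-≤ {0ℝ} {a} {a} {a} (nonneg (inj₁ q)) (pointwise-≤ {a} {a} λ n → ℚ.≤-refl))
on-cover {a} (yes p) (yes q) (no ¬r) cover nonneg =
  pointwise-≤ {a} {a + 0ℝ} λ n → ℚ.≤-reflexive (sym (ℚ.+-identityʳ (seq a n)))
on-cover {a} (yes p) (no ¬q) (yes r) cover nonneg =
  pointwise-≤ {a} {0ℝ + a} λ n → ℚ.≤-reflexive (sym (ℚ.+-identityˡ (seq a n)))
on-cover {a} (no ¬p) (yes q) (yes r) cover nonneg =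
  +-mono-≤ {0ℝ} {a} {0ℝ} {a} (nonneg (inj₁ q)) (nonneg (inj₁ q))
on-cover {a} (no ¬p) (yes q) (no ¬r) cover nonneg =
  +-mono-≤ {0ℝ} {a} {0ℝ} {0ℝ} (nonneg (inj₁ q)) (pointwise-≤ {0ℝ} {0ℝ} λ n → ℚ.≤-refl)
on-cover {a} (no ¬p) (no ¬q) (yes r) cover nonneg =
  +-mono-≤ {0ℝ} {0ℝ} {0ℝ} {a} (pointwise-≤ {0ℝ} {0ℝ} λ n → ℚ.≤-refl) (nonneg (inj₂ r))

-- A union bound. Nonnegativity is asked only where `Q` or `R` holds, since `Feasible` says nothing
-- about the weights of blocks that are not sensitive.
∑-filter-cover : ∀ {A : Set} (w : A → ℝ) {P Q R : A → Set}
                 (P? : Decidable P) (Q? : Decidable Q) (R? : Decidable R) →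
                 (∀ x → P x → Q x ⊎ R x) → (∀ x → Q x ⊎ R x → 0ℝ ≤ w x) → ∀ xs →
                 ∑ (map w (filter P? xs)) ≤ ∑ (map w (filter Q? xs)) + ∑ (map w (filter R? xs))
∑-filter-cover w P? Q? R? cover nonneg xs =
  ≤-trans {∑ (map w (filter P? xs))} {∑ (map p xs)} {∑ (map w (filter Q? xs)) + ∑ (map w (filter R? xs))}
    (pointwise-≤ {∑ (map w (filter P? xs))} {∑ (map p xs)} λ n → ℚ.≤-reflexive (∑-filter P? w xs n))
    (≤-trans {∑ (map p xs)} {∑ (map (λ x → q x + r x) xs)} {∑ (map w (filter Q? xs)) + ∑ (map w (filter R? xs))}
      (∑-mono {f = p} {λ x → q x + r x} (λ x → on-cover {w x} (P? x) (Q? x) (R? x) (cover x) (nonneg x)) xs)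
      (pointwise-≤ {∑ (map (λ x → q x + r x) xs)} {∑ (map w (filter Q? xs)) + ∑ (map w (filter R? xs))} λ n →
        ℚ.≤-reflexive (trans (∑-+ q r xs n) (sym (cong₂ ℚ._+_ (∑-filter Q? w xs n) (∑-filter R? w xs n))))))
  where
  p = λ x → on (does (P? x)) (w x)
  q = λ x → on (does (Q? x)) (w x)
  r = λ x → on (does (R? x)) (w x)

Hits : ∀ {n} → BoolFun n → Input n → List (Fin n) → Set
Hits f x T = ∀ B → Sensitive f x B → Any (_∈ₛ B) T

fromℕ-suc : ∀ m n → seq (1ℝ + fromℕ m) n ≡ seq (fromℕ (suc m)) n
fromℕ-suc m n = sym (/-+ 1 m 0)

-- Weak duality: every sensitive block contains a point of `T`, so its weight is counted in one of
-- the loads at these points, each of which is at most 1.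
hits⇒objective≤ : ∀ {n} (f : BoolFun n) x w → Feasible f x w → ∀ T → Hits f x T →
                  objective f x w ≤ fromℕ (length T)
hits⇒objective≤ {n} f x w (loads , bounds) T hits = bound T (sensitive? f x) (λ _ s → s) hits
  where
  -- The predicate is generalised for the induction on `T`: blocks through the first point are paid
  -- for by its load, and the blocks hit by the remaining points form the next `P`.
  bound : ∀ T {P : Subset n → Set} (P? : Decidable P) → (∀ B → P B → Sensitive f x B) →
          (∀ B → P B → Any (_∈ₛ B) T) → ∑ (map w (filter P? (subsets n))) ≤ fromℕ (length T)
  bound []      {P} P? P⇒s hit = pointwise-≤ {∑ (map w (filter P? (subsets n)))} {0ℝ} λ m →
    ℚ.≤-reflexive (trans (seq-∑ w (filter P? (subsets n)) m) (cong (λ Bs → Σℚ Bs (λ B → seq (w B) m)) none))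
    where
    none : filter P? (subsets n) ≡ []
    none = List.filter-none P? (All.universal (λ B p → case hit B p of λ ()) (subsets n))
  bound (i ∷ T) {P} P? P⇒s hit =
    ≤-trans {∑ (map w (filter P? (subsets n)))} {load f x w i + rest} {fromℕ (suc (length T))}
      (∑-filter-cover w P? (λ B → sensitive? f x B ×-dec (i ∈? B)) R? cover nonneg (subsets n))
      (≤-trans {load f x w i + rest} {1ℝ + fromℕ (length T)} {fromℕ (suc (length T))}
        (+-mono-≤ {load f x w i} {1ℝ} {rest} {fromℕ (length T)} (loads i)
          (bound T R? (λ B r → P⇒s B (proj₁ r)) (λ B r → proj₂ r)))
        (pointwise-≤ {1ℝ + fromℕ (length T)} {fromℕ (suc (length T))} λ m → ℚ.≤-reflexive (fromℕ-suc (length T) m)))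
    where
    R? : Decidable (λ B → P B × Any (_∈ₛ B) T)
    R? B = P? B ×-dec Any.any? (_∈? B) T
    rest = ∑ (map w (filter R? (subsets n)))
    cover : ∀ B → P B → (Sensitive f x B × i ∈ₛ B) ⊎ (P B × Any (_∈ₛ B) T)
    cover B p = Sum.map (P⇒s B p ,_) (p ,_) (Any.toSum (hit B p))
    nonneg : ∀ B → (Sensitive f x B × i ∈ₛ B) ⊎ (P B × Any (_∈ₛ B) T) → 0ℝ ≤ w B
    nonneg B (inj₁ (s , _)) = proj₁ (bounds B s)
    nonneg B (inj₂ (p , _)) = proj₁ (bounds B (P⇒s B p))

-- Pigeonhole: each block is sent to the index in `T` of a point it contains, and two blocks with
-- the same index share that point.
hits⇒blocks≤ : ∀ {n} (f : BoolFun n) x T → Hits f x T →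
               ∀ t → HasDisjointSensitiveBlocks f x t → t ℕ.≤ length T
hits⇒blocks≤ f x T hits t (B , sens , disjoint) = Fin.injective⇒≤ injective
  where
  ix : Fin t → Fin (length T)
  ix i = Any.index (hits (B i) (sens i))
  injective : ∀ {i j} → ix i ≡ ix j → i ≡ j
  injective {i} {j} e with i Fin.≟ j
  ... | yes i≡j = i≡j
  ... | no i≢j  = contradiction (List.lookup T (ix i) , x∈p∩q⁺ (Any.lookup-index (hits (B i) (sens i)) ,
    subst (λ l → List.lookup T l ∈ₛ B j) (sym e) (Any.lookup-index (hits (B j) (sens j))))) (disjoint i j i≢j)

flip-⊥ : ∀ {n} (x : Input n) → flipBits x Subset.⊥ ≡ x
flip-⊥ []      = refl
flip-⊥ (b ∷ x) = cong₂ _∷_ (Bool.xor-identityʳ b) (flip-⊥ x)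

sensitive⇒nonempty : ∀ {n} (f : BoolFun n) x B → Sensitive f x B → ∃ λ i → i ∈ₛ B
sensitive⇒nonempty f x B s with nonempty? B
... | yes ne = ne
... | no ¬ne = contradiction (cong f (sym (trans (cong (flipBits x) (Empty-unique ¬ne)) (flip-⊥ x)))) s

-- A feasible solution with weight one half on each block of a family

module HalfWeights {n} (f : BoolFun n) (x : Input n) {I : Set} (is : List I) (S : I → Subset n)
  (S-sensitive : ∀ i → Sensitive f x (S i)) (S-load : ∀ p → Σ[ is ] (λ i → 𝟙 (does (p ∈? S i))) ℕ.≤ 2) where

  -- A block named by several indices counts once for each, so that sums over blocks become sums
  -- over indices with no comparison between the `S i`.
  count : Subset n → ℕ
  count B = Σ[ is ] (λ i → 𝟙 (does (S i ≟ᵥ B)))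

  halfWeight : Weighting n
  halfWeight B = fromℚ (+ count B ℚ./ 2)

  ∑-half : ∀ Bs m → seq (∑ (map halfWeight Bs)) m ≡ + Σ[ Bs ] count ℚ./ 2
  ∑-half []       m = refl
  ∑-half (B ∷ Bs) m = trans (cong (+ count B ℚ./ 2 ℚ.+_) (∑-half Bs m)) (sym (/-+ (count B) (Σ[ Bs ] count) 1))

  Σ-count : ∀ (h : Subset n → ℕ) → Σ[ subsets n ] (λ B → h B ℕ.* count B) ≡ Σ[ is ] (λ i → h (S i))
  Σ-count h = begin
    Σ[ subsets n ] (λ B → h B ℕ.* count B)
      ≡⟨ Σ-cong (subsets n) (λ B → sym (Σ-*ˡ (h B) is _)) ⟩
    Σ[ subsets n ] (λ B → Σ[ is ] (λ i → h B ℕ.* 𝟙 (does (S i ≟ᵥ B))))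
      ≡⟨ Σ-swap (subsets n) is _ ⟩
    Σ[ is ] (λ i → Σ[ subsets n ] (λ B → h B ℕ.* 𝟙 (does (S i ≟ᵥ B))))
      ≡⟨ Σ-cong is (λ i → trans (Σ-cong (subsets n) (λ B → ℕ.*-comm (h B) _)) (Σ-subsets-δ (S i) h)) ⟩
    Σ[ is ] (λ i → h (S i)) ∎
    where open ≡-Reasoning

  count-load : ∀ p → Σ[ subsets n ] (λ B → 𝟙 (does (p ∈? B)) ℕ.* count B) ℕ.≤ 2
  count-load p = subst (ℕ._≤ 2) (sym (Σ-count (λ B → 𝟙 (does (p ∈? B))))) (S-load p)

  half≤1 : ∀ {c} → c ℕ.≤ 2 → + c ℚ./ 2 ℚ.≤ 1ℚ
  half≤1 {c} h = /-mono c 1 1 0 (subst (ℕ._≤ 2) (sym (ℕ.*-identityʳ c)) h)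

  halfWeight-feasible : Feasible f x halfWeight
  halfWeight-feasible =
    (λ p → pointwise-≤ {load f x halfWeight p} {1ℝ} λ m → subst (ℚ._≤ 1ℚ) (sym (∑-half (filter (λ B → sensitive? f x B ×-dec (p ∈? B)) (subsets n)) m)) (half≤1 (load≤2 p))) ,
    λ B s → pointwise-≤ {0ℝ} {halfWeight B} (λ _ → /-mono 0 (count B) 0 1 z≤n) ,
            pointwise-≤ {halfWeight B} {1ℝ} (λ _ → half≤1 (count≤2 B s))
    where
    open ℕ.≤-Reasoning
    ∧≤ : ∀ a b → 𝟙 (a ∧ b) ℕ.≤ 𝟙 b
    ∧≤ true  b = ℕ.≤-refl
    ∧≤ false b = z≤n
    load≤2 : ∀ p → Σ[ filter (λ B → sensitive? f x B ×-dec (p ∈? B)) (subsets n) ] count ℕ.≤ 2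
    load≤2 p = begin
      Σ[ filter (λ B → sensitive? f x B ×-dec (p ∈? B)) (subsets n) ] count
        ≡⟨ Σ-filter (λ B → sensitive? f x B ×-dec (p ∈? B)) (subsets n) count ⟩
      Σ[ subsets n ] (λ B → 𝟙 (does (sensitive? f x B) ∧ does (p ∈? B)) ℕ.* count B)
        ≤⟨ Σ-mono (subsets n) (λ B → ℕ.*-monoˡ-≤ (count B) (∧≤ (does (sensitive? f x B)) (does (p ∈? B)))) ⟩
      Σ[ subsets n ] (λ B → 𝟙 (does (p ∈? B)) ℕ.* count B)
        ≤⟨ count-load p ⟩
      2 ∎
    -- The bound of 1 on a single weight comes from the load at any point of the block; there is
    -- such a point because flipping nothing changes nothing.
    count≤2 : ∀ B → Sensitive f x B → count B ℕ.≤ 2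
    count≤2 B s with sensitive⇒nonempty f x B s
    ... | p , p∈B = begin
      count B                                                     ≡⟨ ℕ.*-identityˡ (count B) ⟨
      1 ℕ.* count B                                               ≡⟨ cong (λ b → 𝟙 b ℕ.* count B) (dec-true (p ∈? B) p∈B) ⟨
      𝟙 (does (p ∈? B)) ℕ.* count B                               ≤⟨ term≤Σ (λ B → 𝟙 (does (p ∈? B)) ℕ.* count B) (∈-subsets B) ⟩
      Σ[ subsets n ] (λ B → 𝟙 (does (p ∈? B)) ℕ.* count B)        ≤⟨ count-load p ⟩
      2                                                           ∎

  halfWeight-objective : ∀ m → length is ≡ 2 ℕ.* m → objective f x halfWeight ≃ fromℕ m
  halfWeight-objective m len = pointwise-≃ {objective f x halfWeight} {fromℕ m} λ l →
    trans (∑-half (filter (sensitive? f x) (subsets n)) l) (trans (cong (λ c → + c ℚ./ 2) total) (halve m))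
    where
    open ≡-Reasoning
    halve : ∀ m → + (2 ℕ.* m) ℚ./ 2 ≡ + m ℚ./ 1
    halve m = ℚ.≤-antisym (/-mono (2 ℕ.* m) m 1 0 (ℕ.≤-reflexive (trans (ℕ.*-identityʳ _) (ℕ.*-comm 2 m))))
                          (/-mono m (2 ℕ.* m) 0 1 (ℕ.≤-reflexive (trans (ℕ.*-comm m 2) (sym (ℕ.*-identityʳ _)))))
    total : Σ[ filter (sensitive? f x) (subsets n) ] count ≡ 2 ℕ.* m
    total = begin
      Σ[ filter (sensitive? f x) (subsets n) ] count
        ≡⟨ Σ-filter (sensitive? f x) (subsets n) count ⟩
      Σ[ subsets n ] (λ B → 𝟙 (does (sensitive? f x B)) ℕ.* count B)
        ≡⟨ Σ-count (λ B → 𝟙 (does (sensitive? f x B))) ⟩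
      Σ[ is ] (λ i → 𝟙 (does (sensitive? f x (S i))))
        ≡⟨ Σ-cong is (λ i → cong 𝟙 (dec-true (sensitive? f x (S i)) (S-sensitive i))) ⟩
      Σ[ is ] (λ _ → 1)
        ≡⟨ trans (Σ-const is 1) (trans (ℕ.*-identityʳ _) len) ⟩
      2 ℕ.* m ∎

-- The limit

ι : ℕ → ℚ
ι n = + n ℚ./ 1

/-*ι : ∀ c n m → + c ℚ./ suc n ℚ.* ι m ≡ + (c ℕ.* m) ℚ./ suc n
/-*ι c n zero    = trans (ℚ.*-zeroʳ (+ c ℚ./ suc n)) (trans (sym (zero-/ n)) (cong (λ z → + z ℚ./ suc n) (sym (ℕ.*-zeroʳ c))))
  where
  zero-/ : ∀ n → + 0 ℚ./ suc n ≡ 0ℚ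
  zero-/ n = ℚ.≤-antisym (/-mono 0 0 n 0 z≤n) (/-mono 0 0 0 n z≤n)
/-*ι c n (suc m) = begin
  q ℚ.* ι (suc m)                         ≡⟨ cong (q ℚ.*_) (/-+ 1 m 0) ⟩
  q ℚ.* (1ℚ ℚ.+ ι m)                      ≡⟨ ℚ.*-distribˡ-+ q 1ℚ (ι m) ⟩
  q ℚ.* 1ℚ ℚ.+ q ℚ.* ι m                  ≡⟨ cong₂ ℚ._+_ (ℚ.*-identityʳ q) (/-*ι c n m) ⟩
  q ℚ.+ + (c ℕ.* m) ℚ./ suc n             ≡⟨ /-+ c (c ℕ.* m) n ⟨
  + (c ℕ.+ c ℕ.* m) ℚ./ suc n             ≡⟨ cong (λ z → + z ℚ./ suc n) (ℕ.*-suc c m) ⟨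
  + (c ℕ.* suc m) ℚ./ suc n               ∎
  where
  open ≡-Reasoning
  q = + c ℚ./ suc n

ι-+ : ∀ m n → ι (m ℕ.+ n) ≡ ι m ℚ.+ ι n
ι-+ m n = /-+ m n 0

ι-* : ∀ m n → ι (m ℕ.* n) ≡ ι m ℚ.* ι n
ι-* m n = sym (/-*ι m 0 n)

ι-mono : ∀ {m n} → m ℕ.≤ n → ι m ℚ.≤ ι n
ι-mono {m} {n} h = /-mono m n 0 0 (ℕ.*-monoˡ-≤ 1 h)

0≤ι : ∀ n → 0ℚ ℚ.≤ ι n
0≤ι n = ι-mono {0} {n} z≤n

/-cancel : ∀ c n → + c ℚ./ suc n ℚ.* ι (suc n) ≡ ι c
/-cancel c n = trans (/-*ι c n (suc n)) (ℚ.≤-antisym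
  (/-mono (c ℕ.* suc n) c n 0 (ℕ.≤-reflexive (ℕ.*-identityʳ _)))
  (/-mono c (c ℕ.* suc n) 0 n (ℕ.≤-reflexive (sym (ℕ.*-identityʳ _)))))

*-mono-≤ : ∀ {p q r s} → 0ℚ ℚ.≤ p → 0ℚ ℚ.≤ s → p ℚ.≤ q → r ℚ.≤ s → p ℚ.* r ℚ.≤ q ℚ.* s
*-mono-≤ {p} {q} {r} {s} 0≤p 0≤s p≤q r≤s =
  ℚ.≤-trans (ℚ.*-monoˡ-≤-nonNeg p {{ℚ.nonNegative 0≤p}} r≤s) (ℚ.*-monoʳ-≤-nonNeg s {{ℚ.nonNegative 0≤s}} p≤q)

0<* : ∀ {p q} → 0ℚ ℚ.< p → 0ℚ ℚ.< q → 0ℚ ℚ.< p ℚ.* q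
0<* {p} {q} 0<p 0<q = subst (ℚ._< p ℚ.* q) (ℚ.*-zeroʳ p) (ℚ.*-monoʳ-<-pos p {{ℚ.positive 0<p}} 0<q)

0≤* : ∀ {p q} → 0ℚ ℚ.≤ p → 0ℚ ℚ.≤ q → 0ℚ ℚ.≤ p ℚ.* q
0≤* {p} {q} 0≤p 0≤q = subst (ℚ._≤ p ℚ.* q) (ℚ.*-zeroʳ p) (ℚ.*-monoˡ-≤-nonNeg p {{ℚ.nonNegative 0≤p}} 0≤q)

∣∣-bound : ∀ {p ε} → p ℚ.≤ ε → ℚ.- p ℚ.≤ ε → ℚ.∣ p ∣ ℚ.≤ ε
∣∣-bound {p} {ε} h k with ℚ.∣p∣≡p∨∣p∣≡-p p
... | inj₁ e = subst (ℚ._≤ ε) (sym e) h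
... | inj₂ e = subst (ℚ._≤ ε) (sym e) k

0<1 : 0ℚ ℚ.< 1ℚ
0<1 = ℚ.positive⁻¹ 1ℚ

-- 1/a − v/b = (b² − a²v²) / (ab (b + av)), and b² ≤ ab (b + av).
reciprocal-gap : ∀ a b v {δ} → 1ℚ ℚ.≤ a → 1ℚ ℚ.≤ b → 0ℚ ℚ.≤ v →
                 ℚ.∣ b ℚ.* b ℚ.- a ℚ.* a ℚ.* (v ℚ.* v) ∣ ℚ.≤ δ ℚ.* (b ℚ.* b) →
                 ℚ.∣ inv a ℚ.- v ℚ.* inv b ∣ ℚ.≤ δ
reciprocal-gap a b v {δ} 1≤a 1≤b 0≤v h =
  ℚ.*-cancelʳ-≤-pos (b ℚ.* b) {{ℚ.positive (0<* 0<b 0<b)}} (begin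
    ℚ.∣ g ∣ ℚ.* (b ℚ.* b)
      ≤⟨ ℚ.*-monoˡ-≤-nonNeg ℚ.∣ g ∣ {{ℚ.nonNegative (ℚ.0≤∣p∣ g)}} b²≤D ⟩
    ℚ.∣ g ∣ ℚ.* D
      ≡⟨ cong (ℚ.∣ g ∣ ℚ.*_) (sym (ℚ.0≤p⇒∣p∣≡p (ℚ.≤-trans (0≤* 0≤b 0≤b) b²≤D))) ⟩
    ℚ.∣ g ∣ ℚ.* ℚ.∣ D ∣
      ≡⟨ ℚ.∣p*q∣≡∣p∣*∣q∣ g D ⟨
    ℚ.∣ g ℚ.* D ∣
      ≡⟨ cong ℚ.∣_∣ (expand a b v (inv a) (inv b)) ⟩
    ℚ.∣ (inv a ℚ.* a ℚ.* b ℚ.- inv b ℚ.* b ℚ.* (a ℚ.* v)) ℚ.* (b ℚ.+ a ℚ.* v) ∣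
      ≡⟨ cong₂ (λ x y → ℚ.∣ (x ℚ.* b ℚ.- y ℚ.* (a ℚ.* v)) ℚ.* (b ℚ.+ a ℚ.* v) ∣) (inv-* a 0<a) (inv-* b 0<b) ⟩
    ℚ.∣ (1ℚ ℚ.* b ℚ.- 1ℚ ℚ.* (a ℚ.* v)) ℚ.* (b ℚ.+ a ℚ.* v) ∣
      ≡⟨ cong ℚ.∣_∣ (factor a b v) ⟩
    ℚ.∣ b ℚ.* b ℚ.- a ℚ.* a ℚ.* (v ℚ.* v) ∣
      ≤⟨ h ⟩
    δ ℚ.* (b ℚ.* b) ∎)
  where
  open ℚ.≤-Reasoning
  g = inv a ℚ.- v ℚ.* inv b
  D = a ℚ.* b ℚ.* (b ℚ.+ a ℚ.* v)
  0<a = ℚ.<-≤-trans 0<1 1≤a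
  0<b = ℚ.<-≤-trans 0<1 1≤b
  0≤a = ℚ.<⇒≤ 0<a
  0≤b = ℚ.<⇒≤ 0<b
  b≤ab : b ℚ.≤ a ℚ.* b
  b≤ab = subst (ℚ._≤ a ℚ.* b) (ℚ.*-identityˡ b) (ℚ.*-monoʳ-≤-nonNeg b {{ℚ.nonNegative 0≤b}} 1≤a)
  b≤b+av : b ℚ.≤ b ℚ.+ a ℚ.* v
  b≤b+av = subst (ℚ._≤ b ℚ.+ a ℚ.* v) (ℚ.+-identityʳ b) (ℚ.+-monoʳ-≤ b (0≤* 0≤a 0≤v))
  b²≤D : b ℚ.* b ℚ.≤ D
  b²≤D = *-mono-≤ 0≤b (ℚ.≤-trans 0≤b b≤b+av) b≤ab b≤b+av
  expand : ∀ a b v r s → (r ℚ.- v ℚ.* s) ℚ.* (a ℚ.* b ℚ.* (b ℚ.+ a ℚ.* v)) ≡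
           (r ℚ.* a ℚ.* b ℚ.- s ℚ.* b ℚ.* (a ℚ.* v)) ℚ.* (b ℚ.+ a ℚ.* v)
  expand = solve 5 (λ a b v r s → (r :- v :* s) :* (a :* b :* (b :+ a :* v)) :=
    (r :* a :* b :- s :* b :* (a :* v)) :* (b :+ a :* v)) refl
    where open ℚ-Solver
  factor : ∀ a b v → (1ℚ ℚ.* b ℚ.- 1ℚ ℚ.* (a ℚ.* v)) ℚ.* (b ℚ.+ a ℚ.* v) ≡ b ℚ.* b ℚ.- a ℚ.* a ℚ.* (v ℚ.* v)
  factor = solve 3 (λ a b v → (con 1ℚ :* b :- con 1ℚ :* (a :* v)) :* (b :+ a :* v) := b :* b :- a :* a :* (v :* v)) refl
    where open ℚ-Solver

-- `A` and `B` are the squares of approximations to √6 and √C, each off by at most `η`, and `V` is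
-- the square of the value. Half of the allowance `δ ℚ.* C` pays for the exact gap, the other half
-- for three errors: `η`, `η ℚ.* V`, and `δ ℚ.* η` for passing from `C` to `B` on the right.
square-gap : ∀ A B C V δ η → 0ℚ ℚ.≤ δ → 0ℚ ℚ.≤ V →
             ℚ.∣ A ℚ.- ι 6 ∣ ℚ.≤ η → ℚ.∣ B ℚ.- C ∣ ℚ.≤ η →
             ℚ.∣ C ℚ.- ι 6 ℚ.* V ∣ ℚ.≤ ½ ℚ.* δ ℚ.* C →
             η ℚ.* (1ℚ ℚ.+ V ℚ.+ δ) ℚ.≤ ½ ℚ.* δ ℚ.* C →
             ℚ.∣ B ℚ.- A ℚ.* V ∣ ℚ.≤ δ ℚ.* B
square-gap A B C V δ η 0≤δ 0≤V hA hB hC hη = begin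
  ℚ.∣ B ℚ.- A ℚ.* V ∣
    ≡⟨ cong ℚ.∣_∣ (decompose A B C V (ι 6)) ⟩
  ℚ.∣ (B ℚ.- C) ℚ.+ ((C ℚ.- ι 6 ℚ.* V) ℚ.+ ℚ.- (A ℚ.- ι 6) ℚ.* V) ∣
    ≤⟨ ℚ.∣p+q∣≤∣p∣+∣q∣ (B ℚ.- C) _ ⟩
  ℚ.∣ B ℚ.- C ∣ ℚ.+ ℚ.∣ (C ℚ.- ι 6 ℚ.* V) ℚ.+ ℚ.- (A ℚ.- ι 6) ℚ.* V ∣
    ≤⟨ ℚ.+-mono-≤ hB (ℚ.≤-trans (ℚ.∣p+q∣≤∣p∣+∣q∣ (C ℚ.- ι 6 ℚ.* V) _) (ℚ.+-mono-≤ hC hAV)) ⟩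
  η ℚ.+ (½ ℚ.* δ ℚ.* C ℚ.+ η ℚ.* V)
    ≡⟨ collect η (½ ℚ.* δ ℚ.* C) V δ ⟩
  η ℚ.* (1ℚ ℚ.+ V ℚ.+ δ) ℚ.+ ½ ℚ.* δ ℚ.* C ℚ.- δ ℚ.* η
    ≤⟨ ℚ.+-monoˡ-≤ (ℚ.- (δ ℚ.* η)) (ℚ.+-monoˡ-≤ (½ ℚ.* δ ℚ.* C) hη) ⟩
  ½ ℚ.* δ ℚ.* C ℚ.+ ½ ℚ.* δ ℚ.* C ℚ.- δ ℚ.* η
    ≡⟨ halves δ C η ⟩
  δ ℚ.* (C ℚ.- η)
    ≤⟨ ℚ.*-monoˡ-≤-nonNeg δ {{ℚ.nonNegative 0≤δ}} C-η≤B ⟩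
  δ ℚ.* B ∎
  where
  open ℚ.≤-Reasoning
  decompose : ∀ A B C V s → B ℚ.- A ℚ.* V ≡ (B ℚ.- C) ℚ.+ ((C ℚ.- s ℚ.* V) ℚ.+ ℚ.- (A ℚ.- s) ℚ.* V)
  decompose = solve 5 (λ A B C V s → B :- A :* V := (B :- C) :+ ((C :- s :* V) :+ :- (A :- s) :* V)) refl
    where open ℚ-Solver
  collect : ∀ η c V δ → η ℚ.+ (c ℚ.+ η ℚ.* V) ≡ η ℚ.* (1ℚ ℚ.+ V ℚ.+ δ) ℚ.+ c ℚ.- δ ℚ.* η
  collect = solve 4 (λ η c V δ → η :+ (c :+ η :* V) := η :* (con 1ℚ :+ V :+ δ) :+ c :- δ :* η) refl
    where open ℚ-Solver
  halves : ∀ δ C η → ½ ℚ.* δ ℚ.* C ℚ.+ ½ ℚ.* δ ℚ.* C ℚ.- δ ℚ.* η ≡ δ ℚ.* (C ℚ.- η)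
  halves = solve 3 (λ δ C η → con ½ :* δ :* C :+ con ½ :* δ :* C :- δ :* η := δ :* (C :- η)) refl
    where open ℚ-Solver
  hAV : ℚ.∣ ℚ.- (A ℚ.- ι 6) ℚ.* V ∣ ℚ.≤ η ℚ.* V
  hAV = begin
    ℚ.∣ ℚ.- (A ℚ.- ι 6) ℚ.* V ∣            ≡⟨ ℚ.∣p*q∣≡∣p∣*∣q∣ (ℚ.- (A ℚ.- ι 6)) V ⟩
    ℚ.∣ ℚ.- (A ℚ.- ι 6) ∣ ℚ.* ℚ.∣ V ∣      ≡⟨ cong₂ ℚ._*_ (ℚ.∣-p∣≡∣p∣ (A ℚ.- ι 6)) (ℚ.0≤p⇒∣p∣≡p 0≤V) ⟩
    ℚ.∣ A ℚ.- ι 6 ∣ ℚ.* V                  ≤⟨ ℚ.*-monoʳ-≤-nonNeg V {{ℚ.nonNegative 0≤V}} hA ⟩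
    η ℚ.* V                                 ∎
  C-η≤B : C ℚ.- η ℚ.≤ B
  C-η≤B = begin
    C ℚ.- η                          ≤⟨ ℚ.+-monoʳ-≤ C (ℚ.neg-antimono-≤ (ℚ.≤-trans (neg≤∣∣ (B ℚ.- C)) hB)) ⟩
    C ℚ.- ℚ.- (B ℚ.- C)              ≡⟨ back B C ⟩
    B                                ∎
    where
    back : ∀ B C → C ℚ.- ℚ.- (B ℚ.- C) ≡ B
    back = solve 2 (λ B C → C :- :- (B :- C) := B) refl
      where open ℚ-Solver

-- The constant 21 absorbs the lower-order terms in Growth.lower.
cancel-ratio : ∀ (p q h M : ℕ) {δ} → 0ℚ ℚ.≤ δ → 1 ℕ.≤ h →
               p ℕ.* h ℕ.≤ q ℕ.* h ℕ.+ 21 ℕ.* M → ι 21 ℚ.≤ δ ℚ.* ι h → ι p ℚ.- ι q ℚ.≤ δ ℚ.* ι M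
cancel-ratio p q h M {δ} 0≤δ 1≤h le 21≤ =
  ℚ.*-cancelʳ-≤-pos (ι h) {{ℚ.positive (ℚ.<-≤-trans 0<1 (ι-mono 1≤h))}} (begin
    (ι p ℚ.- ι q) ℚ.* ι h
      ≡⟨ distrib (ι p) (ι q) (ι h) ⟩
    ι p ℚ.* ι h ℚ.- ι q ℚ.* ι h
      ≡⟨ cong₂ ℚ._-_ (sym (ι-* p h)) (sym (ι-* q h)) ⟩
    ι (p ℕ.* h) ℚ.- ι (q ℕ.* h)
      ≤⟨ ℚ.+-monoˡ-≤ (ℚ.- ι (q ℕ.* h)) (ι-mono le) ⟩
    ι (q ℕ.* h ℕ.+ 21 ℕ.* M) ℚ.- ι (q ℕ.* h)
      ≡⟨ cong (ℚ._- ι (q ℕ.* h)) (trans (ι-+ (q ℕ.* h) (21 ℕ.* M)) (cong (ι (q ℕ.* h) ℚ.+_) (ι-* 21 M))) ⟩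
    ι (q ℕ.* h) ℚ.+ ι 21 ℚ.* ι M ℚ.- ι (q ℕ.* h)
      ≡⟨ drop (ι (q ℕ.* h)) (ι 21 ℚ.* ι M) ⟩
    ι 21 ℚ.* ι M
      ≤⟨ ℚ.*-monoʳ-≤-nonNeg (ι M) {{ℚ.nonNegative (0≤ι M)}} 21≤ ⟩
    δ ℚ.* ι h ℚ.* ι M
      ≡⟨ swap δ (ι h) (ι M) ⟩
    δ ℚ.* ι M ℚ.* ι h ∎)
  where
  open ℚ.≤-Reasoning
  open ℚ-Solver
  distrib : ∀ a b c → (a ℚ.- b) ℚ.* c ≡ a ℚ.* c ℚ.- b ℚ.* c
  distrib = solve 3 (λ a b c → (a :- b) :* c := a :* c :- b :* c) refl
  drop : ∀ a b → a ℚ.+ b ℚ.- a ≡ b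
  drop = solve 2 (λ a b → a :+ b :- a := b) refl
  swap : ∀ a b c → a ℚ.* b ℚ.* c ≡ a ℚ.* c ℚ.* b
  swap = solve 3 (λ a b c → a :* b :* c := a :* c :* b) refl

1≤√ : ∀ n .{{_ : ℕ.NonZero n}} k → 1ℚ ℚ.≤ √-seq n k
1≤√ n k = subst (ℚ._≤ √-seq n k) (ℚ.+-identityˡ 1ℚ) (proj₂ (proj₂ (proj₂ (0<√ n))) k z≤n)

ratio : (v M : ℕ) .{{_ : ℕ.NonZero M}} → ℝ
ratio v M = fromℕ v * 1/√ M

-- With the error taken to be `x - ratio v M`, the equation of the theorem becomes an identity that
-- holds at every index of the sequences.
ratio-* : ∀ v M .{{_ : ℕ.NonZero M}} x → fromℕ v ≃ (x - (x - ratio v M)) * √ M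
ratio-* v M x = pointwise-≃ {fromℕ v} {(x - (x - ratio v M)) * √ M} λ n → sym (begin
  (seq x n ℚ.+ ℚ.- (seq x n ℚ.+ ℚ.- (ι v ℚ.* inv (√-seq M n)))) ℚ.* √-seq M n
    ≡⟨ cancel (seq x n) (ι v) (inv (√-seq M n)) (√-seq M n) ⟩
  ι v ℚ.* (inv (√-seq M n) ℚ.* √-seq M n)
    ≡⟨ cong (ι v ℚ.*_) (inv-* (√-seq M n) (ℚ.<-≤-trans 0<1 (1≤√ M n))) ⟩
  ι v ℚ.* 1ℚ
    ≡⟨ ℚ.*-identityʳ (ι v) ⟩
  ι v ∎)
  where
  open ≡-Reasoning
  cancel : ∀ x v s q → (x ℚ.+ ℚ.- (x ℚ.+ ℚ.- (v ℚ.* s))) ℚ.* q ≡ v ℚ.* (s ℚ.* q)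
  cancel = solve 4 (λ x v s q → (x :+ :- (x :+ :- (v :* s))) :* q := v :* (s :* q)) refl
    where open ℚ-Solver

ratio-near : ∀ v M .{{_ : ℕ.NonZero M}} δ → 0ℚ ℚ.< δ →
             ℚ.∣ ι M ℚ.- ι 6 ℚ.* (ι v ℚ.* ι v) ∣ ℚ.≤ ½ ℚ.* δ ℚ.* ι M →
             ∃ λ N → ∀ n → N ℕ.≤ n → ℚ.∣ inv (√-seq 6 n) ℚ.- ι v ℚ.* inv (√-seq M n) ∣ ℚ.≤ δ
ratio-near v M δ 0<δ close =
  let N₁ , h₁ = √-square 6 η 0<η
      N₂ , h₂ = √-square M η 0<η
  in N₁ ℕ.⊔ N₂ , λ n N≤n → reciprocal-gap (√-seq 6 n) (√-seq M n) (ι v) (1≤√ 6 n) (1≤√ M n) (0≤ι v)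
       (square-gap (√-seq 6 n ℚ.* √-seq 6 n) (√-seq M n ℚ.* √-seq M n) (ι M) (ι v ℚ.* ι v) δ η (ℚ.<⇒≤ 0<δ) (0≤* (0≤ι v) (0≤ι v))
         (h₁ n (ℕ.m⊔n≤o⇒m≤o N₁ N₂ N≤n)) (h₂ n (ℕ.m⊔n≤o⇒n≤o N₁ N₂ N≤n)) close small)
  where
  open ℚ.≤-Reasoning
  d = 1ℚ ℚ.+ ι v ℚ.* ι v ℚ.+ δ
  0<d : 0ℚ ℚ.< d
  0<d = ℚ.+-mono-≤-< (ℚ.+-mono-≤ (ℚ.<⇒≤ 0<1) (0≤* (0≤ι v) (0≤ι v))) 0<δ
  -- Chosen so that `η ℚ.* d` is `½ ℚ.* δ`, which is within the allowance because `M` is at least 1.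
  η = ½ ℚ.* δ ℚ.* inv d
  0<η : 0ℚ ℚ.< η
  0<η = 0<* (half-pos 0<δ) (inv-pos d 0<d)
  small : η ℚ.* d ℚ.≤ ½ ℚ.* δ ℚ.* ι M
  small = begin
    ½ ℚ.* δ ℚ.* inv d ℚ.* d       ≡⟨ ℚ.*-assoc (½ ℚ.* δ) (inv d) d ⟩
    ½ ℚ.* δ ℚ.* (inv d ℚ.* d)     ≡⟨ cong (½ ℚ.* δ ℚ.*_) (inv-* d 0<d) ⟩
    ½ ℚ.* δ ℚ.* 1ℚ                ≤⟨ ℚ.*-monoˡ-≤-nonNeg (½ ℚ.* δ) {{ℚ.nonNegative (ℚ.<⇒≤ (half-pos 0<δ))}} (ι-mono (ℕ.>-nonZero⁻¹ M)) ⟩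
    ½ ℚ.* δ ℚ.* ι M               ∎

ratio-limit : ∀ (v M h : ℕ → ℕ) (M≢0 : ∀ k → ℕ.NonZero (M k)) → (∀ k → k ℕ.≤ h k) →
              (∀ k → M k ℕ.* h k ℕ.≤ 6 ℕ.* (v k ℕ.* v k) ℕ.* h k ℕ.+ 21 ℕ.* M k) →
              (∀ k → 6 ℕ.* (v k ℕ.* v k) ℕ.* h k ℕ.≤ M k ℕ.* h k ℕ.+ 21 ℕ.* M k) →
              (λ k → 1/√ 6 - ratio (v k) (M k) {{M≢0 k}}) ⟶ 0ℝ
ratio-limit v M h M≢0 k≤h lower upper e (δ₀ , 0<δ₀ , N₀ , h₀) =
  suc K , λ k K<k →
  let N , near = ratio-near (v k) (M k) {{M≢0 k}} δ 0<δ (close k K<k)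
  in δ , 0<δ , N₀ ℕ.⊔ N , λ n N≤n → final k n (near n (ℕ.m⊔n≤o⇒n≤o N₀ N N≤n)) (h₀ n (ℕ.m⊔n≤o⇒m≤o N₀ N N≤n))
  where
  open ℚ.≤-Reasoning
  -- Strict order on the reals asks for a positive gap: one half of `δ₀` bounds the distance, the
  -- other half is the gap.
  δ = ½ ℚ.* δ₀
  0<δ = half-pos 0<δ₀
  K = proj₁ (archimedean 21 (½ ℚ.* δ) (half-pos 0<δ))
  final : ∀ k n → ℚ.∣ inv (√-seq 6 n) ℚ.- ι (v k) ℚ.* inv (√-seq (M k) n) ∣ ℚ.≤ δ →
          0ℚ ℚ.+ δ₀ ℚ.≤ seq e n →
          ℚ.∣ inv (√-seq 6 n) ℚ.+ ℚ.- (ι (v k) ℚ.* inv (√-seq (M k) n)) ℚ.+ ℚ.- 0ℚ ∣ ℚ.+ δ ℚ.≤ seq e n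
  final k n near h = begin
    ℚ.∣ inv (√-seq 6 n) ℚ.+ ℚ.- (ι (v k) ℚ.* inv (√-seq (M k) n)) ℚ.+ ℚ.- 0ℚ ∣ ℚ.+ δ
      ≡⟨ cong (λ r → ℚ.∣ r ∣ ℚ.+ δ) (ℚ.+-identityʳ (inv (√-seq 6 n) ℚ.+ ℚ.- (ι (v k) ℚ.* inv (√-seq (M k) n)))) ⟩
    ℚ.∣ inv (√-seq 6 n) ℚ.+ ℚ.- (ι (v k) ℚ.* inv (√-seq (M k) n)) ∣ ℚ.+ δ
      ≤⟨ ℚ.+-monoˡ-≤ δ near ⟩
    δ ℚ.+ δ
      ≡⟨ ½+½≡ δ₀ ⟩
    δ₀
      ≡⟨ ℚ.+-identityˡ δ₀ ⟨
    0ℚ ℚ.+ δ₀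
      ≤⟨ h ⟩
    seq e n ∎
  -- `archimedean` speaks of the denominators `suc n`, so the threshold for `n` itself is `suc K`.
  large : ∀ n → suc K ℕ.≤ n → ι 21 ℚ.≤ ½ ℚ.* δ ℚ.* ι n
  large (suc n) (s≤s K≤n) = subst (ℚ._≤ ½ ℚ.* δ ℚ.* ι (suc n)) (/-cancel 21 n)
    (ℚ.*-monoʳ-≤-nonNeg (ι (suc n)) {{ℚ.nonNegative (0≤ι (suc n))}}
      (proj₂ (archimedean 21 (½ ℚ.* δ) (half-pos 0<δ)) n K≤n))
  ι-6v² : ∀ v → ι (6 ℕ.* (v ℕ.* v)) ≡ ι 6 ℚ.* (ι v ℚ.* ι v)
  ι-6v² v = trans (ι-* 6 (v ℕ.* v)) (cong (ι 6 ℚ.*_) (ι-* v v))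
  flip : ∀ a b → ℚ.- (a ℚ.- b) ≡ b ℚ.- a
  flip = solve 2 (λ a b → :- (a :- b) := b :- a) refl
    where open ℚ-Solver
  close : ∀ k → suc K ℕ.≤ k → ℚ.∣ ι (M k) ℚ.- ι 6 ℚ.* (ι (v k) ℚ.* ι (v k)) ∣ ℚ.≤ ½ ℚ.* δ ℚ.* ι (M k)
  close k K<k = subst (λ s → ℚ.∣ ι (M k) ℚ.- s ∣ ℚ.≤ ½ ℚ.* δ ℚ.* ι (M k)) (ι-6v² (v k))
    (∣∣-bound
      (cancel-ratio (M k) (6 ℕ.* (v k ℕ.* v k)) (h k) (M k) 0≤½δ 1≤h (lower k) 21≤)
      (subst (ℚ._≤ ½ ℚ.* δ ℚ.* ι (M k)) (sym (flip (ι (M k)) (ι (6 ℕ.* (v k ℕ.* v k)))))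
        (cancel-ratio (6 ℕ.* (v k ℕ.* v k)) (M k) (h k) (M k) 0≤½δ 1≤h (upper k) 21≤)))
    where
    K<h  = ℕ.≤-trans K<k (k≤h k)
    1≤h  = ℕ.≤-trans (s≤s z≤n) K<h
    21≤  = large (h k) K<h
    0≤½δ = ℚ.<⇒≤ (half-pos 0<δ)

-- Disjunctive normal forms and copies

lookup-flip : ∀ {n} (x : Input n) B p → lookup (flipBits x B) p ≡ lookup x p xor lookup B p
lookup-flip x B p = lookup-zipWith _xor_ p x B

∉⇒lookup : ∀ {n} {B : Subset n} {p} → p ∉ₛ B → lookup B p ≡ false
∉⇒lookup {B = B} {p} p∉B = Bool.¬-not (λ h → p∉B (lookup⇒[]= p B h))

does-∈? : ∀ {n} (p : Fin n) B → does (p ∈? B) ≡ lookup B p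
does-∈? p B with lookup B p in eq
... | true  = dec-true (p ∈? B) (lookup⇒[]= p B eq)
... | false = dec-false (p ∈? B) (λ p∈B → case trans (sym eq) ([]=⇒lookup p∈B) of λ ())

-- `one i` and `zro i` mark the positive and the negative literals of term `i`; a position marked by
-- neither is free.
module DNF {I : Set} {N : ℕ} (terms : List I) (∈-terms : ∀ i → i ∈ terms) (one zro : I → Fin N → Bool) where

  breaks : I → Input N → Fin N → Bool
  breaks i x p = if lookup x p then zro i p else one i p

  Sat : Input N → I → Set
  Sat x i = ∀ p → breaks i x p ≡ false

  sat? : ∀ x i → Dec (Sat x i)
  sat? x i = Fin.all? (λ p → breaks i x p Bool.≟ false)

  dnf : BoolFun N
  dnf x = does (Any.any? (sat? x) terms)

  Sat⇒true : ∀ x i → Sat x i → dnf x ≡ true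
  Sat⇒true x i s = dec-true (Any.any? (sat? x) terms) (lose (∈-terms i) s)

  true⇒Sat : ∀ x → dnf x ≡ true → ∃ (Sat x)
  true⇒Sat x h with yes any ← Any.any? (sat? x) terms = let i , _ , s = find any in i , s

  ¬Sat⇒breaks : ∀ x i → ¬ Sat x i → ∃ λ p → breaks i x p ≡ true
  ¬Sat⇒breaks x i ¬s =
    let p , h = Fin.¬∀⟶∃¬ N (λ p → breaks i x p ≡ false) (λ p → breaks i x p Bool.≟ false) ¬s
    in p , Bool.¬-not h

  false⇒breaks : ∀ x → dnf x ≡ false → ∀ i → ∃ λ p → breaks i x p ≡ true
  false⇒breaks x h i = ¬Sat⇒breaks x i (λ s → case trans (sym h) (Sat⇒true x i s) of λ ())

  breaks⇒false : ∀ x → (∀ i → ∃ λ p → breaks i x p ≡ true) → dnf x ≡ false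
  breaks⇒false x h = Bool.¬-not λ e →
    let i , s = true⇒Sat x e
        p , b = h i
    in case trans (sym b) (s p) of λ ()

  breaks-outside : ∀ i x B {p} → p ∉ₛ B → breaks i (flipBits x B) p ≡ breaks i x p
  breaks-outside i x B {p} p∉B = cong (λ b → if b then zro i p else one i p)
    (trans (lookup-flip x B p) (trans (cong (lookup x p xor_) (∉⇒lookup p∉B)) (Bool.xor-identityʳ _)))

  -- The flipped input satisfies some term `i`. Outside `B` it violates `i` wherever `x` does, so
  -- every violation of `i` at `x` lies in `B`.
  sensitive-0 : ∀ x B → dnf x ≡ false → Sensitive dnf x B → ∃ λ i → ∀ p → breaks i x p ≡ true → p ∈ₛ B
  sensitive-0 x B h sens =
    let i , s = true⇒Sat (flipBits x B) (Bool.¬-not (λ e → sens (trans h (sym e))))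
    in i , λ p b → case p ∈? B of λ where
      (yes p∈B) → p∈B
      (no p∉B)  → case trans (sym b) (trans (sym (breaks-outside i x B p∉B)) (s p)) of λ ()

  -- A block that avoids all literals of a satisfied term leaves it satisfied; hence these literals
  -- hit every sensitive block.
  sensitive-1 : ∀ x B i → Sat x i → Sensitive dnf x B → ∃ λ p → p ∈ₛ B × one i p ∨ zro i p ≡ true
  sensitive-1 x B i s sens =
    let p , b = ¬Sat⇒breaks (flipBits x B) i (λ s′ → sens (trans (Sat⇒true x i s) (sym (Sat⇒true (flipBits x B) i s′))))
    in p , (case p ∈? B of λ where
         (yes p∈B) → p∈B
         (no p∉B)  → case trans (sym b) (trans (breaks-outside i x B p∉B) (s p)) of λ ()) ,
       mentioned (lookup (flipBits x B) p) (one i p) (zro i p) b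
    where
    mentioned : ∀ b o z → (if b then z else o) ≡ true → o ∨ z ≡ true
    mentioned true  o z refl = Bool.∨-zeroʳ o
    mentioned false o z refl = refl

unique-lookup : ∀ {A : Set} {xs : List A} → Unique xs → ∀ i j → List.lookup xs i ≡ List.lookup xs j → i ≡ j
unique-lookup (x∉ ∷ u) Fin.zero    Fin.zero    e = refl
unique-lookup (x∉ ∷ u) Fin.zero    (Fin.suc j) e = contradiction e (All.lookup x∉ (∈-lookup j))
unique-lookup (x∉ ∷ u) (Fin.suc i) Fin.zero    e = contradiction (sym e) (All.lookup x∉ (∈-lookup i))
unique-lookup (x∉ ∷ u) (Fin.suc i) (Fin.suc j) e = cong Fin.suc (unique-lookup u i j e)

length-allFin : ∀ n → length (List.allFin n) ≡ n
length-allFin n = List.length-tabulate id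

-- The domain is counted fibre by fibre. A fibre with more than `c` elements would list `suc c`
-- distinct ones with a common value.
small-fibres : ∀ {t n c} (h : Fin t → Fin n) →
               (∀ (q : Fin (suc c) → Fin t) i → (∀ a b → a ≢ b → q a ≢ q b) → ¬ (∀ a → h (q a) ≡ i)) →
               t ℕ.≤ n ℕ.* c
small-fibres {t} {n} {c} h small = begin
  t                                                 ≡⟨ trans (sym (ℕ.*-identityʳ t)) (cong (ℕ._* 1) (sym (length-allFin t))) ⟩
  length (List.allFin t) ℕ.* 1                      ≡⟨ Σ-const (List.allFin t) 1 ⟨
  Σ[ List.allFin t ] (λ _ → 1)                      ≡⟨ Σ-cong (List.allFin t) (λ a → sym (Σ-allFin-δ (h a) (λ _ → 1))) ⟩
  Σ[ List.allFin t ] (λ a → Σ[ List.allFin n ] (λ i → 𝟙 (does (h a Fin.≟ i)) ℕ.* 1))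
                                                    ≡⟨ Σ-swap (List.allFin t) (List.allFin n) _ ⟩
  Σ[ List.allFin n ] (λ i → Σ[ List.allFin t ] (λ a → 𝟙 (does (h a Fin.≟ i)) ℕ.* 1))
                                                    ≤⟨ Σ-mono (List.allFin n) fibre≤c ⟩
  Σ[ List.allFin n ] (λ _ → c)                      ≡⟨ trans (Σ-const (List.allFin n) c) (cong (ℕ._* c) (length-allFin n)) ⟩
  n ℕ.* c                                           ∎
  where
  open ℕ.≤-Reasoning
  fibre : Fin n → List (Fin t)
  fibre i = filter (λ a → h a Fin.≟ i) (List.allFin t)
  fibre-unique : ∀ i → Unique (fibre i)
  fibre-unique i = Unique.filter⁺ (λ a → h a Fin.≟ i) (Unique.allFin⁺ t)
  length≤c : ∀ i → length (fibre i) ℕ.≤ c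
  length≤c i with length (fibre i) ℕ.≤? c
  ... | yes l = l
  ... | no ¬l = contradiction
    (λ a → proj₂ (∈-filter⁻ (λ a → h a Fin.≟ i) {xs = List.allFin t} (∈-lookup (Fin.inject≤ a (ℕ.≰⇒> ¬l)))))
    (small (λ a → List.lookup (fibre i) (Fin.inject≤ a (ℕ.≰⇒> ¬l))) i
      (λ a b a≢b e → a≢b (Fin.inject≤-injective _ _ a b (unique-lookup (fibre-unique i) _ _ e))))
  fibre≤c : ∀ i → Σ[ List.allFin t ] (λ a → 𝟙 (does (h a Fin.≟ i)) ℕ.* 1) ℕ.≤ c
  fibre≤c i = ℕ.≤-trans (ℕ.≤-reflexive (trans (Σ-cong (List.allFin t) (λ a → ℕ.*-identityʳ _))
    (sym (length-filter (λ a → h a Fin.≟ i) (List.allFin t))))) (length≤c i)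

length-concatMap : ∀ {A B : Set} (g : A → List B) xs → length (concatMap g xs) ≡ Σ[ xs ] (λ x → length (g x))
length-concatMap g []       = refl
length-concatMap g (x ∷ xs) = trans (List.length-++ (g x)) (cong (length (g x) ℕ.+_) (length-concatMap g xs))

-- Numbering the edges, and disjoint copies of the graph

Vec↔ : ∀ k → Fin (2 ^ k) ↔ Vec Bool k
Vec↔ zero    = mk↔ₛ′ (λ _ → []) (λ _ → Fin.zero) (λ { [] → refl }) (λ { Fin.zero → refl ; (Fin.suc ()) })
Vec↔ (suc k) = ↔-trans Fin.*↔× (↔-trans (Fin.2↔Bool Product.×-↔ Vec↔ k)
  (mk↔ₛ′ (λ (b , v) → b ∷ v) (λ v → Vec.head v , Vec.tail v) (λ { (b ∷ v) → refl }) (λ _ → refl)))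

-- The binomial coefficient of 2^k over 2, in the recursive form that matches the constructors of
-- `Edge`.
edges# : ℕ → ℕ
edges# zero    = 0
edges# (suc k) = 2 ℕ.* edges# k ℕ.+ 2 ^ k ℕ.* 2 ^ k

Edge↔ : ∀ k → Fin (edges# k) ↔ Edge k
Edge↔ zero    = mk↔ₛ′ (λ ()) (λ ()) (λ ()) (λ ())
Edge↔ (suc k) = ↔-trans Fin.+↔⊎ (↔-trans
    (↔-trans Fin.*↔× (Fin.2↔Bool Product.×-↔ Edge↔ k) Sum.⊎-↔ ↔-trans Fin.*↔× (Vec↔ k Product.×-↔ Vec↔ k))
    Edge-suc)
  where
  Edge-suc : ((Bool × Edge k) ⊎ (Vec Bool k × Vec Bool k)) ↔ Edge (suc k)
  Edge-suc = mk↔ₛ′ (λ { (inj₁ (b , e)) → inner b e ; (inj₂ (u , v)) → cross u v })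
                   (λ { (inner b e) → inj₁ (b , e) ; (cross u v) → inj₂ (u , v) })
                   (λ { (inner b e) → refl ; (cross u v) → refl })
                   (λ { (inj₁ _) → refl ; (inj₂ _) → refl })

module Copies (n j : ℕ) where

  -- At least two bits, hence the four vertices that `private-edge` relies on.
  K : ℕ
  K = 2 ℕ.+ j

  h : ℕ
  h = 2 ^ suc j

  N : ℕ
  N = n ℕ.* edges# K

  Term : Set
  Term = Fin n × Vec Bool K

  position↔ : Fin N ↔ (Fin n × Edge K)
  position↔ = ↔-trans Fin.*↔× (↔-refl Product.×-↔ Edge↔ K)

  -- Opaque, so that nothing depends on how positions are numbered beyond the two inverse laws.
  abstract
    place : Fin N → Fin n × Edge K
    place = Inverse.to position↔

    pos : Fin n → Edge K → Fin N
    pos i e = Inverse.from position↔ (i , e)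

    place-pos : ∀ i e → place (pos i e) ≡ (i , e)
    place-pos i e = Inverse.strictlyInverseˡ position↔ (i , e)

    pos-place : ∀ p → pos (proj₁ (place p)) (proj₂ (place p)) ≡ p
    pos-place p = Inverse.strictlyInverseʳ position↔ p

  pos-injective : ∀ {i e i′ e′} → pos i e ≡ pos i′ e′ → i ≡ i′ × e ≡ e′
  pos-injective {i} {e} {i′} {e′} eq with trans (sym (place-pos i e)) (trans (cong place eq) (place-pos i′ e′))
  ... | refl = refl , refl

  terms : List Term
  terms = cartesianProduct (List.allFin n) (subsets K)

  ∈-terms : ∀ t → t ∈ terms
  ∈-terms (i , t) = ∈-cartesianProduct⁺ (∈-allFin i) (∈-subsets t)

  length-terms : length terms ≡ 2 ℕ.* (n ℕ.* h)
  length-terms = begin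
    length terms                                  ≡⟨ ℕ.*-identityʳ (length terms) ⟨
    length terms ℕ.* 1                            ≡⟨ Σ-const terms 1 ⟨
    Σ[ terms ] (λ _ → 1)                          ≡⟨ Σ-product _,_ (List.allFin n) (subsets K) (λ _ → 1) ⟩
    Σ[ List.allFin n ] (λ _ → Σ[ subsets K ] (λ _ → 1))
                                                  ≡⟨ Σ-const (List.allFin n) _ ⟩
    length (List.allFin n) ℕ.* Σ[ subsets K ] (λ _ → 1)
                                                  ≡⟨ cong (length (List.allFin n) ℕ.*_) (trans (Σ-const (subsets K) 1) (ℕ.*-identityʳ _)) ⟩
    length (List.allFin n) ℕ.* length (subsets K) ≡⟨ cong₂ ℕ._*_ (length-allFin n) (length-subsets K) ⟩
    n ℕ.* (2 ℕ.* h)                               ≡⟨ trans (sym (ℕ.*-assoc n 2 h)) (trans (cong (ℕ._* h) (ℕ.*-comm n 2)) (ℕ.*-assoc 2 n h)) ⟩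
    2 ℕ.* (n ℕ.* h)                               ∎
    where open ≡-Reasoning

  one zro : Term → Fin N → Bool
  one (i , t) p = does (i Fin.≟ proj₁ (place p)) ∧ inc t (proj₂ (place p))
  zro (i , t) p = does (i Fin.≟ proj₁ (place p)) ∧ zer t (proj₂ (place p))

  open DNF terms ∈-terms one zro public

  private
    same : (i : Fin n) → does (i Fin.≟ i) ≡ true
    same i = dec-true (i Fin.≟ i) refl

  one-pos : ∀ i t i′ e → one (i , t) (pos i′ e) ≡ does (i Fin.≟ i′) ∧ inc t e
  one-pos i t i′ e = cong (λ (i′ , e) → does (i Fin.≟ i′) ∧ inc t e) (place-pos i′ e)

  zro-pos : ∀ i t i′ e → zro (i , t) (pos i′ e) ≡ does (i Fin.≟ i′) ∧ zer t e
  zro-pos i t i′ e = cong (λ (i′ , e) → does (i Fin.≟ i′) ∧ zer t e) (place-pos i′ e)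

  one-pos-same : ∀ i t e → one (i , t) (pos i e) ≡ inc t e
  one-pos-same i t e = trans (one-pos i t i e) (cong (_∧ inc t e) (same i))

  zro-pos-same : ∀ i t e → zro (i , t) (pos i e) ≡ zer t e
  zro-pos-same i t e = trans (zro-pos i t i e) (cong (_∧ zer t e) (same i))

  copy : Input N → Fin n → Edge K → Bool
  copy x i e = lookup x (pos i e)

  breaks-pos : ∀ i t x e → breaks (i , t) x (pos i e) ≡ broken t (copy x i) e
  breaks-pos i t x e = cong₂ (λ z o → if lookup x (pos i e) then z else o) (zro-pos-same i t e) (one-pos-same i t e)

  in-copy : ∀ i p b → does (i Fin.≟ proj₁ (place p)) ∧ b ≡ true → ∃ λ e → p ≡ pos i e
  in-copy i p b eq with i Fin.≟ proj₁ (place p)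
  ... | yes refl = proj₂ (place p) , sym (pos-place p)

  breaks⇒broken : ∀ i t x p → breaks (i , t) x p ≡ true → ∃ λ e → p ≡ pos i e × broken t (copy x i) e ≡ true
  breaks⇒broken i t x p b with either (lookup x p) b
    where
    either : ∀ c → (if c then zro (i , t) p else one (i , t) p) ≡ true → ∃ λ e → p ≡ pos i e
    either true  = in-copy i p _
    either false = in-copy i p _
  ... | e , refl = e , refl , trans (sym (breaks-pos i t x e)) b

  broken⇒breaks : ∀ i t x e → broken t (copy x i) e ≡ true → breaks (i , t) x (pos i e) ≡ true
  broken⇒breaks i t x e b = trans (breaks-pos i t x e) b

  one⇒¬zro : ∀ s p → one s p ≡ true → zro s p ≡ false
  one⇒¬zro (i , t) p h with does (i Fin.≟ proj₁ (place p))
  ... | true = inc⇒¬zer t (proj₂ (place p)) h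

  -- At a 0-input every copy is violated throughout, so each supplies its own set of at most `h`
  -- edges. A sensitive block repairs some term and therefore meets the set of that term's copy.
  hits-0 : 3 ℕ.≤ h → ∀ x → dnf x ≡ false → ∃ λ T → length T ℕ.≤ n ℕ.* h × Hits dnf x T
  hits-0 3≤h x fx =
    concatMap local (List.allFin n) ,
    ℕ.≤-trans (ℕ.≤-reflexive (length-concatMap local (List.allFin n)))
      (ℕ.≤-trans (Σ-mono (List.allFin n) local≤h)
        (ℕ.≤-reflexive (trans (Σ-const (List.allFin n) h) (cong (ℕ._* h) (length-allFin n))))) ,
    hit
    where
    violated : ∀ i t → ∃ λ e → broken t (copy x i) e ≡ true
    violated i t =
      let p , b = false⇒breaks x fx (i , t)
          e , _ , b′ = breaks⇒broken i t x p b
      in e , b′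
    set : ∀ i → ∃ λ T → length T ℕ.≤ h × (∀ t → ∃ λ e → e ∈ T × broken t (copy x i) e ≡ true)
    set i = hitting-set (copy x i) 3≤h (violated i)
    local : Fin n → List (Fin N)
    local i = map (pos i) (proj₁ (set i))
    local≤h : ∀ i → length (local i) ℕ.≤ h
    local≤h i = ℕ.≤-trans (ℕ.≤-reflexive (List.length-map (pos i) (proj₁ (set i)))) (proj₁ (proj₂ (set i)))
    hit : Hits dnf x (concatMap local (List.allFin n))
    hit B s =
      let (i , t) , ⊆B = sensitive-0 x B fx s
          e , e∈ , b = proj₂ (proj₂ (set i)) t
      in lose (∈-concatMap⁺ local (lose (∈-allFin i) (∈-map⁺ (pos i) e∈)))
              (⊆B (pos i e) (broken⇒breaks i t x e b))

  hits-1 : ∀ x → dnf x ≡ true → ∃ λ T → (∃ λ t → length T ≡ domainSize {K} t) × Hits dnf x T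
  hits-1 x fx =
    let (i , t) , s = true⇒Sat x fx in
    map (pos i) (domain t) ,
    (t , trans (List.length-map (pos i) (domain t)) (length-domain t)) ,
    λ B sens → let p , p∈B , m = sensitive-1 x B (i , t) s sens in lose (mentioned i t p m) p∈B
    where
    mentioned : ∀ i t p → one (i , t) p ∨ zro (i , t) p ≡ true → p ∈ map (pos i) (domain t)
    mentioned i t p m with in-copy i p (inDomain t (proj₂ (place p))) (trans (Bool.∧-distribˡ-∨ (does (i Fin.≟ proj₁ (place p))) _ _) m)
    ... | e , refl = ∈-map⁺ (pos i) (∈-domain t e (trans (sym (cong₂ _∨_ (one-pos-same i t e) (zro-pos-same i t e))) m))

  -- Each block repairs one term and is assigned to its copy. Four blocks in one copy would repair
  -- the terms of four vertices, and by `four-meet` two of them would share an edge.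
  blocks-0 : ∀ x → dnf x ≡ false → ∀ b → HasDisjointSensitiveBlocks dnf x b → b ℕ.≤ n ℕ.* 3
  blocks-0 x fx b (B , sens , disjoint) = small-fibres (λ a → proj₁ (term a)) crowded
    where
    term : Fin b → Term
    term a = proj₁ (sensitive-0 x (B a) fx (sens a))
    ⊆B : ∀ a p → breaks (term a) x p ≡ true → p ∈ₛ B a
    ⊆B a = proj₂ (sensitive-0 x (B a) fx (sens a))
    vertex : Fin b → Vec Bool K
    vertex a = proj₂ (term a)
    module _ (q : Fin 4 → Fin b) (i : Fin n) (q-inj : ∀ a c → a ≢ c → q a ≢ q c) (at-i : ∀ a → proj₁ (term (q a)) ≡ i) where
      covers : ∀ a e → broken (vertex (q a)) (copy x i) e ≡ true → pos i e ∈ₛ B (q a)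
      covers a e br = ⊆B (q a) (pos i e)
        (subst (λ i′ → breaks (i′ , vertex (q a)) x (pos i e) ≡ true) (sym (at-i a)) (broken⇒breaks i (vertex (q a)) x e br))
      apart : ∀ a c → a ≢ c → ¬ Meet (copy x i) (vertex (q a)) (vertex (q c))
      apart a c a≢c (e , br , br′) = disjoint (q a) (q c) (q-inj a c a≢c)
        (pos i e , x∈p∩q⁺ (covers a e br , covers c e br′))
      -- Two disjoint blocks cannot repair the same term, since it is violated somewhere and both
      -- would contain that position.
      vertex-injective : ∀ a c → a ≢ c → vertex (q a) ≢ vertex (q c)
      vertex-injective a c a≢c eq =
        let p , br = false⇒breaks x fx (i , vertex (q a))
            e , _ , br′ = breaks⇒broken i (vertex (q a)) x p br
        in apart a c a≢c (e , br′ , subst (λ v → broken v (copy x i) e ≡ true) eq br′)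
      crowded : ⊥
      crowded =
        let a , c , a≢c , meet = four-meet (copy x i) (vertex ∘ q) vertex-injective
        in apart a c a≢c meet

  -- Serves both as an input, the least one that satisfies `s`, and as a block: flipping it at
  -- `zeros` gives that input.
  star : Term → Input N
  star s = tabulate (one s)

  star-Sat : ∀ s → Sat (star s) s
  star-Sat s p = trans (cong (λ b → if b then zro s p else one s p) (lookup∘tabulate (one s) p)) (agree (one s p) refl)
    where
    agree : ∀ b → one s p ≡ b → (if b then zro s p else one s p) ≡ false
    agree true  h = one⇒¬zro s p h
    agree false h = h

  star-true : ∀ s → dnf (star s) ≡ true
  star-true s = Sat⇒true (star s) s (star-Sat s)

  star-pos : ∀ i t i′ e → lookup (star (i , t)) (pos i′ e) ≡ does (i Fin.≟ i′) ∧ inc t e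
  star-pos i t i′ e = trans (lookup∘tabulate (one (i , t)) (pos i′ e)) (one-pos i t i′ e)

  breaks-at-0 : ∀ i t x e → lookup x (pos i e) ≡ false → inc t e ≡ true → breaks (i , t) x (pos i e) ≡ true
  breaks-at-0 i t x e x≡0 inc≡1 = broken⇒breaks i t x e (broken-0 t (copy x i) x≡0 inc≡1)

  incident : (t : Vec Bool K) → ∃ λ e → inc t e ≡ true
  incident t = let u , h = inc-antipodal t in antipodal u , h

  zeros : Input N
  zeros = replicate N false

  zeros-false : dnf zeros ≡ false
  zeros-false = breaks⇒false zeros λ (i , t) →
    let e , h = incident t in pos i e , breaks-at-0 i t zeros e (lookup-replicate (pos i e) false) h

  star-sensitive : ∀ s → Sensitive dnf zeros (star s)
  star-sensitive s eq = case trans (sym zeros-false) (trans eq (trans (cong dnf (flip-zeros (star s))) (star-true s))) of λ ()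
    where
    flip-zeros : ∀ {m} (B : Subset m) → flipBits (replicate m false) B ≡ B
    flip-zeros []      = refl
    flip-zeros (b ∷ B) = cong (b ∷_) (flip-zeros B)

  star-load : ∀ p → Σ[ terms ] (λ s → 𝟙 (does (p ∈? star s))) ≡ 2
  star-load p = begin
    Σ[ terms ] (λ s → 𝟙 (does (p ∈? star s)))
      ≡⟨ Σ-cong terms (λ s → cong 𝟙 (trans (does-∈? p (star s)) (lookup∘tabulate (one s) p))) ⟩
    Σ[ terms ] (λ s → 𝟙 (one s p))
      ≡⟨ Σ-product _,_ (List.allFin n) (subsets K) (λ s → 𝟙 (one s p)) ⟩
    Σ[ List.allFin n ] (λ i → Σ[ subsets K ] (λ t → 𝟙 (does (i Fin.≟ i₀) ∧ inc t e₀)))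
      ≡⟨ Σ-cong (List.allFin n) (λ i → trans (Σ-cong (subsets K) (λ t → 𝟙-∧ (does (i Fin.≟ i₀)) (inc t e₀)))
           (Σ-*ˡ (𝟙 (does (i Fin.≟ i₀))) (subsets K) (λ t → 𝟙 (inc t e₀)))) ⟩
    Σ[ List.allFin n ] (λ i → 𝟙 (does (i Fin.≟ i₀)) ℕ.* Σ[ subsets K ] (λ t → 𝟙 (inc t e₀)))
      ≡⟨ Σ-cong (List.allFin n) (λ i → cong₂ (λ b d → 𝟙 b ℕ.* d) (≟-comm i i₀) (degree e₀)) ⟩
    Σ[ List.allFin n ] (λ i → 𝟙 (does (i₀ Fin.≟ i)) ℕ.* 2)
      ≡⟨ Σ-allFin-δ i₀ (λ _ → 2) ⟩
    2 ∎
    where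
    open ≡-Reasoning
    i₀ = proj₁ (place p)
    e₀ = proj₂ (place p)
    𝟙-∧ : ∀ a b → 𝟙 (a ∧ b) ≡ 𝟙 a ℕ.* 𝟙 b
    𝟙-∧ true  b = sym (ℕ.+-identityʳ (𝟙 b))
    𝟙-∧ false b = refl
    ≟-comm : ∀ i j → does (i Fin.≟ j) ≡ does (j Fin.≟ i)
    ≟-comm i j with i Fin.≟ j
    ... | yes refl = sym (same i)
    ... | no i≢j   = sym (dec-false (j Fin.≟ i) (i≢j ∘ sym))

  -- This gives the lower bound on block sensitivity. Flipping one mentioned edge falsifies the term
  -- of `t` and makes no other term true: the other copies are empty, and every other vertex of this
  -- copy still lacks the edge given by `private-edge`.
  singleton-sensitive : ∀ i t e → inDomain t e ≡ true → Sensitive dnf (star (i , t)) ⁅ pos i e ⁆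
  singleton-sensitive i t e e∈ eq = case trans (sym (star-true (i , t))) (trans eq (breaks⇒false x′ broken-everywhere)) of λ ()
    where
    x  = star (i , t)
    B  = ⁅ pos i e ⁆
    x′ = flipBits x B
    away : ∀ i′ t′ e′ → pos i′ e′ ≢ pos i e → does (i Fin.≟ i′) ∧ inc t e′ ≡ false → inc t′ e′ ≡ true →
           ∃ λ p → breaks (i′ , t′) x′ p ≡ true
    away i′ t′ e′ p≢ x≡0 inc≡1 = pos i′ e′ ,
      trans (breaks-outside (i′ , t′) x B (λ p∈ → p≢ (x∈⁅y⁆⇒x≡y (pos i e) p∈)))
            (breaks-at-0 i′ t′ x e′ (trans (star-pos i t i′ e′) x≡0) inc≡1)
    flipped : lookup x′ (pos i e) ≡ not (inc t e)
    flipped = trans (lookup-flip x B (pos i e)) (trans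
      (cong₂ _xor_ (trans (star-pos i t i e) (cong (_∧ inc t e) (same i))) ([]=⇒lookup (x∈⁅x⁆ (pos i e))))
      (Bool.xor-comm (inc t e) true))
    own : ∀ a z → a ∨ z ≡ true → (if not a then z else a) ≡ true
    own true  z h = refl
    own false z h = h
    broken-everywhere : ∀ s → ∃ λ p → breaks s x′ p ≡ true
    broken-everywhere (i′ , t′) with i Fin.≟ i′
    ... | no i≢i′ = let e′ , h = incident t′ in
      away i′ t′ e′ (λ p≡ → i≢i′ (sym (proj₁ (pos-injective p≡)))) (cong (_∧ inc t e′) (dec-false (i Fin.≟ i′) i≢i′)) h
    ... | yes refl with t′ ≟ᵥ t
    ... | no t′≢t = let e′ , h , h′ , e′≢e = private-edge e t′≢t in
      away i t′ e′ (λ p≡ → e′≢e (proj₂ (pos-injective p≡))) (trans (cong (_∧ inc t e′) (same i)) h′) h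
    ... | yes refl = pos i e , trans (breaks-pos i t x′ e)
      (trans (cong (λ b → if b then zer t e else inc t e) flipped) (own (inc t e) (zer t e) e∈))

  star-blocks : ∀ i t → HasDisjointSensitiveBlocks dnf (star (i , t)) (length (domain t))
  star-blocks i t =
    (λ a → ⁅ pos i (List.lookup (domain t) a) ⁆) ,
    (λ a → singleton-sensitive i t _ (proj₂ (∈-filter⁻ (λ e → inDomain t e Bool.≟ true) {xs = allEdges K} (∈-lookup a)))) ,
    λ a c a≢c (p , p∈) → let p∈a , p∈c = x∈p∩q⁻ ⁅ pos i (List.lookup (domain t) a) ⁆ ⁅ pos i (List.lookup (domain t) c) ⁆ p∈ in
      a≢c (unique-lookup (domain-unique t) a c (proj₂ (pos-injective (trans (sym (x∈⁅y⁆⇒x≡y _ p∈a)) (x∈⁅y⁆⇒x≡y _ p∈c)))))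

-- Parameters

domainSize-constant : ∀ {k} (s t : Vec Bool k) → domainSize s ≡ domainSize t
domainSize-constant s t = ℕ.*-cancelˡ-≡ _ _ 6 (ℕ.+-cancelʳ-≡ 4 _ _ (trans (domainSize-count s) (sym (domainSize-count t))))

-- The hypothesis is D = (m − 1)(m + 4)/6 for m = 2h, without subtraction or division.
module Growth (D h : ℕ) (quad : 3 ℕ.* D ℕ.+ 2 ≡ 2 ℕ.* (h ℕ.* h) ℕ.+ 3 ℕ.* h) (4≤h : 4 ℕ.≤ h) where

  open ℕ.≤-Reasoning
  open ℕ-Solver

  n r : ℕ
  n = D / 3
  r = D % 3

  D≡ : D ≡ r ℕ.+ n ℕ.* 3
  D≡ = m≡m%n+[m/n]*n D 3

  r≤2 : r ℕ.≤ 2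
  r≤2 = ℕ.≤-pred (m%n<n D 3)

  n*3≤D : n ℕ.* 3 ℕ.≤ D
  n*3≤D = subst (n ℕ.* 3 ℕ.≤_) (sym D≡) (ℕ.m≤n+m (n ℕ.* 3) r)

  D≤ : D ℕ.≤ 2 ℕ.+ n ℕ.* 3
  D≤ = subst (ℕ._≤ 2 ℕ.+ n ℕ.* 3) (sym D≡) (ℕ.+-monoˡ-≤ (n ℕ.* 3) r≤2)

  2≤n : 2 ℕ.≤ n
  2≤n = ℕ.≮⇒≥ λ n<2 → ℕ.<-irrefl refl (begin-strict
    -- `n ≤ 1` would give `D ≤ 5` and thus at most 17 here, while `4 ≤ h` makes the other side at
    -- least 44 = 18 + 26.
    3 ℕ.* D ℕ.+ 2                         ≤⟨ ℕ.+-monoˡ-≤ 2 (ℕ.*-monoʳ-≤ 3 (ℕ.≤-trans D≤ (ℕ.+-monoʳ-≤ 2 (ℕ.*-monoˡ-≤ 3 (ℕ.≤-pred n<2))))) ⟩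
    17                                    <⟨ ℕ.m≤m+n 18 26 ⟩
    2 ℕ.* (4 ℕ.* 4) ℕ.+ 3 ℕ.* 4           ≤⟨ ℕ.+-mono-≤ (ℕ.*-monoʳ-≤ 2 (ℕ.*-mono-≤ 4≤h 4≤h)) (ℕ.*-monoʳ-≤ 3 4≤h) ⟩
    2 ℕ.* (h ℕ.* h) ℕ.+ 3 ℕ.* h           ≡⟨ quad ⟨
    3 ℕ.* D ℕ.+ 2                         ∎)

  -- Ensures that 1-inputs, where the `D` mentioned edges are the hitting set, do not exceed the
  -- optimum found at the empty graph.
  D≤nh : D ℕ.≤ n ℕ.* h
  D≤nh = begin
    D                     ≤⟨ D≤ ⟩
    2 ℕ.+ n ℕ.* 3         ≤⟨ ℕ.+-monoˡ-≤ (n ℕ.* 3) 2≤n ⟩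
    n ℕ.+ n ℕ.* 3         ≡⟨ ℕ.*-suc n 3 ⟨
    n ℕ.* 4               ≤⟨ ℕ.*-monoʳ-≤ n 4≤h ⟩
    n ℕ.* h               ∎

  1≤h : 1 ℕ.≤ h
  1≤h = ℕ.≤-trans (s≤s z≤n) 4≤h

  1≤h² : 1 ℕ.≤ h ℕ.* h
  1≤h² = ℕ.*-mono-≤ 1≤h 1≤h

  h≤D : h ℕ.≤ D
  h≤D = ℕ.*-cancelˡ-≤ 3 (ℕ.+-cancelʳ-≤ 2 _ _ (begin
    3 ℕ.* h ℕ.+ 2                        ≡⟨ ℕ.+-comm (3 ℕ.* h) 2 ⟩
    2 ℕ.+ 3 ℕ.* h                        ≤⟨ ℕ.+-monoˡ-≤ (3 ℕ.* h) (ℕ.*-monoʳ-≤ 2 1≤h²) ⟩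
    2 ℕ.* (h ℕ.* h) ℕ.+ 3 ℕ.* h          ≡⟨ quad ⟨
    3 ℕ.* D ℕ.+ 2                        ∎))

  1≤D : 1 ℕ.≤ D
  1≤D = ℕ.≤-trans 1≤h h≤D

  2h²≤ : 2 ℕ.* (h ℕ.* h) ℕ.≤ 3 ℕ.* D ℕ.+ 2
  2h²≤ = subst (2 ℕ.* (h ℕ.* h) ℕ.≤_) (sym quad) (ℕ.m≤m+n _ _)

  h²≤3D : h ℕ.* h ℕ.≤ 3 ℕ.* D
  h²≤3D = ℕ.*-cancelˡ-≤ 2 (begin
    2 ℕ.* (h ℕ.* h)              ≤⟨ 2h²≤ ⟩
    3 ℕ.* D ℕ.+ 2                ≤⟨ ℕ.+-monoʳ-≤ (3 ℕ.* D) (ℕ.≤-trans (ℕ.*-monoʳ-≤ 2 1≤D) (ℕ.*-monoˡ-≤ D (ℕ.m≤m+n 2 1))) ⟩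
    3 ℕ.* D ℕ.+ 3 ℕ.* D          ≡⟨ cong (3 ℕ.* D ℕ.+_) (sym (ℕ.+-identityʳ _)) ⟩
    2 ℕ.* (3 ℕ.* D)              ∎)

  v C : ℕ
  v = n ℕ.* h
  C = D ^ 3

  C≢0 : ℕ.NonZero C
  C≢0 = ℕ.m^n≢0 D 3 {{ℕ.>-nonZero 1≤D}}

  9n²≤D² : (n ℕ.* 3) ℕ.* (n ℕ.* 3) ℕ.≤ D ℕ.* D
  9n²≤D² = ℕ.*-mono-≤ n*3≤D n*3≤D

  C≡ : C ≡ D ℕ.* D ℕ.* D
  C≡ = solve 1 (λ D → D :* (D :* (D :* con 1)) := D :* D :* D) refl D

  D²h≤C : D ℕ.* D ℕ.* h ℕ.≤ C
  D²h≤C = subst (D ℕ.* D ℕ.* h ℕ.≤_) (sym C≡) (ℕ.*-monoʳ-≤ (D ℕ.* D) h≤D)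

  D²h²≤3C : D ℕ.* D ℕ.* (h ℕ.* h) ℕ.≤ 3 ℕ.* C
  D²h²≤3C = begin
    D ℕ.* D ℕ.* (h ℕ.* h)     ≤⟨ ℕ.*-monoʳ-≤ (D ℕ.* D) h²≤3D ⟩
    D ℕ.* D ℕ.* (3 ℕ.* D)     ≡⟨ solve 1 (λ D → D :* D :* (con 3 :* D) := con 3 :* (D :* D :* D)) refl D ⟩
    3 ℕ.* (D ℕ.* D ℕ.* D)     ≡⟨ cong (3 ℕ.*_) C≡ ⟨
    3 ℕ.* C                   ∎

  -- Together with `lower`: 6v² and D³ agree up to a relative error of 21/h, with the division by
  -- `h` cleared. Here 18v² = 9n²·2h² is at most D²(3D + 2), and the excess 2D² is absorbed because
  -- D²h ≤ D³.
  upper : 6 ℕ.* (v ℕ.* v) ℕ.* h ℕ.≤ C ℕ.* h ℕ.+ 21 ℕ.* C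
  upper = ℕ.*-cancelˡ-≤ 3 (begin
    3 ℕ.* (6 ℕ.* (v ℕ.* v) ℕ.* h)
      ≡⟨ solve 2 (λ n h → con 3 :* (con 6 :* ((n :* h) :* (n :* h)) :* h) :=
                          (n :* con 3) :* (n :* con 3) :* (con 2 :* (h :* h)) :* h) refl n h ⟩
    (n ℕ.* 3) ℕ.* (n ℕ.* 3) ℕ.* (2 ℕ.* (h ℕ.* h)) ℕ.* h
      ≤⟨ ℕ.*-monoˡ-≤ h (ℕ.*-mono-≤ 9n²≤D² 2h²≤) ⟩
    D ℕ.* D ℕ.* (3 ℕ.* D ℕ.+ 2) ℕ.* h
      ≡⟨ solve 2 (λ D h → D :* D :* (con 3 :* D :+ con 2) :* h :=
                          con 3 :* (D :* D :* D :* h) :+ con 2 :* (D :* D :* h)) refl D h ⟩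
    3 ℕ.* (D ℕ.* D ℕ.* D ℕ.* h) ℕ.+ 2 ℕ.* (D ℕ.* D ℕ.* h)
      ≤⟨ ℕ.+-mono-≤ (ℕ.≤-reflexive (cong (λ c → 3 ℕ.* (c ℕ.* h)) (sym C≡))) (ℕ.*-monoʳ-≤ 2 D²h≤C) ⟩
    3 ℕ.* (C ℕ.* h) ℕ.+ 2 ℕ.* C
      -- 63 = 2 + 61 is three times 21; the whole inequality carries a factor 3.
      ≤⟨ ℕ.+-monoʳ-≤ (3 ℕ.* (C ℕ.* h)) (ℕ.*-monoˡ-≤ C (ℕ.m≤m+n 2 61)) ⟩
    3 ℕ.* (C ℕ.* h) ℕ.+ 63 ℕ.* C
      ≡⟨ solve 2 (λ C h → con 3 :* (C :* h) :+ con 63 :* C := con 3 :* (C :* h :+ con 21 :* C)) refl C h ⟩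
    3 ℕ.* (C ℕ.* h ℕ.+ 21 ℕ.* C) ∎)

  D²≤9n²+16n : D ℕ.* D ℕ.≤ (n ℕ.* 3) ℕ.* (n ℕ.* 3) ℕ.+ 16 ℕ.* n
  D²≤9n²+16n = begin
    D ℕ.* D
      ≤⟨ ℕ.*-mono-≤ D≤ D≤ ⟩
    (2 ℕ.+ n ℕ.* 3) ℕ.* (2 ℕ.+ n ℕ.* 3)
      ≡⟨ solve 1 (λ n → (con 2 :+ n :* con 3) :* (con 2 :+ n :* con 3) :=
                        (n :* con 3) :* (n :* con 3) :+ (con 2 :* con 2 :+ con 12 :* n)) refl n ⟩
    (n ℕ.* 3) ℕ.* (n ℕ.* 3) ℕ.+ (2 ℕ.* 2 ℕ.+ 12 ℕ.* n)
      ≤⟨ ℕ.+-monoʳ-≤ ((n ℕ.* 3) ℕ.* (n ℕ.* 3)) (ℕ.+-monoˡ-≤ (12 ℕ.* n) (ℕ.≤-trans (ℕ.*-monoʳ-≤ 2 2≤n) (ℕ.*-monoˡ-≤ n (ℕ.m≤m+n 2 2)))) ⟩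
    (n ℕ.* 3) ℕ.* (n ℕ.* 3) ℕ.+ (4 ℕ.* n ℕ.+ 12 ℕ.* n)
      ≡⟨ cong ((n ℕ.* 3) ℕ.* (n ℕ.* 3) ℕ.+_) (sym (ℕ.*-distribʳ-+ n 4 12)) ⟩
    (n ℕ.* 3) ℕ.* (n ℕ.* 3) ℕ.+ 16 ℕ.* n ∎

  3D≤ : 3 ℕ.* D ℕ.≤ 2 ℕ.* (h ℕ.* h) ℕ.+ 3 ℕ.* h
  3D≤ = subst (3 ℕ.* D ℕ.≤_) quad (ℕ.m≤m+n (3 ℕ.* D) 2)

  -- Two losses occur, after multiplication by 3: rounding `n` down costs 16·3n·D·h, at most 16D³,
  -- and the linear term 3h in `3D≤` costs 3·9n²·h², at most 9D³. Their sum 25 is below 63 = 3·21.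
  lower : C ℕ.* h ℕ.≤ 6 ℕ.* (v ℕ.* v) ℕ.* h ℕ.+ 21 ℕ.* C
  lower = ℕ.*-cancelˡ-≤ 3 (begin
    3 ℕ.* (C ℕ.* h)
      ≡⟨ cong (λ c → 3 ℕ.* (c ℕ.* h)) C≡ ⟩
    3 ℕ.* (D ℕ.* D ℕ.* D ℕ.* h)
      ≡⟨ solve 2 (λ D h → con 3 :* (D :* D :* D :* h) := D :* D :* (con 3 :* D) :* h) refl D h ⟩
    D ℕ.* D ℕ.* (3 ℕ.* D) ℕ.* h
      ≤⟨ ℕ.*-monoˡ-≤ h (ℕ.*-monoˡ-≤ (3 ℕ.* D) D²≤9n²+16n) ⟩
    (a ℕ.+ 16 ℕ.* n) ℕ.* (3 ℕ.* D) ℕ.* h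
      ≡⟨ solve 4 (λ a n D h → (a :+ con 16 :* n) :* (con 3 :* D) :* h :=
                              a :* (con 3 :* D) :* h :+ con 16 :* (n :* con 3 :* D :* h)) refl a n D h ⟩
    a ℕ.* (3 ℕ.* D) ℕ.* h ℕ.+ 16 ℕ.* (n ℕ.* 3 ℕ.* D ℕ.* h)
      ≤⟨ ℕ.+-mono-≤ (ℕ.*-monoˡ-≤ h (ℕ.*-monoʳ-≤ a 3D≤))
           (ℕ.*-monoʳ-≤ 16 (ℕ.≤-trans (ℕ.*-monoˡ-≤ h (ℕ.*-monoˡ-≤ D n*3≤D)) D²h≤C)) ⟩
    a ℕ.* (2 ℕ.* (h ℕ.* h) ℕ.+ 3 ℕ.* h) ℕ.* h ℕ.+ 16 ℕ.* C
      ≡⟨ cong (ℕ._+ 16 ℕ.* C) (solve 2 (λ a h → a :* (con 2 :* (h :* h) :+ con 3 :* h) :* h :=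
                              a :* (con 2 :* (h :* h)) :* h :+ con 3 :* (a :* (h :* h))) refl a h) ⟩
    a ℕ.* (2 ℕ.* (h ℕ.* h)) ℕ.* h ℕ.+ 3 ℕ.* (a ℕ.* (h ℕ.* h)) ℕ.+ 16 ℕ.* C
      ≤⟨ ℕ.+-monoˡ-≤ (16 ℕ.* C) (ℕ.+-monoʳ-≤ (a ℕ.* (2 ℕ.* (h ℕ.* h)) ℕ.* h)
           (ℕ.*-monoʳ-≤ 3 (ℕ.≤-trans (ℕ.*-monoˡ-≤ (h ℕ.* h) 9n²≤D²) D²h²≤3C))) ⟩
    a ℕ.* (2 ℕ.* (h ℕ.* h)) ℕ.* h ℕ.+ 3 ℕ.* (3 ℕ.* C) ℕ.+ 16 ℕ.* C
      ≡⟨ solve 3 (λ n h C → (n :* con 3) :* (n :* con 3) :* (con 2 :* (h :* h)) :* h :+ con 3 :* (con 3 :* C) :+ con 16 :* C :=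
                            con 3 :* (con 6 :* ((n :* h) :* (n :* h)) :* h) :+ con 25 :* C) refl n h C ⟩
    3 ℕ.* (6 ℕ.* (v ℕ.* v) ℕ.* h) ℕ.+ 25 ℕ.* C
      ≤⟨ ℕ.+-monoʳ-≤ (3 ℕ.* (6 ℕ.* (v ℕ.* v) ℕ.* h)) (ℕ.*-monoˡ-≤ C (ℕ.m≤m+n 25 38)) ⟩
    3 ℕ.* (6 ℕ.* (v ℕ.* v) ℕ.* h) ℕ.+ 63 ℕ.* C
      ≡⟨ solve 2 (λ x C → con 3 :* x :+ con 63 :* C := con 3 :* (x :+ con 21 :* C)) refl (6 ℕ.* (v ℕ.* v) ℕ.* h) C ⟩
    3 ℕ.* (6 ℕ.* (v ℕ.* v) ℕ.* h ℕ.+ 21 ℕ.* C) ∎)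
    where
    a = (n ℕ.* 3) ℕ.* (n ℕ.* 3)

-- The family: `3 ℕ.+ κ` bits, so that half the number of vertices is at least 4

module Family (κ : ℕ) where

  origin : Vec Bool (3 ℕ.+ κ)
  origin = replicate (3 ℕ.+ κ) false

  -- From here on `D` is known only through its quadratic equation and its independence of the
  -- vertex.
  abstract
    D : ℕ
    D = domainSize origin

    domainSize≡D : ∀ t → domainSize {3 ℕ.+ κ} t ≡ D
    domainSize≡D t = domainSize-constant t origin

    quad : 3 ℕ.* D ℕ.+ 2 ≡ 2 ℕ.* (2 ^ (2 ℕ.+ κ) ℕ.* 2 ^ (2 ℕ.+ κ)) ℕ.+ 3 ℕ.* 2 ^ (2 ℕ.+ κ)
    quad = halve D (2 ^ (2 ℕ.+ κ)) (domainSize-count origin)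
      where
      open ℕ-Solver
      halve : ∀ D h → 6 ℕ.* D ℕ.+ 4 ≡ 2 ℕ.* h ℕ.* (2 ℕ.* h) ℕ.+ 3 ℕ.* (2 ℕ.* h) → 3 ℕ.* D ℕ.+ 2 ≡ 2 ℕ.* (h ℕ.* h) ℕ.+ 3 ℕ.* h
      halve D h e = ℕ.*-cancelˡ-≡ _ _ 2 (trans (solve 1 (λ D → con 2 :* (con 3 :* D :+ con 2) := con 6 :* D :+ con 4) refl D)
        (trans e (solve 1 (λ h → con 2 :* h :* (con 2 :* h) :+ con 3 :* (con 2 :* h) := con 2 :* (con 2 :* (h :* h) :+ con 3 :* h)) refl h)))

  1≤2^ : ∀ n → 1 ℕ.≤ 2 ^ n
  1≤2^ n = ℕ.>-nonZero⁻¹ (2 ^ n) {{ℕ.m^n≢0 2 n}}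

  n<2^n : ∀ n → n ℕ.< 2 ^ n
  n<2^n zero    = s≤s z≤n
  n<2^n (suc n) = ℕ.≤-trans (ℕ.+-mono-≤ (1≤2^ n) (n<2^n n)) (ℕ.+-monoʳ-≤ (2 ^ n) (ℕ.m≤m+n (2 ^ n) 0))

  4≤h : 4 ℕ.≤ 2 ^ (2 ℕ.+ κ)
  4≤h = subst (4 ℕ.≤_) (ℕ.*-assoc 2 2 (2 ^ κ)) (ℕ.*-monoʳ-≤ 4 (1≤2^ κ))

  open Growth D (2 ^ (2 ℕ.+ κ)) quad 4≤h public
  open Copies n (suc κ) public hiding (h)

  κ≤h : κ ℕ.≤ 2 ^ (2 ℕ.+ κ)
  κ≤h = ℕ.≤-trans (ℕ.m≤n+m κ 2) (ℕ.<⇒≤ (n<2^n (2 ℕ.+ κ)))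

  κ≤D : κ ℕ.≤ D
  κ≤D = ℕ.≤-trans κ≤h h≤D

  first : Fin n
  first = Fin.fromℕ< (ℕ.<-≤-trans (s≤s z≤n) 2≤n)

  1≤N : 1 ℕ.≤ N
  1≤N = ℕ.≤-trans (s≤s z≤n) (Fin.toℕ<n (pos first (proj₁ (incident origin))))

  hits : ∀ x → ∃ λ T → length T ℕ.≤ v × Hits dnf x T
  hits x = by-value (dnf x) refl
    where
    by-value : ∀ b → dnf x ≡ b → ∃ λ T → length T ℕ.≤ v × Hits dnf x T
    by-value false fx = hits-0 (ℕ.≤-trans (ℕ.m≤m+n 3 1) 4≤h) x fx
    by-value true  fx =
      let T , (t , len) , hit = hits-1 x fx
      in T , ℕ.≤-trans (ℕ.≤-reflexive (trans len (domainSize≡D t))) D≤nh , hit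

  blocks≤D : ∀ x b → HasDisjointSensitiveBlocks dnf x b → b ℕ.≤ D
  blocks≤D x b blocks = by-value (dnf x) refl
    where
    by-value : ∀ c → dnf x ≡ c → b ℕ.≤ D
    by-value false fx = ℕ.≤-trans (blocks-0 x fx b blocks) n*3≤D
    by-value true  fx =
      let T , (t , len) , hit = hits-1 x fx
      in ℕ.≤-trans (hits⇒blocks≤ dnf x T hit b blocks) (ℕ.≤-reflexive (trans len (domainSize≡D t)))

  isBs : IsBs dnf D
  isBs = (star (first , origin) ,
          subst (HasDisjointSensitiveBlocks dnf (star (first , origin)))
            (trans (length-domain origin) (domainSize≡D origin)) (star-blocks first origin) ,
          blocks≤D (star (first , origin))) ,
         λ { b (x , blocks , _) → blocks≤D x b blocks }

  objective≤v : ∀ x u → (∃ λ w → Feasible dnf x w × objective dnf x w ≃ u) → u ≤ fromℕ v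
  objective≤v x u (w , feasible , obj≃u) =
    let T , len , hit = hits x
    in ≤-trans {u} {objective dnf x w} {fromℕ v} (≃⇒≥ {objective dnf x w} {u} obj≃u)
         (≤-trans {objective dnf x w} {fromℕ (length T)} {fromℕ v}
           (hits⇒objective≤ dnf x w feasible T hit)
           (pointwise-≤ {fromℕ (length T)} {fromℕ v} λ _ → ι-mono len))

  module Stars = HalfWeights dnf zeros terms star star-sensitive (λ p → ℕ.≤-reflexive (star-load p))

  isFbs : IsFbs dnf (fromℕ v)
  isFbs = (zeros , (Stars.halfWeight , Stars.halfWeight-feasible , Stars.halfWeight-objective v length-terms) ,
           objective≤v zeros) ,
          λ { u (x , attained , _) → objective≤v x u attained }

theorem1 : Σ (ℕ → ℕ) λ n →
    Σ (∀ k → BoolFun (n k)) λ f →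
    Σ (ℕ → ℕ) λ bs →
    Σ (ℕ → ℝ) λ fbs →
    Σ (ℕ → ℝ) λ ε →
    (∀ k → 1 ℕ.≤ n k) ×
    (∀ k → IsBs (f k) (bs k)) ×
    (∀ k → IsFbs (f k) (fbs k)) ×
    (ε ⟶ 0ℝ) ×
    (bs ⟶∞) ×
    (∀ k → fbs k ≃ (1/√ 6 - ε k) * (bs k ^3/2))
theorem1 =
  N , dnf , D , (λ k → fromℕ (v k)) ,
  (λ k → 1/√ 6 - ratio (v k) (C k) {{C≢0 k}}) ,
  1≤N , isBs , isFbs ,
  ratio-limit v C (λ k → 2 ^ (2 ℕ.+ k)) C≢0 κ≤h lower upper ,
  (λ M → M , λ k M≤k → ℕ.≤-trans M≤k (κ≤D k)) ,
  λ k → ratio-* (v k) (C k) {{C≢0 k}} (1/√ 6)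
  where open Family
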